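{- Let $p\in\mathbb Z_{\ge0}$. For every $t>0$ and $\alpha>0$, as $N\to\infty$, $$Z_{\alpha,N}(t)=\frac{\Theta_\alpha(t)}{\phi(q_t)^2}\sum_{r=0}^{p}\frac{(-t)^r}{r!\,(N+\alpha-1)^r}\,\mathbb E\bigl[F_\alpha(\mu,\nu,M)^r\bigr]+O_{t,\alpha,p}\bigl((N+\alpha-1)^{ -p-1}\bigr),$$ and the estimate is locally uniform in $(t,\alpha)\in(0,\infty)^2$ (i.e. uniform on compact subsets).
   Context: For $N\ge1$ and $\alpha>0$ let $\widehat{\mathrm U(N)}=\{\lambda\in\mathbb Z^N:\lambda_1\ge\dots\ge\lambda_N\}$ and $$\kappa_{\alpha,N}(\lambda)=\frac1{N+\alpha-1}\Bigl(\alpha\sum_{i=1}^N\lambda_i^2+\sum_{i=1}^N(N+1-2i)\lambda_i\Bigr).$$ The Jack heat trace is $Z_{\alpha,N}(t)=\sum_{\lambda\in\widehat{\mathrm U(N)}}e^{ -\frac t2\kappa_{\alpha,N}(\lambda)}$. (It is the trace of $e^{\frac t2\mathscr L_{\alpha,N}}$ on the symmetric functions in $L^2(\mathbb T^N,\prod_{i<j}|e^{\mathrm i\theta_i}-e^{\mathrm i\theta_j}|^{2/\alpha}d\theta)$, where $\mathscr L_{\alpha,N}$ is the self-adjoint closure, from symmetric Laurent polynomials, of $\frac{\alpha}{N+\alpha-1}\sum_i\partial_{\theta_i}^2+\frac1{N+\alpha-1}\sum_{i<j}\cot\frac{\theta_i-\theta_j}2(\partial_{\theta_i}-\partial_{\theta_j})$,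 whose eigenvalues are $-\kappa_{\alpha,N}(\lambda)$.) For a partition $\lambda$, $|\lambda|$ is its size and $\mathsf C_\alpha(\lambda)=\sum_{(i,j)\in\lambda}(\alpha(j-1)-(i-1))$. For partitions $\mu,\nu$ and $m\in\mathbb Z$, $$F_\alpha(\mu,\nu,m)=\mathsf C_\alpha(\mu)+\mathsf C_\alpha(\nu)+\alpha m(|\mu|-|\nu|)-\tfrac{\alpha(\alpha-1)}2m^2.$$ Put $q_t=e^{ -t/2}$, $\phi(q)=\prod_{k\ge1}(1-q^k)$, $\Theta_\alpha(t)=\sum_{m\in\mathbb Z}e^{ -t\alpha m^2/2}$. The expectation $\mathbb E$ is over independent $\mu,\nu,M$, where $\mu,\nu$ are random partitions with $\mathbb P(\mu=\lambda)=\phi(q_t)q_t^{|\lambda|}$ for every partition $\lambda$, and $M$ is a random integer with $\mathbb P(M=m)=e^{ -t\alpha m^2/2}/\Theta_\alpha(t)$. -}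

module Defs where

open import Algebra.Bundles using (CommutativeRing; Semiring)
import Algebra.Construct.NaturalChoice.Max as Max
import Algebra.Definitions.RawSemiring as RawSemiringDefs
open import Axiom.ExcludedMiddle using (ExcludedMiddle)
open import Data.Fin.Base using (Fin; toℕ)
open import Data.Integer.Base as ℤ using (ℤ; +_; -[1+_])
open import Data.List.Base as List using (List)
open import Data.List.Relation.Binary.Subset.Propositional using (_⊆_)
open import Data.List.Relation.Unary.All using (All)
open import Data.List.Relation.Unary.Any using (Any)
open import Data.List.Relation.Unary.Linked using (Linked)
open import Data.List.Relation.Unary.Unique.Propositional using (Unique)
open import Data.Nat.Base as ℕ using (ℕ; suc; _!)
open import Data.Product.Base using (_×_; _,_; ∃; ∃-syntax; Σ-syntax)
open import Data.Refinement.Base using (Refinement; value)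
open import Data.Vec.Base as Vec using (Vec)
import Data.Vec.Relation.Unary.Linked as Vec
open import Level using (0ℓ) renaming (suc to lsuc)
open import Relation.Binary.Bundles using (TotalOrder)
open import Relation.Binary.Core using (Rel)
import Relation.Binary.Construct.NonStrictToStrict as ToStrict
open import Relation.Binary.Structures using (IsTotalOrder)
open import Relation.Nullary.Decidable using (yes; no)
open import Relation.Unary using (Pred; _∈_)

-- The real numbers, by their classical axioms: a Dedekind-complete ordered
-- field, which is unique up to isomorphism.  Equality is a setoid equality, so
-- that (with excluded middle) ordinary constructions of ℝ, such as Cauchy
-- sequences of rationals, are instances.
record CompleteOrderedField : Set (lsuc 0ℓ) where
  infix  4 _≤_
  infixl 10 _⁻¹
  field
    commutativeRing : CommutativeRing 0ℓ 0ℓ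

  open CommutativeRing commutativeRing public renaming (Carrier to ℝ)

  field
    0≉1           : 0# ≉ 1#
    -- The value of 0# ⁻¹ is unconstrained.
    _⁻¹           : ℝ → ℝ
    ⁻¹-inverseʳ   : ∀ x → x ≉ 0# → x * x ⁻¹ ≈ 1#
    _≤_           : Rel ℝ 0ℓ
    isTotalOrder  : IsTotalOrder _≈_ _≤_
    +-monoʳ-≤     : ∀ z {x y} → x ≤ y → z + x ≤ z + y
    *-nonNeg      : ∀ {x y} → 0# ≤ x → 0# ≤ y → 0# ≤ x * y

  UpperBound : Pred ℝ 0ℓ → Pred ℝ 0ℓ
  UpperBound P b = ∀ x → x ∈ P → x ≤ b

  field
    supremum : (P : Pred ℝ 0ℓ) → ∃ P → ∃ (UpperBound P) →
               ∃[ s ] (s ∈ UpperBound P × (∀ b → b ∈ UpperBound P → s ≤ b))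

  totalOrder : TotalOrder 0ℓ 0ℓ 0ℓ
  totalOrder = record { isTotalOrder = isTotalOrder }

  open ToStrict _≈_ _≤_ public using (_<_)
  open Max totalOrder public using (_⊔_)
  -- `sum` and `product` are over finite families Fin n → ℝ.
  open RawSemiringDefs (Semiring.rawSemiring semiring) public using (_^_; sum; product)
  private module Mult = RawSemiringDefs (Semiring.rawSemiring semiring)

  infixl 7 _/_
  _/_ : ℝ → ℝ → ℝ
  x / y = x * y ⁻¹

  ∣_∣ : ℝ → ℝ
  ∣ x ∣ = x ⊔ - x

  fromℕ : ℕ → ℝ
  fromℕ n = n Mult.× 1#

  fromℤ : ℤ → ℝ
  fromℤ (+ n)    = fromℕ n
  fromℤ -[1+ n ] = - fromℕ (suc n)

  Open : Pred (ℝ × ℝ) 0ℓ → Set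
  Open U = ∀ x y → (x , y) ∈ U →
    ∃[ ε ] (0# < ε × (∀ x′ y′ → ∣ x′ - x ∣ < ε → ∣ y′ - y ∣ < ε → (x′ , y′) ∈ U))

  Compact : Pred (ℝ × ℝ) 0ℓ → Set (lsuc 0ℓ)
  Compact K = (I : Set) (U : I → Pred (ℝ × ℝ) 0ℓ) → (∀ i → Open (U i)) →
    (∀ z → z ∈ K → ∃[ i ] z ∈ U i) →
    Σ[ is ∈ List I ] (∀ z → z ∈ K → Any (λ i → z ∈ U i) is)

  ConvergesTo : (ℕ → ℝ) → ℝ → Set
  ConvergesTo s L = ∀ ε → 0# < ε → ∃[ n₀ ] (∀ n → n₀ ℕ.≤ n → ∣ s n - L ∣ < ε)

  ∑ : {A : Set} → (A → ℝ) → List A → ℝ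
  ∑ f as = List.foldr (λ a s → f a + s) 0# as

  -- Unconditional summation over an arbitrary index type: the net of sums over
  -- finite subsets (lists without repetition) converges to S.
  HasSum : {A : Set} → (A → ℝ) → ℝ → Set
  HasSum {A} f S = ∀ ε → 0# < ε →
    Σ[ as₀ ∈ List A ] (∀ as → Unique as → as₀ ⊆ as → ∣ ∑ f as - S ∣ < ε)

-- A partition is its list of nonzero parts.  Proofs in a Refinement are
-- irrelevant, so partitions (and signatures) are equal iff their parts are.
Partition : Set
Partition = Refinement (List ℕ) (λ parts → Linked ℕ._≥_ parts × All (0 ℕ.<_) parts)

size : Partition → ℕ
size μ = List.sum (value μ)

Signature : ℕ → Set
Signature N = Refinement (Vec ℤ N) (Vec.Linked ℤ._≥_)

-- Excluded middle is used to make limits and infinite sums total, with value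
-- 0# in case of divergence.
module JackHeatTrace (lem : ExcludedMiddle 0ℓ) (reals : CompleteOrderedField) where

  open CompleteOrderedField reals public

  choose : Pred ℝ 0ℓ → ℝ
  choose P with lem {∃ P}
  ... | yes (x , _) = x
  ... | no _        = 0#

  lim : (ℕ → ℝ) → ℝ
  lim s = choose (ConvergesTo s)

  tsum : {A : Set} → (A → ℝ) → ℝ
  tsum f = choose (HasSum f)

  exp : ℝ → ℝ
  exp x = tsum λ k → x ^ k / fromℕ (k !)

  2# : ℝ
  2# = fromℕ 2

  -- With i = 1 + toℕ k, the coefficient N + 1 - 2i is N - 1 - 2 toℕ k.
  κ : ℝ → (N : ℕ) → Signature N → ℝ
  κ α N ƛ = (α * sum (λ k → part k ^ 2) + sum (λ k → coeff k * part k))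
            / (fromℕ N + α - 1#)
    where
    part coeff : Fin N → ℝ
    part k  = fromℤ (Vec.lookup (value ƛ) k)
    coeff k = fromℕ N - 1# - 2# * fromℕ (toℕ k)

  Z : ℝ → ℕ → ℝ → ℝ
  Z α N t = tsum λ (ƛ : Signature N) → exp (- (t / 2#) * κ α N ƛ)

  -- Rows and columns are counted from 0, so the box in row i and column j has
  -- content α j - i.
  content : ℝ → Partition → ℝ
  content α μ = sum λ (i : Fin (List.length (value μ))) →
                sum λ (j : Fin (List.lookup (value μ) i)) →
                α * fromℕ (toℕ j) - fromℕ (toℕ i)

  F : ℝ → Partition → Partition → ℤ → ℝ
  F α μ ν m = content α μ + content α ν
              + α * fromℤ m * (fromℕ (size μ) - fromℕ (size ν))
              - α * (α - 1#) / 2# * fromℤ m ^ 2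

  q : ℝ → ℝ
  q t = exp (- (t / 2#))

  φ : ℝ → ℝ
  φ x = lim λ n → product λ (k : Fin n) → 1# - x ^ suc (toℕ k)

  gauss : ℝ → ℝ → ℤ → ℝ
  gauss α t m = exp (- (t * α * fromℤ m ^ 2 / 2#))

  Θ : ℝ → ℝ → ℝ
  Θ α t = tsum (gauss α t)

  partitionLaw : ℝ → Partition → ℝ
  partitionLaw t μ = φ (q t) * q t ^ size μ

  integerLaw : ℝ → ℝ → ℤ → ℝ
  integerLaw α t m = gauss α t m / Θ α t

  -- Expectation of g(μ, ν, M); by independence, the joint mass function is the
  -- product of the three marginal ones.
  𝔼 : ℝ → ℝ → (Partition → Partition → ℤ → ℝ) → ℝ
  𝔼 α t g = tsum λ ((μ , ν , m) : Partition × Partition × ℤ) →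
    partitionLaw t μ * partitionLaw t ν * integerLaw α t m * g μ ν m

{-# OPTIONS --safe #-}
-- A signature of length N is m + μᵢ - ν_{N-1-i} for an integer m, its entry at
-- position ⌊N/2⌋, and two partitions μ, ν with at most about N/2 parts.  In these
-- terms κ = |μ| + |ν| + α m² + 2F/c with c = N + α - 1, so that the summand of the
-- heat trace is the weight exp (-t/2 (|μ| + |ν| + α m²)) times exp (-tF/c), and the
-- expansion is Taylor's theorem for the second factor.
--
-- The remainder |exp x - T_p(x)| ≤ D |x|^(p+1) (1 + exp x) at x = -tF/c is summable
-- uniformly in N because, besides the weight, the summand exp (-tκ/2) itself is at
-- most ρ^s, where s = |μ| + |ν| + |m| and ρ < 1 is uniform: by Chebyshev's sum
-- inequality and since each partition occupies at most half of the rows,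
-- 2cκ ≥ N (|μ| + |ν| + α m²), while c ≤ (1 + α) N.  Triples not arising from a
-- signature have 2s ≥ N, hence 1 ≤ (2(1 + α)s/c)^(p+1), and contribute to the same
-- order.  All bounds are polynomial in s times ρ^s, and ∑_μ σ^|μ| is finite because
-- the partial products ∏ (1 - σ^k) are bounded away from 0; this also gives φ > 0.
module Submission where

open import Defs
import Algebra.Construct.NaturalChoice.Max
import Algebra.Properties.AbelianGroup
import Algebra.Properties.CommutativeSemiring.Binomial
import Algebra.Properties.CommutativeSemiring.Exp
import Algebra.Properties.Ring
import Algebra.Properties.Semiring.Mult
import Algebra.Properties.Semiring.Sum
import Algebra.Solver.Ring
open import Algebra.Solver.Ring.AlmostCommutativeRing
  using (fromCommutativeRing; _-Raw-AlmostCommutative⟶_)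
open import Axiom.ExcludedMiddle using (ExcludedMiddle)
open import Data.Bool.Base using (Bool; true; false)
open import Data.Empty using (⊥-elim-irr)
open import Data.Fin.Base as Fin using (Fin; zero; suc; toℕ)
import Data.Fin.Properties as Fin
open import Data.Integer.Base as ℤ using (ℤ; +_; -[1+_])
import Data.Integer.Properties as ℤ
open import Data.Irrelevant using ([_])
open import Data.List.Base as List
  using (List; []; _∷_; _++_; upTo; applyUpTo; map; concatMap; cartesianProduct; deduplicate)
import Data.List.Membership.Propositional as Membership
import Data.List.Membership.Propositional.Properties as Membership
open import Data.List.Relation.Binary.Permutation.Propositional as Perm using (_↭_; ↭-trans)
import Data.List.Relation.Binary.Permutation.Propositional.Properties as Perm
open import Data.List.Relation.Binary.Subset.Propositional using (_⊆_)
open import Data.List.Relation.Unary.All as All using (All; []; _∷_)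
open import Data.List.Relation.Unary.AllPairs using ([]; _∷_)
open import Data.List.Relation.Unary.Any as Any using (Any; here; there)
open import Data.List.Relation.Unary.Linked using (Linked; []; [-]; _∷_)
open import Data.List.Relation.Unary.Unique.Propositional using (Unique)
import Data.List.Relation.Unary.Unique.DecPropositional.Properties as DecUnique
import Data.List.Relation.Unary.Unique.Propositional.Properties as Unique
open import Data.Maybe.Base using (Maybe; just; nothing)
open import Data.Nat.Base as ℕ using (ℕ; zero; suc; _!; z≤n; s≤s; _∸_)
import Data.Nat.DivMod as ℕ
import Data.Nat.ListAction as ℕ
import Data.Nat.Properties as ℕ
open import Data.Product.Base using (_×_; _,_; ∃; ∃-syntax; Σ-syntax; proj₁; proj₂)
open import Data.Refinement.Base using (Refinement; value; _,_)
open import Data.Sum.Base using (inj₁; inj₂)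
open import Data.Vec.Base as Vec using (Vec; []; _∷_)
import Data.Vec.Properties as Vec
import Data.Vec.Relation.Unary.Linked as VecLinked
open import Function.Base using (_∘_; id; case_of_)
open import Level using (0ℓ)
open import Relation.Binary.Bundles using (TotalOrder)
import Relation.Binary.Construct.NonStrictToStrict
open import Relation.Binary.Definitions using (tri<; tri≈; tri>)
open import Relation.Binary.PropositionalEquality.Core as ≡ using (_≡_)
import Relation.Binary.Reasoning.PartialOrder
import Relation.Binary.Reasoning.Setoid
open import Relation.Nullary.Decidable using (Dec; yes; no)
open import Relation.Nullary.Negation using (¬_; contradiction)
open import Relation.Unary using (Pred; _∈_)

open Algebra.Properties.AbelianGroup ℤ.+-0-abelianGroup using (∙-cancelˡ)

-- The difficulty is that F is quadratic in the sizes while the weight decays only exponentially. A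
-- column of n boxes has content -n(n-1)/2, so its weight times exp (-tF/c) grows without bound once
-- n exceeds c + 1: over all triples this product is summable for no N. Polynomials in F are
-- summable. Hence the Taylor polynomial is summed over all triples, and the exponential only over
-- those that come from signatures. There a bound by exp |x| would be useless; with 1 + exp x the
-- exponential recombines with the weight. Cutting the rows in the middle is what keeps the result
-- decaying: a partition confined to half of the rows cannot have content negative enough to cancel
-- its size.
--
-- `lim` and `tsum` default to `0#`, so a sum has to be proved convergent before its value means
-- anything. Convergence comes from bounds on the finite sums of a nonnegative majorant. The bound
-- for the majorant of the error depends only on p and on R with 1/R ≤ t, α ≤ R, which makes the
-- constant uniform.

module Expansion (lem : ExcludedMiddle 0ℓ) (reals : CompleteOrderedField) where

  open JackHeatTrace lem reals

  open Algebra.Properties.Ring ring public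
    using (-‿involutive; -‿+-comm; -0#≈0#; -‿distribˡ-*; -‿distribʳ-*)
  open Algebra.Properties.CommutativeSemiring.Exp commutativeSemiring public
    using (^-congˡ; ^-homo-*; ^-distrib-*; ^-assocʳ)
  open TotalOrder totalOrder public using (poset; total)
    renaming (refl to ≤-refl; reflexive to ≤-reflexive; trans to ≤-trans; antisym to ≤-antisym)
  module ≤-Reasoning = Relation.Binary.Reasoning.PartialOrder poset
  module ≈-Reasoning = Relation.Binary.Reasoning.Setoid setoid
  module Max = Algebra.Construct.NaturalChoice.Max totalOrder
  module ToStrict = Relation.Binary.Construct.NonStrictToStrict _≈_ _≤_

  -- Embedding of ℕ and ℤ, and the ring solver

  fromℕ-+ : ∀ m n → fromℕ (m ℕ.+ n) ≈ fromℕ m + fromℕ n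
  fromℕ-+ = Algebra.Properties.Semiring.Mult.×-homo-+ semiring 1#

  fromℕ-* : ∀ m n → fromℕ (m ℕ.* n) ≈ fromℕ m * fromℕ n
  fromℕ-* = Algebra.Properties.Semiring.Mult.×1-homo-* semiring

  fromℤ-neg : ∀ i → fromℤ (ℤ.- i) ≈ - fromℤ i
  fromℤ-neg (+ zero)  = sym -0#≈0#
  fromℤ-neg (+ suc n) = refl
  fromℤ-neg -[1+ n ]  = sym (-‿involutive _)

  fromℤ-⊖ : ∀ m n → fromℤ (m ℤ.⊖ n) ≈ fromℕ m - fromℕ n
  fromℤ-⊖ zero    zero    = sym (-‿inverseʳ 0#)
  fromℤ-⊖ zero    (suc n) = sym (+-identityˡ _)
  fromℤ-⊖ (suc m) zero    = sym (trans (+-congˡ -0#≈0#) (+-identityʳ _))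
  fromℤ-⊖ (suc m) (suc n) = begin
    fromℤ (suc m ℤ.⊖ suc n)               ≡⟨ ≡.cong fromℤ (ℤ.[1+m]⊖[1+n]≡m⊖n m n) ⟩
    fromℤ (m ℤ.⊖ n)                       ≈⟨ fromℤ-⊖ m n ⟩
    fromℕ m - fromℕ n                     ≈⟨ +-congʳ (+-identityˡ _) ⟨
    0# + fromℕ m - fromℕ n                ≈⟨ +-congʳ (+-congʳ (-‿inverseʳ 1#)) ⟨
    1# - 1# + fromℕ m - fromℕ n           ≈⟨ +-congʳ (+-assoc _ _ _) ⟩
    1# + (- 1# + fromℕ m) - fromℕ n       ≈⟨ +-congʳ (+-congˡ (+-comm _ _)) ⟩
    1# + (fromℕ m - 1#) - fromℕ n         ≈⟨ +-congʳ (+-assoc _ _ _) ⟨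
    1# + fromℕ m - 1# - fromℕ n           ≈⟨ +-assoc _ _ _ ⟩
    1# + fromℕ m + (- 1# - fromℕ n)       ≈⟨ +-congˡ (-‿+-comm 1# (fromℕ n)) ⟩
    1# + fromℕ m - (1# + fromℕ n)         ∎
    where open ≈-Reasoning

  fromℤ-+ : ∀ i j → fromℤ (i ℤ.+ j) ≈ fromℤ i + fromℤ j
  fromℤ-+ (+ m)    (+ n)    = fromℕ-+ m n
  fromℤ-+ (+ m)    -[1+ n ] = fromℤ-⊖ m (suc n)
  fromℤ-+ -[1+ m ] (+ n)    = trans (fromℤ-⊖ n (suc m)) (+-comm _ _)
  fromℤ-+ -[1+ m ] -[1+ n ] = begin
    - fromℕ (suc (suc (m ℕ.+ n)))         ≡⟨ ≡.cong (λ k → - fromℕ (suc k)) (ℕ.+-suc m n) ⟨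
    - fromℕ (suc m ℕ.+ suc n)             ≈⟨ -‿cong (fromℕ-+ (suc m) (suc n)) ⟩
    - (fromℕ (suc m) + fromℕ (suc n))     ≈⟨ -‿+-comm _ _ ⟨
    - fromℕ (suc m) - fromℕ (suc n)       ∎
    where open ≈-Reasoning

  fromℤ-pos-* : ∀ m j → fromℤ (+ m ℤ.* j) ≈ fromℕ m * fromℤ j
  fromℤ-pos-* m (+ n) = trans (reflexive (≡.cong fromℤ (≡.sym (ℤ.pos-* m n)))) (fromℕ-* m n)
  fromℤ-pos-* m -[1+ n ] = begin
    fromℤ (+ m ℤ.* -[1+ n ])              ≡⟨ ≡.cong fromℤ (ℤ.neg-distribʳ-* (+ m) (+ suc n)) ⟨
    fromℤ (ℤ.- (+ m ℤ.* + suc n))         ≈⟨ fromℤ-neg (+ m ℤ.* + suc n) ⟩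
    - fromℤ (+ m ℤ.* + suc n)             ≈⟨ -‿cong (fromℤ-pos-* m (+ suc n)) ⟩
    - (fromℕ m * fromℕ (suc n))           ≈⟨ -‿distribʳ-* _ _ ⟩
    fromℕ m * - fromℕ (suc n)             ∎
    where open ≈-Reasoning

  fromℤ-* : ∀ i j → fromℤ (i ℤ.* j) ≈ fromℤ i * fromℤ j
  fromℤ-* (+ m)    j = fromℤ-pos-* m j
  fromℤ-* -[1+ m ] j = begin
    fromℤ (-[1+ m ] ℤ.* j)                ≡⟨ ≡.cong fromℤ (ℤ.neg-distribˡ-* (+ suc m) j) ⟨
    fromℤ (ℤ.- (+ suc m ℤ.* j))           ≈⟨ fromℤ-neg (+ suc m ℤ.* j) ⟩
    - fromℤ (+ suc m ℤ.* j)               ≈⟨ -‿cong (fromℤ-pos-* (suc m) j) ⟩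
    - (fromℕ (suc m) * fromℤ j)           ≈⟨ -‿distribˡ-* _ _ ⟩
    - fromℕ (suc m) * fromℤ j             ∎
    where open ≈-Reasoning

  -- Unlike fromℤ, sends + 1 to 1# itself rather than to 1# + 0#, so that the
  -- literals of solver expressions match those of the goals.
  ⟦_⟧ : ℤ → ℝ
  ⟦ + 1 ⟧ = 1#
  ⟦ i ⟧   = fromℤ i

  ⟦⟧≈fromℤ : ∀ i → ⟦ i ⟧ ≈ fromℤ i
  ⟦⟧≈fromℤ (+ zero)        = refl
  ⟦⟧≈fromℤ (+ 1)           = sym (+-identityʳ 1#)
  ⟦⟧≈fromℤ (+ suc (suc n)) = refl
  ⟦⟧≈fromℤ -[1+ n ]        = refl

  ⟦⟧-homo₂ : (_·_ : ℤ → ℤ → ℤ) {_∙_ : ℝ → ℝ → ℝ} →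
             (∀ {x x′ y y′} → x ≈ x′ → y ≈ y′ → x ∙ y ≈ x′ ∙ y′) →
             (∀ i j → fromℤ (i · j) ≈ fromℤ i ∙ fromℤ j) → ∀ i j → ⟦ i · j ⟧ ≈ ⟦ i ⟧ ∙ ⟦ j ⟧
  ⟦⟧-homo₂ _·_ ∙-cong homo i j =
    trans (⟦⟧≈fromℤ (i · j)) (trans (homo i j) (sym (∙-cong (⟦⟧≈fromℤ i) (⟦⟧≈fromℤ j))))

  -- Coefficients are taken in ℤ because the solver compares them by computation; equality in ℝ is
  -- decided only by excluded middle, which does not compute.
  ⟦⟧-morphism : ℤ.+-*-rawRing -Raw-AlmostCommutative⟶ fromCommutativeRing commutativeRing
  ⟦⟧-morphism = record
    { ⟦_⟧    = ⟦_⟧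
    ; +-homo = ⟦⟧-homo₂ ℤ._+_ +-cong fromℤ-+
    ; *-homo = ⟦⟧-homo₂ ℤ._*_ *-cong fromℤ-*
    ; -‿homo = λ i → trans (⟦⟧≈fromℤ (ℤ.- i)) (trans (fromℤ-neg i) (-‿cong (sym (⟦⟧≈fromℤ i))))
    ; 0-homo = refl
    ; 1-homo = refl
    }

  ⟦⟧-≟ : ∀ i j → Maybe (⟦ i ⟧ ≈ ⟦ j ⟧)
  ⟦⟧-≟ i j with i ℤ.≟ j
  ... | yes i≡j = just (reflexive (≡.cong ⟦_⟧ i≡j))
  ... | no _    = nothing

  module RingSolver =
    Algebra.Solver.Ring ℤ.+-*-rawRing (fromCommutativeRing commutativeRing) ⟦⟧-morphism ⟦⟧-≟
  open RingSolver public using (solve; con; _:+_; _:*_; _:-_; :-_; _:=_; _:^_)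

  module _ {n : ℕ} where
    :0 :1 :2 : RingSolver.Polynomial n
    :0 = con (+ 0)
    :1 = con (+ 1)
    :2 = con (+ 2)

  -- Ordered fields

  open ToStrict public using (<⇒≤)

  ≰⇒> : ∀ {x y} → ¬ (x ≤ y) → y < x
  ≰⇒> = ToStrict.≰⇒> sym ≤-reflexive total

  ≮⇒≥ : ∀ {x y} → ¬ (x < y) → y ≤ x
  ≮⇒≥ {x} {y} x≮y with lem {y ≤ x}
  ... | yes y≤x = y≤x
  ... | no y≰x  = contradiction (≰⇒> y≰x) x≮y

  ≤-<-trans : ∀ {x y z} → x ≤ y → y < z → x < z
  ≤-<-trans = ToStrict.≤-<-trans ≤-trans ≤-antisym (λ x≈y x≤z → ≤-trans (≤-reflexive (sym x≈y)) x≤z)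

  <-≤-trans : ∀ {x y z} → x < y → y ≤ z → x < z
  <-≤-trans = ToStrict.<-≤-trans sym ≤-trans ≤-antisym (λ y≈z x≤y → ≤-trans x≤y (≤-reflexive y≈z))

  <⇒≱ : ∀ {x y} → x < y → ¬ (y ≤ x)
  <⇒≱ = ToStrict.<⇒≱ ≤-antisym

  <⇒≉0 : ∀ {x} → 0# < x → x ≉ 0#
  <⇒≉0 (_ , 0≉x) x≈0 = 0≉x (sym x≈0)

  <-resp : ∀ {x x′ y y′} → x ≈ x′ → y ≈ y′ → x < y → x′ < y′
  <-resp x≈x′ y≈y′ x<y = ≤-<-trans (≤-reflexive (sym x≈x′)) (<-≤-trans x<y (≤-reflexive y≈y′))

  ≤-resp : ∀ {x x′ y y′} → x ≈ x′ → y ≈ y′ → x ≤ y → x′ ≤ y′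
  ≤-resp x≈x′ y≈y′ x≤y = ≤-trans (≤-reflexive (sym x≈x′)) (≤-trans x≤y (≤-reflexive y≈y′))

  +-mono-≤ : ∀ {x x′ y y′} → x ≤ x′ → y ≤ y′ → x + y ≤ x′ + y′
  +-mono-≤ x≤x′ y≤y′ = ≤-trans (+-monoʳ-≤ _ y≤y′) (≤-resp (+-comm _ _) (+-comm _ _) (+-monoʳ-≤ _ x≤x′))

  ≤⇒0≤- : ∀ {x y} → x ≤ y → 0# ≤ y - x
  ≤⇒0≤- {x} {y} x≤y = ≤-resp (-‿inverseˡ x) (+-comm _ _) (+-monoʳ-≤ (- x) x≤y)

  0≤-⇒≤ : ∀ {x y} → 0# ≤ y - x → x ≤ y
  0≤-⇒≤ {x} {y} 0≤y-x =
    ≤-resp (+-identityʳ x) (solve 2 (λ x y → x :+ (y :- x) := y) refl x y) (+-monoʳ-≤ x 0≤y-x)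

  -- To prove x ≤ y, exhibit y - x as a nonnegative expression.
  ≤-by : ∀ {x y e} → 0# ≤ e → y - x ≈ e → x ≤ y
  ≤-by 0≤e y-x≈e = 0≤-⇒≤ (≤-trans 0≤e (≤-reflexive (sym y-x≈e)))

  +-nonNeg : ∀ {x y} → 0# ≤ x → 0# ≤ y → 0# ≤ x + y
  +-nonNeg 0≤x 0≤y = ≤-trans (≤-reflexive (sym (+-identityˡ 0#))) (+-mono-≤ 0≤x 0≤y)

  x≤x+y : ∀ {x y} → 0# ≤ y → x ≤ x + y
  x≤x+y {x} 0≤y = ≤-trans (≤-reflexive (sym (+-identityʳ x))) (+-monoʳ-≤ x 0≤y)

  x≤y+x : ∀ {x y} → 0# ≤ y → x ≤ y + x
  x≤y+x 0≤y = ≤-trans (x≤x+y 0≤y) (≤-reflexive (+-comm _ _))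

  neg-mono-≤ : ∀ {x y} → x ≤ y → - y ≤ - x
  neg-mono-≤ {x} {y} x≤y = ≤-by (≤⇒0≤- x≤y) (solve 2 (λ x y → :- x :- :- y := y :- x) refl x y)

  neg-nonNeg : ∀ {x} → x ≤ 0# → 0# ≤ - x
  neg-nonNeg x≤0 = ≤-trans (≤-reflexive (sym -0#≈0#)) (neg-mono-≤ x≤0)

  neg-nonPos : ∀ {x} → 0# ≤ x → - x ≤ 0#
  neg-nonPos 0≤x = ≤-trans (neg-mono-≤ 0≤x) (≤-reflexive -0#≈0#)

  *-monoˡ-≤ : ∀ {x y z} → 0# ≤ z → x ≤ y → z * x ≤ z * y
  *-monoˡ-≤ {x} {y} {z} 0≤z x≤y =
    ≤-by (*-nonNeg 0≤z (≤⇒0≤- x≤y)) (solve 3 (λ x y z → z :* y :- z :* x := z :* (y :- x)) refl x y z)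

  *-monoʳ-≤ : ∀ {x y z} → 0# ≤ z → x ≤ y → x * z ≤ y * z
  *-monoʳ-≤ 0≤z x≤y = ≤-resp (*-comm _ _) (*-comm _ _) (*-monoˡ-≤ 0≤z x≤y)

  *-mono-≤ : ∀ {x x′ y y′} → 0# ≤ x → 0# ≤ y′ → x ≤ x′ → y ≤ y′ → x * y ≤ x′ * y′
  *-mono-≤ 0≤x 0≤y′ x≤x′ y≤y′ = ≤-trans (*-monoˡ-≤ 0≤x y≤y′) (*-monoʳ-≤ 0≤y′ x≤x′)

  neg*neg : ∀ x → - x * - x ≈ x * x
  neg*neg = solve 1 (λ x → :- x :* :- x := x :* x) refl

  0≤x*x : ∀ x → 0# ≤ x * x
  0≤x*x x with total 0# x
  ... | inj₁ 0≤x = *-nonNeg 0≤x 0≤x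
  ... | inj₂ x≤0 = ≤-trans (*-nonNeg (neg-nonNeg x≤0) (neg-nonNeg x≤0)) (≤-reflexive (neg*neg x))

  0≤1 : 0# ≤ 1#
  0≤1 = ≤-trans (0≤x*x 1#) (≤-reflexive (*-identityˡ 1#))

  0<1 : 0# < 1#
  0<1 = 0≤1 , 0≉1

  +-pos : ∀ {x y} → 0# < x → 0# ≤ y → 0# < x + y
  +-pos 0<x 0≤y = <-≤-trans 0<x (x≤x+y 0≤y)

  fromℕ-nonNeg : ∀ n → 0# ≤ fromℕ n
  fromℕ-nonNeg zero    = ≤-refl
  fromℕ-nonNeg (suc n) = +-nonNeg 0≤1 (fromℕ-nonNeg n)

  fromℕ-mono : ∀ {m n} → m ℕ.≤ n → fromℕ m ≤ fromℕ n
  fromℕ-mono {n = n} z≤n   = fromℕ-nonNeg n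
  fromℕ-mono (s≤s m≤n) = +-monoʳ-≤ 1# (fromℕ-mono m≤n)

  fromℕ-pos : ∀ {n} → 1 ℕ.≤ n → 0# < fromℕ n
  fromℕ-pos (s≤s {n = n} z≤n) = +-pos 0<1 (fromℕ-nonNeg n)

  1≤fromℕ : ∀ {n} → 1 ℕ.≤ n → 1# ≤ fromℕ n
  1≤fromℕ 1≤n = ≤-trans (≤-reflexive (sym (+-identityʳ 1#))) (fromℕ-mono 1≤n)

  0≤2 : 0# ≤ 2#
  0≤2 = fromℕ-nonNeg 2

  0<2 : 0# < 2#
  0<2 = fromℕ-pos {2} (s≤s z≤n)

  *-pos : ∀ {x y} → 0# < x → 0# < y → 0# < x * y
  *-pos {x} {y} 0<x 0<y = *-nonNeg (<⇒≤ 0<x) (<⇒≤ 0<y) , λ 0≈xy → <⇒≉0 0<y (begin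
    y                ≈⟨ *-identityˡ y ⟨
    1# * y           ≈⟨ *-congʳ (⁻¹-inverseʳ x (<⇒≉0 0<x)) ⟨
    x * x ⁻¹ * y     ≈⟨ solve 3 (λ x i y → x :* i :* y := i :* (x :* y)) refl x (x ⁻¹) y ⟩
    x ⁻¹ * (x * y)   ≈⟨ *-congˡ 0≈xy ⟨
    x ⁻¹ * 0#        ≈⟨ zeroʳ _ ⟩
    0#               ∎)
    where open ≈-Reasoning

  *-⁻¹ : ∀ {x} → 0# < x → x * x ⁻¹ ≈ 1#
  *-⁻¹ 0<x = ⁻¹-inverseʳ _ (<⇒≉0 0<x)

  ⁻¹-pos : ∀ {x} → 0# < x → 0# < x ⁻¹
  ⁻¹-pos {x} 0<x = ≰⇒> λ x⁻¹≤0 → <⇒≱ 0<1 (≤-by (*-nonNeg (<⇒≤ 0<x) (neg-nonNeg x⁻¹≤0))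
    (trans (+-congˡ (-‿cong (sym (*-⁻¹ 0<x)))) (solve 2 (λ x i → :0 :- x :* i := x :* :- i) refl x (x ⁻¹))))

  ⁻¹-unique : ∀ {x y} → 0# < x → x * y ≈ 1# → y ≈ x ⁻¹
  ⁻¹-unique {x} {y} 0<x xy≈1 = begin
    y                ≈⟨ *-identityˡ y ⟨
    1# * y           ≈⟨ *-congʳ (*-⁻¹ 0<x) ⟨
    x * x ⁻¹ * y     ≈⟨ solve 3 (λ x i y → x :* i :* y := x :* y :* i) refl x (x ⁻¹) y ⟩
    x * y * x ⁻¹     ≈⟨ *-congʳ xy≈1 ⟩
    1# * x ⁻¹        ≈⟨ *-identityˡ _ ⟩
    x ⁻¹             ∎
    where open ≈-Reasoning

  ⁻¹-* : ∀ {x y} → 0# < x → 0# < y → (x * y) ⁻¹ ≈ x ⁻¹ * y ⁻¹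
  ⁻¹-* {x} {y} 0<x 0<y = sym (⁻¹-unique (*-pos 0<x 0<y) (begin
    x * y * (x ⁻¹ * y ⁻¹)    ≈⟨ solve 4 (λ x y i j → x :* y :* (i :* j) := x :* i :* (y :* j)) refl x y _ _ ⟩
    x * x ⁻¹ * (y * y ⁻¹)    ≈⟨ *-cong (*-⁻¹ 0<x) (*-⁻¹ 0<y) ⟩
    1# * 1#                  ≈⟨ *-identityˡ 1# ⟩
    1#                       ∎))
    where open ≈-Reasoning

  *-/-cancel : ∀ x {y} → 0# < y → x / y * y ≈ x
  *-/-cancel x {y} 0<y = begin
    x * y ⁻¹ * y     ≈⟨ solve 3 (λ x i y → x :* i :* y := x :* (y :* i)) refl x (y ⁻¹) y ⟩
    x * (y * y ⁻¹)   ≈⟨ *-congˡ (*-⁻¹ 0<y) ⟩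
    x * 1#           ≈⟨ *-identityʳ x ⟩
    x                ∎
    where open ≈-Reasoning

  *-cancelʳ : ∀ {x y z} → 0# < z → x * z ≈ y * z → x ≈ y
  *-cancelʳ {x} {y} {z} 0<z xz≈yz = begin
    x                ≈⟨ *-/-cancel x 0<z ⟨
    x * z ⁻¹ * z     ≈⟨ solve 3 (λ x i z → x :* i :* z := x :* z :* i) refl x (z ⁻¹) z ⟩
    x * z * z ⁻¹     ≈⟨ *-congʳ xz≈yz ⟩
    y * z * z ⁻¹     ≈⟨ solve 3 (λ x i z → x :* i :* z := x :* z :* i) refl y (z ⁻¹) z ⟨
    y * z ⁻¹ * z     ≈⟨ *-/-cancel y 0<z ⟩
    y                ∎
    where open ≈-Reasoning

  *-cancelʳ-≤ : ∀ {x y z} → 0# < z → x * z ≤ y * z → x ≤ y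
  *-cancelʳ-≤ {x} {y} {z} 0<z xz≤yz with lem {x ≤ y}
  ... | yes x≤y = x≤y
  ... | no x≰y  = let y<x = ≰⇒> x≰y in
    contradiction (*-cancelʳ 0<z (≤-antisym xz≤yz (*-monoʳ-≤ (<⇒≤ 0<z) (<⇒≤ y<x))))
                  (λ x≈y → ToStrict.<⇒≉ y<x (sym x≈y))

  ≤-/ : ∀ {x y z} → 0# < z → x * z ≤ y → x ≤ y / z
  ≤-/ {y = y} 0<z xz≤y = *-cancelʳ-≤ 0<z (≤-trans xz≤y (≤-reflexive (sym (*-/-cancel y 0<z))))

  /-≤ : ∀ {x y z} → 0# < z → x ≤ y * z → x / z ≤ y
  /-≤ {x} 0<z x≤yz = *-cancelʳ-≤ 0<z (≤-trans (≤-reflexive (*-/-cancel x 0<z)) x≤yz)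

  /-nonNeg : ∀ {x y} → 0# ≤ x → 0# < y → 0# ≤ x / y
  /-nonNeg 0≤x 0<y = *-nonNeg 0≤x (<⇒≤ (⁻¹-pos 0<y))

  /-pos : ∀ {x y} → 0# < x → 0# < y → 0# < x / y
  /-pos 0<x 0<y = *-pos 0<x (⁻¹-pos 0<y)

  ⁻¹-anti : ∀ {x y} → 0# < x → x ≤ y → y ⁻¹ ≤ x ⁻¹
  ⁻¹-anti {x} {y} 0<x x≤y = ≤-trans (≤-reflexive (sym (*-identityˡ _))) (/-≤ 0<y
    (≤-trans (≤-reflexive (sym (trans (*-comm _ _) (*-⁻¹ 0<x)))) (*-monoˡ-≤ (<⇒≤ (⁻¹-pos 0<x)) x≤y)))
    where 0<y = <-≤-trans 0<x x≤y

  half+half : ∀ ε → ε / 2# + ε / 2# ≈ ε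
  half+half ε = trans (solve 2 (λ e i → e :* i :+ e :* i := e :* i :* :2) refl ε (2# ⁻¹)) (*-/-cancel ε 0<2)

  ^-nonNeg : ∀ {x} → 0# ≤ x → ∀ n → 0# ≤ x ^ n
  ^-nonNeg 0≤x zero    = 0≤1
  ^-nonNeg 0≤x (suc n) = *-nonNeg 0≤x (^-nonNeg 0≤x n)

  ^-pos : ∀ {x} → 0# < x → ∀ n → 0# < x ^ n
  ^-pos 0<x zero    = 0<1
  ^-pos 0<x (suc n) = *-pos 0<x (^-pos 0<x n)

  ^-monoˡ-≤ : ∀ {x y} → 0# ≤ x → x ≤ y → ∀ n → x ^ n ≤ y ^ n
  ^-monoˡ-≤ 0≤x x≤y zero    = ≤-refl
  ^-monoˡ-≤ 0≤x x≤y (suc n) = *-mono-≤ 0≤x (^-nonNeg (≤-trans 0≤x x≤y) n) x≤y (^-monoˡ-≤ 0≤x x≤y n)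

  1≤^ : ∀ {x} → 1# ≤ x → ∀ n → 1# ≤ x ^ n
  1≤^ 1≤x zero    = ≤-refl
  1≤^ 1≤x (suc n) = ≤-trans (≤-reflexive (sym (*-identityˡ 1#)))
                            (*-mono-≤ 0≤1 (^-nonNeg (≤-trans 0≤1 1≤x) n) 1≤x (1≤^ 1≤x n))

  ^-monoʳ-≤ : ∀ {x} → 1# ≤ x → ∀ {m n} → m ℕ.≤ n → x ^ m ≤ x ^ n
  ^-monoʳ-≤ 1≤x {n = n} z≤n = 1≤^ 1≤x n
  ^-monoʳ-≤ 1≤x (s≤s m≤n)   = *-monoˡ-≤ (≤-trans 0≤1 1≤x) (^-monoʳ-≤ 1≤x m≤n)

  1^n≈1 : ∀ n → 1# ^ n ≈ 1#
  1^n≈1 zero    = refl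
  1^n≈1 (suc n) = trans (*-identityˡ _) (1^n≈1 n)

  ⁻¹-^ : ∀ {x} → 0# < x → ∀ n → (x ^ n) ⁻¹ ≈ (x ⁻¹) ^ n
  ⁻¹-^ 0<x zero    = sym (⁻¹-unique 0<1 (*-identityˡ 1#))
  ⁻¹-^ 0<x (suc n) = trans (⁻¹-* 0<x (^-pos 0<x n)) (*-congˡ (⁻¹-^ 0<x n))

  x≤∣x∣ : ∀ x → x ≤ ∣ x ∣
  x≤∣x∣ x = Max.x≤x⊔y x (- x)

  -x≤∣x∣ : ∀ x → - x ≤ ∣ x ∣
  -x≤∣x∣ x = Max.x≤y⊔x x (- x)

  ∣∣≤ : ∀ {x y} → x ≤ y → - x ≤ y → ∣ x ∣ ≤ y
  ∣∣≤ = Max.⊔-lub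

  0≤∣x∣ : ∀ x → 0# ≤ ∣ x ∣
  0≤∣x∣ x with total 0# x
  ... | inj₁ 0≤x = ≤-trans 0≤x (x≤∣x∣ x)
  ... | inj₂ x≤0 = ≤-trans (neg-nonNeg x≤0) (-x≤∣x∣ x)

  ∣∣-cong : ∀ {x y} → x ≈ y → ∣ x ∣ ≈ ∣ y ∣
  ∣∣-cong x≈y = Max.⊔-cong x≈y (-‿cong x≈y)

  0≤x⇒∣x∣≈x : ∀ {x} → 0# ≤ x → ∣ x ∣ ≈ x
  0≤x⇒∣x∣≈x {x} 0≤x = ≤-antisym (∣∣≤ ≤-refl (≤-trans (neg-nonPos 0≤x) 0≤x)) (x≤∣x∣ x)

  ∣-x∣≈∣x∣ : ∀ x → ∣ - x ∣ ≈ ∣ x ∣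
  ∣-x∣≈∣x∣ x = trans (Max.⊔-cong refl (-‿involutive x)) (Max.⊔-comm (- x) x)

  x≤0⇒∣x∣≈-x : ∀ {x} → x ≤ 0# → ∣ x ∣ ≈ - x
  x≤0⇒∣x∣≈-x {x} x≤0 = trans (sym (∣-x∣≈∣x∣ x)) (0≤x⇒∣x∣≈x (neg-nonNeg x≤0))

  ∣x+y∣≤∣x∣+∣y∣ : ∀ x y → ∣ x + y ∣ ≤ ∣ x ∣ + ∣ y ∣
  ∣x+y∣≤∣x∣+∣y∣ x y = ∣∣≤ (+-mono-≤ (x≤∣x∣ x) (x≤∣x∣ y))
    (≤-trans (≤-reflexive (sym (-‿+-comm x y))) (+-mono-≤ (-x≤∣x∣ x) (-x≤∣x∣ y)))

  ∣x*y∣≈∣x∣*∣y∣ : ∀ x y → ∣ x * y ∣ ≈ ∣ x ∣ * ∣ y ∣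
  ∣x*y∣≈∣x∣*∣y∣ x y with total 0# x | total 0# y
  ... | inj₁ p | inj₁ q = trans (0≤x⇒∣x∣≈x (*-nonNeg p q)) (sym (*-cong (0≤x⇒∣x∣≈x p) (0≤x⇒∣x∣≈x q)))
  ... | inj₁ p | inj₂ q = trans (sym (∣-x∣≈∣x∣ _)) (trans (∣∣-cong (-‿distribʳ-* x y))
    (trans (0≤x⇒∣x∣≈x (*-nonNeg p (neg-nonNeg q))) (sym (*-cong (0≤x⇒∣x∣≈x p) (x≤0⇒∣x∣≈-x q)))))
  ... | inj₂ p | inj₁ q = trans (sym (∣-x∣≈∣x∣ _)) (trans (∣∣-cong (-‿distribˡ-* x y))
    (trans (0≤x⇒∣x∣≈x (*-nonNeg (neg-nonNeg p) q)) (sym (*-cong (x≤0⇒∣x∣≈-x p) (0≤x⇒∣x∣≈x q)))))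
  ... | inj₂ p | inj₂ q = trans (∣∣-cong (solve 2 (λ x y → x :* y := :- x :* :- y) refl x y))
    (trans (0≤x⇒∣x∣≈x (*-nonNeg (neg-nonNeg p) (neg-nonNeg q))) (sym (*-cong (x≤0⇒∣x∣≈-x p) (x≤0⇒∣x∣≈-x q))))

  ∣x^n∣≈∣x∣^n : ∀ x n → ∣ x ^ n ∣ ≈ ∣ x ∣ ^ n
  ∣x^n∣≈∣x∣^n x zero    = 0≤x⇒∣x∣≈x 0≤1
  ∣x^n∣≈∣x∣^n x (suc n) = trans (∣x*y∣≈∣x∣*∣y∣ x (x ^ n)) (*-congˡ (∣x^n∣≈∣x∣^n x n))

  ∣x-y∣≈∣y-x∣ : ∀ x y → ∣ x - y ∣ ≈ ∣ y - x ∣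
  ∣x-y∣≈∣y-x∣ x y = trans (sym (∣-x∣≈∣x∣ _)) (∣∣-cong (solve 2 (λ x y → :- (x :- y) := y :- x) refl x y))

  ∣x-z∣≤ : ∀ x y z → ∣ x - z ∣ ≤ ∣ x - y ∣ + ∣ y - z ∣
  ∣x-z∣≤ x y z = ≤-trans (≤-reflexive (∣∣-cong (solve 3 (λ x y z → x :- z := x :- y :+ (y :- z)) refl x y z)))
                         (∣x+y∣≤∣x∣+∣y∣ _ _)

  +-mono-≤-< : ∀ {x x′ y y′} → x ≤ x′ → y < y′ → x + y < x′ + y′
  +-mono-≤-< {x} {x′} {y} {y′} x≤x′ y<y′ = +-mono-≤ x≤x′ (<⇒≤ y<y′) , λ eq → <⇒≱ y<y′
    (≤-by (≤⇒0≤- x≤x′) (trans (solve 4 (λ x x′ y y′ → y :- y′ := x :+ y :- x :- y′) refl x x′ y y′)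
    (trans (+-congʳ (+-congʳ eq)) (solve 4 (λ x x′ y y′ → x′ :+ y′ :- x :- y′ := x′ :- x) refl x x′ y y′))))

  +-mono-< : ∀ {x x′ y y′} → x < x′ → y < y′ → x + y < x′ + y′
  +-mono-< x<x′ = +-mono-≤-< (<⇒≤ x<x′)

  ∀ε⇒≤ : ∀ {x y} → (∀ ε → 0# < ε → x ≤ y + ε) → x ≤ y
  ∀ε⇒≤ {x} {y} h with lem {x ≤ y}
  ... | yes x≤y = x≤y
  ... | no x≰y  = contradiction (h δ 0<δ) (<⇒≱ (<-resp (+-identityʳ _) lemma (+-mono-≤-< ≤-refl 0<δ)))
    where
    y<x : y < x
    y<x = ≰⇒> x≰y
    0<x-y : 0# < x - y
    0<x-y = ≤⇒0≤- (<⇒≤ y<x) , λ eq → ToStrict.<⇒≉ y<x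
      (trans (sym (+-identityʳ y)) (trans (+-congˡ eq) (solve 2 (λ x y → y :+ (x :- y) := x) refl x y)))
    δ = (x - y) / 2#
    0<δ : 0# < δ
    0<δ = /-pos 0<x-y 0<2
    lemma : y + δ + δ ≈ x
    lemma = trans (+-assoc _ _ _) (trans (+-congˡ (half+half (x - y))) (solve 2 (λ x y → y :+ (x :- y) := x) refl x y))

  -- Completeness: if the naturals were bounded, with supremum s, then s - 1 would be an upper bound
  -- too, because n + 1 ≤ s for every n.
  archimedean : ∀ x → ∃[ n ] x ≤ fromℕ n
  archimedean x with lem {∃[ n ] x ≤ fromℕ n}
  ... | yes found = found
  ... | no none =
    let s , ub , least = supremum (λ y → ∃[ n ] y ≈ fromℕ n) (0# , 0 , refl)
          (x , λ { y (n , y≈n) → ≤-trans (≤-reflexive y≈n) (<⇒≤ (≰⇒> λ x≤n → none (n , x≤n))) })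
        s≤s-1 = least (s - 1#) λ { y (n , y≈n) → ≤-by (≤⇒0≤- (ub (fromℕ (suc n)) (suc n , refl)))
          (trans (+-congˡ (-‿cong y≈n)) (solve 2 (λ s n → s :- :1 :- n := s :- (:1 :+ n)) refl s (fromℕ n))) }
        -1≥0 = ≤-trans (≤⇒0≤- s≤s-1) (≤-reflexive (solve 1 (λ s → s :- :1 :- s := :- :1) refl s))
    in contradiction (≤-by -1≥0 (+-identityˡ _)) (<⇒≱ 0<1)

  -- Finite sums

  open Algebra.Properties.Semiring.Sum semiring public
    using (sum-cong-≋; ∑-distrib-+; *-distribˡ-sum)

  module _ {A : Set} where

    ∑-cong : {f g : A → ℝ} → (∀ a → f a ≈ g a) → ∀ as → ∑ f as ≈ ∑ g as
    ∑-cong f≈g []       = refl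
    ∑-cong f≈g (a ∷ as) = +-cong (f≈g a) (∑-cong f≈g as)

    ∑-+ : (f g : A → ℝ) → ∀ as → ∑ (λ a → f a + g a) as ≈ ∑ f as + ∑ g as
    ∑-+ f g []       = sym (+-identityˡ 0#)
    ∑-+ f g (a ∷ as) = trans (+-congˡ (∑-+ f g as))
      (solve 4 (λ x y u v → x :+ y :+ (u :+ v) := x :+ u :+ (y :+ v)) refl (f a) (g a) _ _)

    ∑-* : ∀ c (f : A → ℝ) as → ∑ (λ a → c * f a) as ≈ c * ∑ f as
    ∑-* c f []       = sym (zeroʳ c)
    ∑-* c f (a ∷ as) = trans (+-congˡ (∑-* c f as)) (sym (distribˡ c _ _))

    ∑-mono : {f g : A → ℝ} → (∀ a → f a ≤ g a) → ∀ as → ∑ f as ≤ ∑ g as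
    ∑-mono f≤g []       = ≤-refl
    ∑-mono f≤g (a ∷ as) = +-mono-≤ (f≤g a) (∑-mono f≤g as)

    ∑-nonNeg : {f : A → ℝ} → (∀ a → 0# ≤ f a) → ∀ as → 0# ≤ ∑ f as
    ∑-nonNeg 0≤f []       = ≤-refl
    ∑-nonNeg 0≤f (a ∷ as) = +-nonNeg (0≤f a) (∑-nonNeg 0≤f as)

    ∣∑∣≤ : {f g : A → ℝ} → (∀ a → ∣ f a ∣ ≤ g a) → ∀ as → ∣ ∑ f as ∣ ≤ ∑ g as
    ∣∑∣≤ ∣f∣≤g []       = ≤-reflexive (0≤x⇒∣x∣≈x ≤-refl)
    ∣∑∣≤ ∣f∣≤g (a ∷ as) = ≤-trans (∣x+y∣≤∣x∣+∣y∣ _ _) (+-mono-≤ (∣f∣≤g a) (∣∑∣≤ ∣f∣≤g as))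

    ∑-++ : (f : A → ℝ) → ∀ as bs → ∑ f (as ++ bs) ≈ ∑ f as + ∑ f bs
    ∑-++ f []       bs = sym (+-identityˡ _)
    ∑-++ f (a ∷ as) bs = trans (+-congˡ (∑-++ f as bs)) (sym (+-assoc _ _ _))

    ∑-↭ : (f : A → ℝ) → ∀ {as bs} → as ↭ bs → ∑ f as ≈ ∑ f bs
    ∑-↭ f Perm.refl          = refl
    ∑-↭ f (Perm.prep a p)    = +-congˡ (∑-↭ f p)
    ∑-↭ f (Perm.swap a b p)  = trans (+-congˡ (+-congˡ (∑-↭ f p)))
      (solve 3 (λ x y u → x :+ (y :+ u) := y :+ (x :+ u)) refl (f a) (f b) _)
    ∑-↭ f (Perm.trans p q)   = trans (∑-↭ f p) (∑-↭ f q)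

    ∑-map : {B : Set} (f : A → ℝ) (g : B → A) → ∀ bs → ∑ f (map g bs) ≡ ∑ (f ∘ g) bs
    ∑-map f g []       = ≡.refl
    ∑-map f g (b ∷ bs) = ≡.cong (λ s → f (g b) + s) (∑-map f g bs)

    unique-∉ : ∀ {a : A} {as} → Unique (a ∷ as) → ¬ (a Membership.∈ as)
    unique-∉ = Unique.Unique[x∷xs]⇒x∉xs

    -- One occurrence of each element of `as` is taken out of `bs`; as it does not recur in `as`,
    -- the later elements are still found in what remains.
    ⊆-split : ∀ {as bs : List A} → Unique as → as ⊆ bs → ∃[ cs ] bs ↭ as ++ cs
    ⊆-split {[]}     {bs} _ _ = bs , Perm.refl
    ⊆-split {a ∷ as} {bs} u@(_ ∷ u′) as⊆bs
      with xs , ys , ≡.refl ← Membership.∈-∃++ (as⊆bs (here ≡.refl))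
      with cs , p ← ⊆-split {as} {xs ++ ys} u′ (λ {b} b∈as → case Perm.∈-resp-↭ (Perm.shift a xs ys) (as⊆bs (there b∈as)) of
             λ { (here ≡.refl) → contradiction b∈as (unique-∉ u) ; (there b∈) → b∈ })
      = cs , ↭-trans (Perm.shift a xs ys) (Perm.prep a p)

    ∑-mono-⊆ : {f : A → ℝ} → (∀ a → 0# ≤ f a) → ∀ {as bs} → Unique as → as ⊆ bs → ∑ f as ≤ ∑ f bs
    ∑-mono-⊆ {f} 0≤f {as} {bs} u as⊆bs with cs , p ← ⊆-split u as⊆bs =
      ≤-trans (x≤x+y (∑-nonNeg 0≤f cs)) (≤-reflexive (sym (trans (∑-↭ f p) (∑-++ f as cs))))

    ≟-classical : (a b : A) → Dec (a ≡ b)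
    ≟-classical _ _ = lem

    -- `HasSum` speaks of lists without repetition, but the list it supplies may repeat elements,
    -- and so may a concatenation of two such lists.
    dedup : List A → List A
    dedup = deduplicate ≟-classical

    dedup-unique : ∀ as → Unique (dedup as)
    dedup-unique = DecUnique.deduplicate-! ≟-classical

    ⊆-dedup : ∀ as → as ⊆ dedup as
    ⊆-dedup as = Membership.∈-deduplicate⁺ ≟-classical

  ∑-concatMap : {A B : Set} (f : B → ℝ) (g : A → List B) → ∀ as → ∑ f (concatMap g as) ≈ ∑ (∑ f ∘ g) as
  ∑-concatMap f g []       = refl
  ∑-concatMap f g (a ∷ as) = trans (∑-++ f (g a) _) (+-congˡ (∑-concatMap f g as))

  ∑-cartesianProduct : {A B : Set} (f : A → ℝ) (g : B → ℝ) → ∀ as bs →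
    ∑ (λ (a , b) → f a * g b) (cartesianProduct as bs) ≈ ∑ f as * ∑ g bs
  ∑-cartesianProduct f g []       bs = sym (zeroˡ _)
  ∑-cartesianProduct f g (a ∷ as) bs = begin
    ∑ (λ (a , b) → f a * g b) (map (a ,_) bs ++ cartesianProduct as bs)
      ≈⟨ ∑-++ _ (map (a ,_) bs) _ ⟩
    ∑ (λ (a , b) → f a * g b) (map (a ,_) bs) + ∑ (λ (a , b) → f a * g b) (cartesianProduct as bs)
      ≈⟨ +-cong (trans (reflexive (∑-map _ (a ,_) bs)) (∑-* (f a) g bs)) (∑-cartesianProduct f g as bs) ⟩
    f a * ∑ g bs + ∑ f as * ∑ g bs
      ≈⟨ distribʳ _ _ _ ⟨
    (f a + ∑ f as) * ∑ g bs
      ∎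
    where open ≈-Reasoning

  -- Sums over initial segments of ℕ

  ∑< : ℕ → (ℕ → ℝ) → ℝ
  ∑< n f = sum {n} (f ∘ toℕ)

  ∑<-cong : ∀ n {f g : ℕ → ℝ} → (∀ i → i ℕ.< n → f i ≈ g i) → ∑< n f ≈ ∑< n g
  ∑<-cong n f≈g = sum-cong-≋ (λ i → f≈g (toℕ i) (Fin.toℕ<n i))

  ∑<-+ : ∀ n (f g : ℕ → ℝ) → ∑< n (λ i → f i + g i) ≈ ∑< n f + ∑< n g
  ∑<-+ n f g = ∑-distrib-+ {n} (f ∘ toℕ) (g ∘ toℕ)

  ∑<-* : ∀ n c (f : ℕ → ℝ) → ∑< n (λ i → c * f i) ≈ c * ∑< n f
  ∑<-* n c f = sym (*-distribˡ-sum {n} c (f ∘ toℕ))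

  ∑<-suc : ∀ n (f : ℕ → ℝ) → ∑< (suc n) f ≈ ∑< n f + f n
  ∑<-suc zero    f = +-comm _ _
  ∑<-suc (suc n) f = trans (+-congˡ (∑<-suc n (f ∘ suc))) (sym (+-assoc _ _ _))

  ∑<-mono : ∀ n {f g : ℕ → ℝ} → (∀ i → i ℕ.< n → f i ≤ g i) → ∑< n f ≤ ∑< n g
  ∑<-mono zero    f≤g = ≤-refl
  ∑<-mono (suc n) f≤g = +-mono-≤ (f≤g 0 (s≤s z≤n)) (∑<-mono n (λ i i<n → f≤g (suc i) (s≤s i<n)))

  ∑<-split : ∀ m n (f : ℕ → ℝ) → ∑< (m ℕ.+ n) f ≈ ∑< m f + ∑< n (λ i → f (m ℕ.+ i))
  ∑<-split zero    n f = sym (+-identityˡ _)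
  ∑<-split (suc m) n f = trans (+-congˡ (∑<-split m n (f ∘ suc))) (sym (+-assoc _ _ _))

  ∣∑<∣≤ : ∀ n {f g : ℕ → ℝ} → (∀ i → i ℕ.< n → ∣ f i ∣ ≤ g i) → ∣ ∑< n f ∣ ≤ ∑< n g
  ∣∑<∣≤ zero    h = ≤-reflexive (0≤x⇒∣x∣≈x ≤-refl)
  ∣∑<∣≤ (suc n) h = ≤-trans (∣x+y∣≤∣x∣+∣y∣ _ _)
    (+-mono-≤ (h 0 (s≤s z≤n)) (∣∑<∣≤ n (λ i i<n → h (suc i) (s≤s i<n))))

  ∑<-const : ∀ n c → ∑< n (λ _ → c) ≈ fromℕ n * c
  ∑<-const zero    c = sym (zeroˡ c)
  ∑<-const (suc n) c = trans (+-congˡ (∑<-const n c)) (solve 2 (λ n c → c :+ n :* c := (:1 :+ n) :* c) refl (fromℕ n) c)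

  ∑-applyUpTo : (f : ℕ → ℝ) (g : ℕ → ℕ) → ∀ n → ∑ f (applyUpTo g n) ≡ ∑< n (f ∘ g)
  ∑-applyUpTo f g zero    = ≡.refl
  ∑-applyUpTo f g (suc n) = ≡.cong (λ s → f (g 0) + s) (∑-applyUpTo f (g ∘ suc) n)

  ∑-upTo : (f : ℕ → ℝ) → ∀ n → ∑ f (upTo n) ≡ ∑< n f
  ∑-upTo f = ∑-applyUpTo f id

  ⊆-upTo : ∀ ks → ∃[ n ] ks ⊆ upTo n
  ⊆-upTo []       = 0 , λ ()
  ⊆-upTo (k ∷ ks) with n , ks⊆ ← ⊆-upTo ks = suc k ℕ.⊔ n , λ
    { (here ≡.refl) → Membership.∈-upTo⁺ (ℕ.m≤m⊔n (suc k) n)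
    ; (there i∈ks)  → Membership.∈-upTo⁺ (ℕ.≤-trans (Membership.∈-upTo⁻ (ks⊆ i∈ks)) (ℕ.m≤n⊔m (suc k) n)) }

  -- Unconditional sums

  HasSum-cong : {A : Set} {f g : A → ℝ} {S T : ℝ} → (∀ a → f a ≈ g a) → S ≈ T → HasSum f S → HasSum g T
  HasSum-cong f≈g S≈T hf ε 0<ε with as₀ , h ← hf ε 0<ε =
    as₀ , λ as u as₀⊆as → <-resp (∣∣-cong (+-cong (∑-cong f≈g as) (-‿cong S≈T))) refl (h as u as₀⊆as)

  HasSum-+ : {A : Set} {f g : A → ℝ} {S T : ℝ} → HasSum f S → HasSum g T → HasSum (λ a → f a + g a) (S + T)
  HasSum-+ {f = f} {g} {S} {T} hf hg ε 0<ε
    with as₀ , h ← hf (ε / 2#) (/-pos 0<ε 0<2) | bs₀ , k ← hg (ε / 2#) (/-pos 0<ε 0<2) =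
    as₀ ++ bs₀ , λ as u ⊆as → ≤-<-trans (≤-trans (≤-reflexive (∣∣-cong (trans (+-congʳ (∑-+ f g as))
        (solve 4 (λ x y u v → x :+ y :- (u :+ v) := x :- u :+ (y :- v)) refl _ _ S T)))) (∣x+y∣≤∣x∣+∣y∣ _ _))
      (<-resp refl (half+half ε) (+-mono-< (h as u (⊆as ∘ Membership.∈-++⁺ˡ)) (k as u (⊆as ∘ Membership.∈-++⁺ʳ as₀))))

  HasSum-* : {A : Set} {f : A → ℝ} {S : ℝ} → ∀ c → HasSum f S → HasSum (λ a → c * f a) (c * S)
  -- Dividing by |c| + 1 instead of |c| covers c = 0.
  HasSum-* {f = f} {S} c hf ε 0<ε = let as₀ , h = hf (ε / (∣ c ∣ + 1#)) (/-pos 0<ε 0<∣c∣+1) in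
    as₀ , λ as u ⊆as → ≤-<-trans (≤-trans (≤-reflexive (trans (∣∣-cong (trans (+-congʳ (∑-* c f as))
        (solve 3 (λ c x y → c :* x :- c :* y := c :* (x :- y)) refl c _ S))) (∣x*y∣≈∣x∣*∣y∣ c _)))
        (*-monoʳ-≤ (0≤∣x∣ _) (x≤x+y 0≤1)))
      (<-resp (*-comm _ _) (*-/-cancel ε 0<∣c∣+1) (*-monoʳ-< 0<∣c∣+1 (h as u ⊆as)))
    where
    0<∣c∣+1 : 0# < ∣ c ∣ + 1#
    0<∣c∣+1 = <-resp refl (+-comm _ _) (+-pos 0<1 (0≤∣x∣ c))
    *-monoʳ-< : ∀ {x y z} → 0# < z → x < y → x * z < y * z
    *-monoʳ-< 0<z (x≤y , x≉y) = *-monoʳ-≤ (<⇒≤ 0<z) x≤y , λ eq → x≉y (*-cancelʳ 0<z eq)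

  HasSum-bound : {A : Set} {f : A → ℝ} {S B : ℝ} → (∀ as → Unique as → ∣ ∑ f as ∣ ≤ B) → HasSum f S → ∣ S ∣ ≤ B
  HasSum-bound {f = f} {S} {B} bound hf = ∀ε⇒≤ λ ε 0<ε → let as₀ , h = hf ε 0<ε ; as = dedup as₀ in begin
    ∣ S ∣                          ≈⟨ ∣∣-cong (solve 2 (λ s t → s := t :+ (s :- t)) refl S (∑ f as)) ⟩
    ∣ ∑ f as + (S - ∑ f as) ∣      ≤⟨ ∣x+y∣≤∣x∣+∣y∣ _ _ ⟩
    ∣ ∑ f as ∣ + ∣ S - ∑ f as ∣    ≤⟨ +-mono-≤ (bound as (dedup-unique as₀)) (≤-trans (≤-reflexive (∣x-y∣≈∣y-x∣ S _))
                                       (<⇒≤ (h as (dedup-unique as₀) (⊆-dedup as₀)))) ⟩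
    B + ε                          ∎
    where open ≤-Reasoning

  -- The difference of two sums of f is a sum of the zero family, whose finite sums bound it by 0.
  HasSum-unique : {A : Set} {f : A → ℝ} {S T : ℝ} → HasSum f S → HasSum f T → S ≈ T
  HasSum-unique {f = f} {S} {T} hS hT = ≤-antisym (bound hS hT) (bound hT hS)
    where
    zero-sum : ∀ {U V} → HasSum f U → HasSum f V → HasSum (λ _ → 0#) (U - V)
    zero-sum hU hV = HasSum-cong (λ a → solve 1 (λ x → x :+ :- :1 :* x := :0) refl (f a))
      (solve 2 (λ u v → u :+ :- :1 :* v := u :- v) refl _ _) (HasSum-+ hU (HasSum-* (- 1#) hV))
    ∑0 : ∀ as → ∑ (λ _ → 0#) as ≈ 0#
    ∑0 []       = refl
    ∑0 (a ∷ as) = trans (+-identityˡ _) (∑0 as)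
    bound : ∀ {U V} → HasSum f U → HasSum f V → U ≤ V
    bound hU hV = 0≤-⇒≤ (≤-trans (neg-nonNeg (≤-trans (x≤∣x∣ _)
      (HasSum-bound (λ as _ → ≤-reflexive (trans (∣∣-cong (∑0 as)) (0≤x⇒∣x∣≈x ≤-refl))) (zero-sum hU hV))))
      (≤-reflexive (solve 2 (λ u v → :- (u :- v) := v :- u) refl _ _)))

  choose-spec : (P : Pred ℝ 0ℓ) → ∃ P → P (choose P)
  choose-spec P ∃P with lem {∃ P}
  ... | yes (_ , Px) = Px
  ... | no ∄         = contradiction ∃P ∄

  -- The gate to every use of `tsum`: some sum has to be exhibited to exclude the default value.
  tsum-HasSum : {A : Set} {f : A → ℝ} {S : ℝ} → HasSum f S → HasSum f (tsum f)
  tsum-HasSum {f = f} hf = choose-spec (HasSum f) (_ , hf)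

  tsum-≈ : {A : Set} {f : A → ℝ} {S : ℝ} → HasSum f S → tsum f ≈ S
  tsum-≈ hf = HasSum-unique (tsum-HasSum hf) hf

  -- For nonnegative f this is summability.
  BoundedBy : {A : Set} → (A → ℝ) → ℝ → Set
  BoundedBy f B = ∀ as → Unique as → ∑ f as ≤ B

  module _ {A : Set} {f : A → ℝ} (0≤f : ∀ a → 0# ≤ f a) where

    -- The sum is the supremum S of the finite sums. Either some finite sum exceeds S - ε, and then
    -- by nonnegativity so do all larger ones, or S - ε would be a smaller upper bound.
    nonNeg-HasSum : ∀ {B} → BoundedBy f B → ∃[ S ] HasSum f S
    nonNeg-HasSum {B} bounded =
      let S , ub , least = supremum (λ x → ∃[ as ] Unique as × x ≈ ∑ f as) (0# , [] , [] , refl)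
                             (B , λ { x (as , u , x≈) → ≤-trans (≤-reflexive x≈) (bounded as u) })
      in S , λ ε 0<ε → case lem {∃[ as ] Unique as × S < ∑ f as + ε} of λ
        { (yes (as₀ , u₀ , S<)) → as₀ , λ as u ⊆as → ≤-<-trans
            (≤-reflexive (trans (∣x-y∣≈∣y-x∣ _ S) (0≤x⇒∣x∣≈x (≤⇒0≤- (ub _ (as , u , refl))))))
            (S-x<ε (<-≤-trans S< (+-mono-≤ (∑-mono-⊆ 0≤f u₀ ⊆as) ≤-refl)))
        ; (no none) → contradiction
            (least (S - ε) λ { x (as , u , x≈) → x+ε≤S⇒x≤S-ε
              (≤-trans (≤-reflexive (+-congʳ x≈)) (≮⇒≥ λ S< → none (as , u , S<))) })
            (<⇒≱ (S-ε<S 0<ε)) }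
      where
      S-x<ε : ∀ {S x ε} → S < x + ε → S - x < ε
      S-x<ε {S} {x} {ε} S< = <-resp (+-comm _ _) (solve 2 (λ x e → :- x :+ (x :+ e) := e) refl x ε) (+-mono-≤-< ≤-refl S<)
      x+ε≤S⇒x≤S-ε : ∀ {S x ε} → x + ε ≤ S → x ≤ S - ε
      x+ε≤S⇒x≤S-ε {S} {x} {ε} h = ≤-by (≤⇒0≤- h) (solve 3 (λ s x e → s :- e :- x := s :- (x :+ e)) refl S x ε)
      S-ε<S : ∀ {S ε} → 0# < ε → S - ε < S
      S-ε<S {S} {ε} 0<ε = <-resp (+-identityʳ _) (solve 2 (λ s e → s :- e :+ e := s) refl S ε) (+-mono-≤-< ≤-refl 0<ε)

    ∑≤HasSum : ∀ {S} → HasSum f S → BoundedBy f S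
    ∑≤HasSum {S} hf as u = ∀ε⇒≤ λ ε 0<ε → let as₀ , h = hf ε 0<ε ; bs = dedup (as ++ as₀) in begin
      ∑ f as                  ≤⟨ ∑-mono-⊆ 0≤f u (⊆-dedup (as ++ as₀) ∘ Membership.∈-++⁺ˡ) ⟩
      ∑ f bs                  ≈⟨ solve 2 (λ s t → t := s :+ (t :- s)) refl S (∑ f bs) ⟩
      S + (∑ f bs - S)        ≤⟨ +-monoʳ-≤ S (≤-trans (x≤∣x∣ _) (<⇒≤ (h bs (dedup-unique (as ++ as₀))
                                   (⊆-dedup (as ++ as₀) ∘ Membership.∈-++⁺ʳ as)))) ⟩
      S + ε                   ∎
      where open ≤-Reasoning

  BoundedBy-mono : {A : Set} {f g : A → ℝ} {B : ℝ} → (∀ a → f a ≤ g a) → BoundedBy g B → BoundedBy f B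
  BoundedBy-mono f≤g bounded as u = ≤-trans (∑-mono f≤g as) (bounded as u)

  BoundedBy-* : {A : Set} {f : A → ℝ} {B : ℝ} → ∀ {c} → 0# ≤ c → BoundedBy f B → BoundedBy (λ a → c * f a) (c * B)
  BoundedBy-* {f = f} 0≤c bounded as u = ≤-trans (≤-reflexive (∑-* _ f as)) (*-monoˡ-≤ 0≤c (bounded as u))

  BoundedBy-injection : {A B : Set} (ι : A → B) → (∀ {a a′} → ι a ≡ ι a′ → a ≡ a′) →
    ∀ {f : B → ℝ} {C} → BoundedBy f C → BoundedBy (f ∘ ι) C
  BoundedBy-injection ι inj {f} bounded as u =
    ≤-trans (≤-reflexive (reflexive (≡.sym (∑-map f ι as)))) (bounded (map ι as) (Unique.map⁺ inj u))

  -- A finite set of pairs lies in the product of its two projections, over which the sum factors.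
  BoundedBy-× : {A B : Set} {f : A → ℝ} {g : B → ℝ} {C D : ℝ} →
    (∀ a → 0# ≤ f a) → (∀ b → 0# ≤ g b) → BoundedBy f C → BoundedBy g D →
    BoundedBy (λ (a , b) → f a * g b) (C * D)
  BoundedBy-× {f = f} {g} {C} {D} 0≤f 0≤g bf bg cs u = begin
    ∑ (λ (a , b) → f a * g b) cs                          ≤⟨ ∑-mono-⊆ (λ (a , b) → *-nonNeg (0≤f a) (0≤g b)) u
      (λ c∈cs → Membership.∈-cartesianProduct⁺ (⊆-dedup _ (Membership.∈-map⁺ proj₁ c∈cs))
                                               (⊆-dedup _ (Membership.∈-map⁺ proj₂ c∈cs))) ⟩
    ∑ (λ (a , b) → f a * g b) (cartesianProduct as bs)    ≈⟨ ∑-cartesianProduct f g as bs ⟩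
    ∑ f as * ∑ g bs                                       ≤⟨ *-mono-≤ (∑-nonNeg 0≤f as) (≤-trans (∑-nonNeg 0≤g bs) bg′) bf′ bg′ ⟩
    C * D                                                 ∎
    where
    open ≤-Reasoning
    as = dedup (map proj₁ cs)
    bs = dedup (map proj₂ cs)
    bf′ = bf as (dedup-unique (map proj₁ cs))
    bg′ = bg bs (dedup-unique (map proj₂ cs))

  -- Written as f = (f + g) - g, with both terms nonnegative and f + g ≤ 2g.
  abs-HasSum : {A : Set} {f g : A → ℝ} {B : ℝ} → (∀ a → ∣ f a ∣ ≤ g a) → BoundedBy g B → ∃[ S ] HasSum f S
  abs-HasSum {f = f} {g} {B} ∣f∣≤g bounded =
    let S , hS = nonNeg-HasSum {f = λ a → f a + g a} 0≤f+g (λ as u → ≤-trans (∑-mono f+g≤2g as)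
                   (≤-trans (≤-reflexive (∑-* 2# g as)) (*-monoˡ-≤ 0≤2 (bounded as u))))
        T , hT = nonNeg-HasSum {f = g} (λ a → ≤-trans (0≤∣x∣ _) (∣f∣≤g a)) bounded
    in S + - 1# * T , HasSum-cong (λ a → solve 2 (λ x y → x :+ y :+ :- :1 :* y := x) refl (f a) (g a)) refl
         (HasSum-+ hS (HasSum-* (- 1#) hT))
    where
    0≤f+g : ∀ a → 0# ≤ f a + g a
    0≤f+g a = ≤-by (≤⇒0≤- (≤-trans (-x≤∣x∣ (f a)) (∣f∣≤g a))) (solve 2 (λ x y → x :+ y :- :0 := y :- :- x) refl (f a) (g a))
    f+g≤2g : ∀ a → f a + g a ≤ 2# * g a
    f+g≤2g a = ≤-by (≤⇒0≤- (≤-trans (x≤∣x∣ (f a)) (∣f∣≤g a)))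
      (solve 2 (λ x y → :2 :* y :- (x :+ y) := y :- x) refl (f a) (g a))

  -- Not opened at top level, where the operator _C_ would clash with variables named C.
  open import Data.Nat.Combinatorics using (_C_; nCk≡n!/k![n-k]!; k![n∸k]!∣n!)

  -- Reindexing, grouping and multiplying unconditional sums

  module _ {A B : Set} (J : B → A) (Λ : B → Set)
           (surjective : ∀ a → ∃[ b ] Λ b × J b ≡ a)
           (injective : ∀ {b b′} → Λ b → Λ b′ → J b ≡ J b′ → b ≡ b′)
           where

    images : List B → List A
    images []       = []
    images (b ∷ bs) with lem {Λ b}
    ... | yes _ = J b ∷ images bs
    ... | no _  = images bs

    ∈-images⁺ : ∀ {b bs} → Λ b → b Membership.∈ bs → J b Membership.∈ images bs
    ∈-images⁺ {b} Λb (here {xs = bs} ≡.refl) with lem {Λ b}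
    ... | yes _  = here ≡.refl
    ... | no ¬Λb = contradiction Λb ¬Λb
    ∈-images⁺ Λb (there {x = b′} b∈bs) with lem {Λ b′}
    ... | yes _ = there (∈-images⁺ Λb b∈bs)
    ... | no _  = ∈-images⁺ Λb b∈bs

    ∈-images⁻ : ∀ {a} bs → a Membership.∈ images bs → ∃[ b ] Λ b × J b ≡ a × b Membership.∈ bs
    ∈-images⁻ (b ∷ bs) a∈ with lem {Λ b} | a∈
    ... | yes Λb | here a≡   = b , Λb , ≡.sym a≡ , here ≡.refl
    ... | yes _  | there a∈′ = let b , Λb , eq , b∈ = ∈-images⁻ bs a∈′ in b , Λb , eq , there b∈
    ... | no _   | a∈′       = let b , Λb , eq , b∈ = ∈-images⁻ bs a∈′ in b , Λb , eq , there b∈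

    images-unique : ∀ {bs} → Unique bs → Unique (images bs)
    images-unique {[]}     _ = []
    images-unique {b ∷ bs} u@(_ ∷ u′) with lem {Λ b}
    ... | yes Λb = All.tabulate (λ a∈ J≡a → let b′ , Λb′ , eq , b′∈ = ∈-images⁻ bs a∈ in
                     unique-∉ u (≡.subst (Membership._∈ bs) (injective Λb′ Λb (≡.trans eq (≡.sym J≡a))) b′∈))
                   ∷ images-unique u′
    ... | no _   = images-unique u′

    module _ {f : A → ℝ} {g : B → ℝ}
             (on : ∀ b → Λ b → g b ≈ f (J b)) (off : ∀ b → ¬ Λ b → g b ≈ 0#)
             where

      ∑-images : ∀ bs → ∑ g bs ≈ ∑ f (images bs)
      ∑-images []       = refl
      ∑-images (b ∷ bs) with lem {Λ b}
      ... | yes Λb = +-cong (on b Λb) (∑-images bs)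
      ... | no ¬Λb = trans (+-cong (off b ¬Λb) (∑-images bs)) (+-identityˡ _)

      -- `J` is a bijection from the part Λ of B onto A, and g is f carried back along it, extended
      -- by 0. A finite sum of g is thus one of f over `images`, and choosing a preimage of each
      -- element of `as₀` gives the list that has to be contained.
      HasSum-transfer : ∀ {S} → HasSum f S → HasSum g S
      HasSum-transfer hf ε 0<ε = let as₀ , h = hf ε 0<ε in
        map (proj₁ ∘ surjective) as₀ , λ bs u ⊆bs → <-resp (∣∣-cong (+-congʳ (sym (∑-images bs)))) refl
          (h (images bs) (images-unique u) λ {a} a∈as₀ → let _ , Λb , Jb≡a = surjective a in
            ≡.subst (Membership._∈ images bs) Jb≡a (∈-images⁺ Λb (⊆bs (Membership.∈-map⁺ _ a∈as₀))))

  module _ {A B : Set} (fibre : A → List B) (π : B → A)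
           (∈-fibre : ∀ b → b Membership.∈ fibre (π b))
           (π-fibre : ∀ {a b} → b Membership.∈ fibre a → π b ≡ a)
           (fibre-unique : ∀ a → Unique (fibre a))
           where

    concatMap-fibre-unique : ∀ {as} → Unique as → Unique (concatMap fibre as)
    concatMap-fibre-unique {[]}     _            = []
    concatMap-fibre-unique {a ∷ as} u@(_ ∷ u′) = Unique.++⁺ (fibre-unique a) (concatMap-fibre-unique u′)
      λ (b∈ , b∈′) → let (a′ , a′∈as , b∈″) = Membership.find (Membership.∈-concatMap⁻ fibre b∈′) in
        unique-∉ u (≡.subst (Membership._∈ as) (≡.trans (≡.sym (π-fibre b∈″)) (π-fibre b∈)) a′∈as)

    -- A sum over groups is a sum over the concatenation of the fibres, which contains `bs₀` as soon
    -- as the groups include its image under π. Applied to the antidiagonals of ℕ × ℕ.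
    HasSum-fibres : ∀ {f : B → ℝ} {S} → HasSum f S → HasSum (∑ f ∘ fibre) S
    HasSum-fibres {f} hf ε 0<ε = let bs₀ , h = hf ε 0<ε in
      map π bs₀ , λ as u ⊆as → <-resp (∣∣-cong (+-congʳ (∑-concatMap f fibre as))) refl
        (h (concatMap fibre as) (concatMap-fibre-unique u) λ {b} b∈bs₀ → Membership.∈-concatMap⁺ fibre
          (Any.map (λ πb≡a → ≡.subst (λ a → b Membership.∈ fibre a) πb≡a (∈-fibre b))
                   (⊆as (Membership.∈-map⁺ π b∈bs₀))))

  -- X Y - S T = (X - S) Y + S (Y - T). Bounding |Y| by D rather than by |T| + ε keeps the estimate
  -- linear in ε.
  product-close : ∀ {L S T X Y D ε} → ∣ X * Y - L ∣ ≤ ε → ∣ X - S ∣ ≤ ε → ∣ Y - T ∣ ≤ ε → ∣ Y ∣ ≤ D →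
    ∣ L - S * T ∣ ≤ ε * (D + ∣ S ∣ + 1#)
  product-close {L} {S} {T} {X} {Y} {D} {ε} P-L X-S Y-T Y≤D = begin
    ∣ L - S * T ∣
      ≤⟨ ∣x-z∣≤ L (X * Y) (S * T) ⟩
    ∣ L - X * Y ∣ + ∣ X * Y - S * T ∣
      ≈⟨ +-cong (∣x-y∣≈∣y-x∣ L (X * Y)) (∣∣-cong
           (solve 4 (λ x y s t → x :* y :- s :* t := (x :- s) :* y :+ s :* (y :- t)) refl X Y S T)) ⟩
    ∣ X * Y - L ∣ + ∣ (X - S) * Y + S * (Y - T) ∣
      ≤⟨ +-mono-≤ P-L (∣x+y∣≤∣x∣+∣y∣ _ _) ⟩
    ε + (∣ (X - S) * Y ∣ + ∣ S * (Y - T) ∣)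
      ≈⟨ +-congˡ (+-cong (∣x*y∣≈∣x∣*∣y∣ _ _) (∣x*y∣≈∣x∣*∣y∣ _ _)) ⟩
    ε + (∣ X - S ∣ * ∣ Y ∣ + ∣ S ∣ * ∣ Y - T ∣)
      ≤⟨ +-monoʳ-≤ ε (+-mono-≤ (*-mono-≤ (0≤∣x∣ _) (≤-trans (0≤∣x∣ Y) Y≤D) X-S Y≤D) (*-monoˡ-≤ (0≤∣x∣ S) Y-T)) ⟩
    ε + (ε * D + ∣ S ∣ * ε)
      ≈⟨ solve 3 (λ e d s → e :+ (e :* d :+ s :* e) := e :* (d :+ s :+ :1)) refl ε D ∣ S ∣ ⟩
    ε * (D + ∣ S ∣ + 1#)
      ∎
    where open ≤-Reasoning

  ∀ε⇒≈ : ∀ {x y} → (∀ ε → 0# < ε → ∣ x - y ∣ ≤ ε) → x ≈ y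
  ∀ε⇒≈ {x} {y} h = ≤-antisym
    (≤-by (neg-nonNeg (≤-trans (x≤∣x∣ _) ∣x-y∣≤0)) (solve 2 (λ l m → m :- l := :- (l :- m)) refl x y))
    (≤-by (neg-nonNeg (≤-trans (-x≤∣x∣ _) ∣x-y∣≤0)) (solve 2 (λ l m → l :- m := :- :- (l :- m)) refl x y))
    where
    ∣x-y∣≤0 : ∣ x - y ∣ ≤ 0#
    ∣x-y∣≤0 = ∀ε⇒≤ λ ε 0<ε → ≤-trans (h ε 0<ε) (≤-reflexive (sym (+-identityˡ ε)))

  module _ {A B : Set} {f f′ : A → ℝ} {g g′ : B → ℝ} {C D : ℝ}
           (∣f∣≤f′ : ∀ a → ∣ f a ∣ ≤ f′ a) (∣g∣≤g′ : ∀ b → ∣ g b ∣ ≤ g′ b)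
           (bf : BoundedBy f′ C) (bg : BoundedBy g′ D)
           where

    HasSum-×-∃ : ∃[ L ] HasSum (λ (a , b) → f a * g b) L
    HasSum-×-∃ = abs-HasSum (λ (a , b) → ≤-trans (≤-reflexive (∣x*y∣≈∣x∣*∣y∣ _ _))
        (*-mono-≤ (0≤∣x∣ _) (≤-trans (0≤∣x∣ _) (∣g∣≤g′ b)) (∣f∣≤f′ a) (∣g∣≤g′ b)))
      (BoundedBy-× (λ a → ≤-trans (0≤∣x∣ _) (∣f∣≤f′ a)) (λ b → ≤-trans (0≤∣x∣ _) (∣g∣≤g′ b)) bf bg)

    -- The limit is identified along rectangles as × bs.
    HasSum-×-≈ : ∀ {L S T} → HasSum (λ (a , b) → f a * g b) L → HasSum f S → HasSum g T → L ≈ S * T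
    HasSum-×-≈ {L} {S} {T} hL hf hg = ∀ε⇒≈ λ ε 0<ε →
      ≤-trans (close (ε / K) (/-pos 0<ε 0<K)) (≤-reflexive (*-/-cancel ε 0<K))
      where
      K = D + ∣ S ∣ + 1#
      0<K : 0# < K
      0<K = <-resp refl (+-comm _ _) (+-pos 0<1 (+-nonNeg (bg [] []) (0≤∣x∣ S)))
      close : ∀ ε → 0# < ε → ∣ L - S * T ∣ ≤ ε * K
      close ε 0<ε
        with cs₀ , h ← hL ε 0<ε | as₀ , k ← hf ε 0<ε | bs₀ , l ← hg ε 0<ε =
        product-close
          (≤-trans (≤-reflexive (∣∣-cong (+-congʳ (sym (∑-cartesianProduct f g (dedup as₁) (dedup bs₁))))))
            (<⇒≤ (h _ (Unique.cartesianProduct⁺ (dedup-unique as₁) (dedup-unique bs₁)) λ c∈ → Membership.∈-cartesianProduct⁺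
              (⊆-dedup as₁ (Membership.∈-++⁺ʳ as₀ (Membership.∈-map⁺ proj₁ c∈)))
              (⊆-dedup bs₁ (Membership.∈-++⁺ʳ bs₀ (Membership.∈-map⁺ proj₂ c∈))))))
          (<⇒≤ (k (dedup as₁) (dedup-unique as₁) (⊆-dedup as₁ ∘ Membership.∈-++⁺ˡ)))
          (<⇒≤ (l (dedup bs₁) (dedup-unique bs₁) (⊆-dedup bs₁ ∘ Membership.∈-++⁺ˡ)))
          (≤-trans (∣∑∣≤ ∣g∣≤g′ (dedup bs₁)) (bg (dedup bs₁) (dedup-unique bs₁)))
        where
        as₁ = as₀ ++ map proj₁ cs₀
        bs₁ = bs₀ ++ map proj₂ cs₀

    HasSum-× : ∀ {S T} → HasSum f S → HasSum g T → HasSum (λ (a , b) → f a * g b) (S * T)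
    HasSum-× hf hg = let L , hL = HasSum-×-∃ in HasSum-cong (λ _ → refl) (HasSum-×-≈ hL hf hg) hL

  -- Initial segments are cofinal among the finite subsets of ℕ, so sums over those of length at
  -- least k determine the limit.
  HasSum-∑<-bound : ∀ {f : ℕ → ℝ} {S} → HasSum f S → ∀ {T B} k →
    (∀ n → ∣ ∑< (k ℕ.+ n) f - T ∣ ≤ B) → ∣ S - T ∣ ≤ B
  HasSum-∑<-bound {f} {S} hf {T} {B} k bound = ∀ε⇒≤ λ ε 0<ε →
    let as₀ , h = hf ε 0<ε ; n , ⊆upTo = ⊆-upTo as₀ in begin
      ∣ S - T ∣                                              ≤⟨ ∣x-z∣≤ S (∑< (k ℕ.+ n) f) T ⟩
      ∣ S - ∑< (k ℕ.+ n) f ∣ + ∣ ∑< (k ℕ.+ n) f - T ∣        ≤⟨ +-mono-≤ (≤-trans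
        (≤-reflexive (trans (∣x-y∣≈∣y-x∣ S _) (∣∣-cong (+-congʳ (sym (reflexive (∑-upTo f (k ℕ.+ n))))))))
        (<⇒≤ (h (upTo (k ℕ.+ n)) (Unique.upTo⁺ _)
          (Membership.∈-upTo⁺ ∘ (λ i<n → ℕ.≤-trans i<n (ℕ.m≤n+m n k)) ∘ Membership.∈-upTo⁻ ∘ ⊆upTo)))) (bound n) ⟩
      ε + B                                                  ≈⟨ +-comm ε B ⟩
      B + ε                                                  ∎
    where open ≤-Reasoning

  ∑<≤HasSum : ∀ {f : ℕ → ℝ} {S} → (∀ k → 0# ≤ f k) → HasSum f S → ∀ n → ∑< n f ≤ S
  ∑<≤HasSum {f} 0≤f hf n = ≤-trans (≤-reflexive (reflexive (≡.sym (∑-upTo f n)))) (∑≤HasSum 0≤f hf (upTo n) (Unique.upTo⁺ n))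

  ∑<-BoundedBy : ∀ {f : ℕ → ℝ} {B} → (∀ k → 0# ≤ f k) → (∀ n → ∑< n f ≤ B) → BoundedBy f B
  ∑<-BoundedBy {f} 0≤f bound ks u = let n , ⊆upTo = ⊆-upTo ks in
    ≤-trans (∑-mono-⊆ 0≤f u ⊆upTo) (≤-trans (≤-reflexive (reflexive (∑-upTo f n))) (bound n))

  geometric-∑< : ∀ {x} → 0# ≤ x → ∀ n → ∑< n (λ k → x ^ k) * (1# - x) ≤ 1#
  geometric-∑< {x} 0≤x n = ≤-by (^-nonNeg 0≤x n) (trans (+-congˡ (-‿cong (eq n))) (solve 1 (λ y → :1 :- (:1 :- y) := y) refl (x ^ n)))
    where
    eq : ∀ n → ∑< n (λ k → x ^ k) * (1# - x) ≈ 1# - x ^ n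
    eq zero    = solve 1 (λ x → :0 :* (:1 :- x) := :1 :- :1) refl x
    eq (suc n) = trans (*-congʳ (∑<-suc n (λ k → x ^ k))) (trans (distribʳ _ _ _) (trans (+-congʳ (eq n))
      (solve 2 (λ x y → :1 :- y :+ y :* (:1 :- x) := :1 :- x :* y) refl x (x ^ n))))

  geometric-BoundedBy : ∀ {x} → 0# ≤ x → x < 1# → BoundedBy (λ k → x ^ k) ((1# - x) ⁻¹)
  geometric-BoundedBy 0≤x x<1 = ∑<-BoundedBy {f = λ k → _ ^ k} (^-nonNeg 0≤x) λ n → ≤-trans
    (≤-/ (x<1⇒0<1-x x<1) (geometric-∑< 0≤x n)) (≤-reflexive (*-identityˡ _))
    where
    x<1⇒0<1-x : ∀ {x} → x < 1# → 0# < 1# - x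
    x<1⇒0<1-x {x} x<1 = <-resp (-‿inverseˡ x) (+-comm _ _) (+-mono-≤-< ≤-refl x<1)

  -- The exponential function

  fac-pos : ∀ n → 0# < fromℕ (n !)
  fac-pos n = fromℕ-pos (ℕ.1≤n! n)

  expTerm : ℝ → ℕ → ℝ
  expTerm x k = x ^ k / fromℕ (k !)

  expTerm-nonNeg : ∀ {x} → 0# ≤ x → ∀ k → 0# ≤ expTerm x k
  expTerm-nonNeg 0≤x k = /-nonNeg (^-nonNeg 0≤x k) (fac-pos k)

  ∣expTerm∣ : ∀ x k → ∣ expTerm x k ∣ ≈ expTerm ∣ x ∣ k
  ∣expTerm∣ x k = trans (∣x*y∣≈∣x∣*∣y∣ _ _) (*-cong (∣x^n∣≈∣x∣^n x k) (0≤x⇒∣x∣≈x (<⇒≤ (⁻¹-pos (fac-pos k)))))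

  expTerm-cong : ∀ {x y} → x ≈ y → ∀ k → expTerm x k ≈ expTerm y k
  expTerm-cong x≈y k = *-congʳ (^-congˡ k x≈y)

  -- Up to k = n the power is at most n^n. After that each step multiplies the left side by n and
  -- the right side by a factor larger than n.
  n^k≤n^n*k! : ∀ n → 1 ℕ.≤ n → ∀ k → fromℕ n ^ k ≤ fromℕ n ^ n * fromℕ (k !)
  n^k≤n^n*k! n 1≤n zero = ≤-trans (1≤^ (1≤fromℕ 1≤n) n)
    (≤-trans (≤-reflexive (sym (*-identityʳ _))) (*-monoˡ-≤ (^-nonNeg (fromℕ-nonNeg n) n) (1≤fromℕ (ℕ.1≤n! 0))))
  n^k≤n^n*k! n 1≤n (suc k) with suc k ℕ.≤? n
  ... | yes k<n = ≤-trans (^-monoʳ-≤ (1≤fromℕ 1≤n) k<n)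
    (≤-trans (≤-reflexive (sym (*-identityʳ _))) (*-monoˡ-≤ (^-nonNeg (fromℕ-nonNeg n) n) (1≤fromℕ (ℕ.1≤n! (suc k)))))
  ... | no k≮n  = ≤-trans (*-mono-≤ (fromℕ-nonNeg n) (*-nonNeg (^-nonNeg (fromℕ-nonNeg n) n) (fromℕ-nonNeg (k !)))
      (fromℕ-mono (ℕ.<⇒≤ (ℕ.≰⇒> k≮n))) (n^k≤n^n*k! n 1≤n k))
    (≤-reflexive (trans (solve 3 (λ s a b → s :* (a :* b) := a :* (s :* b)) refl _ _ _) (*-congˡ (sym (fromℕ-* (suc k) (k !))))))

  -- For a natural n ≥ 2x one has (2x)^k ≤ n^n k!, so the series is dominated by the geometric
  -- series n^n / 2^k.
  expTerm-BoundedBy : ∀ {x} → 0# ≤ x → ∃[ B ] BoundedBy (expTerm x) B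
  expTerm-BoundedBy {x} 0≤x = let n₀ , 2x≤n₀ = archimedean (2# * x) in
    _ , BoundedBy-mono (dominated n₀ 2x≤n₀) (BoundedBy-* (^-nonNeg (fromℕ-nonNeg (suc n₀)) (suc n₀))
          (geometric-BoundedBy (<⇒≤ (⁻¹-pos 0<2)) ½<1))
    where
    ½<1 : 2# ⁻¹ < 1#
    ½<1 = ≰⇒> λ 1≤½ → <⇒≱ 0<1 (≤-by (≤⇒0≤- (≤-trans (*-monoˡ-≤ 0≤2 1≤½) (≤-reflexive (*-⁻¹ 0<2))))
      (solve 0 (:0 :- :1 := :1 :- :2 :* :1) refl))
    dominated : ∀ n₀ → 2# * x ≤ fromℕ n₀ → ∀ k → expTerm x k ≤ fromℕ (suc n₀) ^ suc n₀ * (2# ⁻¹) ^ k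
    dominated n₀ 2x≤n₀ k = /-≤ (fac-pos k) (begin
      x ^ k                                             ≈⟨ ^-congˡ k (trans (sym (*-/-cancel x 0<2)) (solve 3 (λ x i t → x :* i :* t := t :* x :* i) refl x (2# ⁻¹) 2#)) ⟩
      (2# * x * 2# ⁻¹) ^ k                              ≈⟨ ^-distrib-* (2# * x) (2# ⁻¹) k ⟩
      (2# * x) ^ k * (2# ⁻¹) ^ k                        ≤⟨ *-monoʳ-≤ (^-nonNeg (<⇒≤ (⁻¹-pos 0<2)) k) (≤-trans
        (^-monoˡ-≤ (*-nonNeg 0≤2 0≤x) (≤-trans 2x≤n₀ (x≤y+x 0≤1)) k) (n^k≤n^n*k! (suc n₀) (s≤s z≤n) k)) ⟩
      fromℕ (suc n₀) ^ suc n₀ * fromℕ (k !) * (2# ⁻¹) ^ k   ≈⟨ solve 3 (λ a b c → a :* b :* c := a :* c :* b) refl _ _ _ ⟩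
      fromℕ (suc n₀) ^ suc n₀ * (2# ⁻¹) ^ k * fromℕ (k !)   ∎)
      where open ≤-Reasoning

  ∣expTerm∣≤ : ∀ x k → ∣ expTerm x k ∣ ≤ expTerm ∣ x ∣ k
  ∣expTerm∣≤ x k = ≤-reflexive (∣expTerm∣ x k)

  exp-HasSum : ∀ x → HasSum (expTerm x) (exp x)
  exp-HasSum x = tsum-HasSum (proj₂ (abs-HasSum (∣expTerm∣≤ x) (proj₂ (expTerm-BoundedBy (0≤∣x∣ x)))))

  exp-cong : ∀ {x y} → x ≈ y → exp x ≈ exp y
  exp-cong {x} {y} x≈y = HasSum-unique (exp-HasSum x) (HasSum-cong (sym ∘ expTerm-cong x≈y) refl (exp-HasSum y))

  nCk*k!*[n∸k]!≡n! : ∀ {n k} → k ℕ.≤ n → (n C k) ℕ.* (k ! ℕ.* (n ∸ k) !) ≡ n !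
  nCk*k!*[n∸k]!≡n! {n} {k} k≤n = ≡.trans (≡.cong (ℕ._* (k ! ℕ.* (n ∸ k) !)) (nCk≡n!/k![n-k]! k≤n))
    (ℕ.m/n*n≡m {{k ℕ.!* (n ∸ k) !≢0}} (k![n∸k]!∣n! k≤n))

  -- The binomial theorem divided by n!.
  ∑<-expTerm : ∀ x y n → ∑< (suc n) (λ k → expTerm x k * expTerm y (n ∸ k)) ≈ expTerm (x + y) n
  ∑<-expTerm x y n = begin
    ∑< (suc n) (λ k → expTerm x k * expTerm y (n ∸ k))
      ≈⟨ ∑<-cong (suc n) (λ k k<1+n → summand k (ℕ.≤-pred k<1+n)) ⟩
    ∑< (suc n) (λ k → fromℕ (n !) ⁻¹ * ((n C k) ×# (x ^ k * y ^ (n ∸ k))))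
      ≈⟨ ∑<-* (suc n) (fromℕ (n !) ⁻¹) (λ k → (n C k) ×# (x ^ k * y ^ (n ∸ k))) ⟩
    fromℕ (n !) ⁻¹ * ∑< (suc n) (λ k → (n C k) ×# (x ^ k * y ^ (n ∸ k)))
      ≈⟨ *-congˡ (Algebra.Properties.CommutativeSemiring.Binomial.theorem commutativeSemiring n x y) ⟨
    fromℕ (n !) ⁻¹ * (x + y) ^ n
      ≈⟨ *-comm _ _ ⟩
    expTerm (x + y) n
      ∎
    where
    open ≈-Reasoning
    open Algebra.Properties.Semiring.Mult semiring using (×-assoc-*; ×-congʳ) renaming (_×_ to infixr 8 _×#_)
    summand : ∀ k → k ℕ.≤ n → expTerm x k * expTerm y (n ∸ k) ≈ fromℕ (n !) ⁻¹ * ((n C k) ×# (x ^ k * y ^ (n ∸ k)))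
    summand k k≤n = begin
      x ^ k * a ⁻¹ * (y ^ (n ∸ k) * b ⁻¹)     ≈⟨ solve 4 (λ u i v j → u :* i :* (v :* j) := i :* j :* (u :* v)) refl _ _ _ _ ⟩
      a ⁻¹ * b ⁻¹ * z                         ≈⟨ *-congʳ (*-cancelʳ (fac-pos n) (trans coefficient (sym (*-/-cancel c (fac-pos n))))) ⟩
      c * N ⁻¹ * z                            ≈⟨ solve 3 (λ c i z → c :* i :* z := i :* (c :* z)) refl c (N ⁻¹) z ⟩
      N ⁻¹ * (c * z)                          ≈⟨ *-congˡ (trans (×-assoc-* (n C k) 1# z) (×-congʳ (n C k) (*-identityˡ z))) ⟩
      N ⁻¹ * ((n C k) ×# z)                    ∎
      where
      a = fromℕ (k !)
      b = fromℕ ((n ∸ k) !)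
      c = fromℕ (n C k)
      N = fromℕ (n !)
      z = x ^ k * y ^ (n ∸ k)
      coefficient : a ⁻¹ * b ⁻¹ * N ≈ c
      coefficient = begin
        a ⁻¹ * b ⁻¹ * N                       ≡⟨ ≡.cong (λ m → a ⁻¹ * b ⁻¹ * fromℕ m) (nCk*k!*[n∸k]!≡n! k≤n) ⟨
        a ⁻¹ * b ⁻¹ * fromℕ ((n C k) ℕ.* (k ! ℕ.* (n ∸ k) !))
          ≈⟨ *-congˡ (trans (fromℕ-* (n C k) _) (*-congˡ (fromℕ-* (k !) _))) ⟩
        a ⁻¹ * b ⁻¹ * (c * (a * b))           ≈⟨ solve 5 (λ i j c a b → i :* j :* (c :* (a :* b)) := c :* (a :* i) :* (b :* j)) refl _ _ c a b ⟩
        c * (a * a ⁻¹) * (b * b ⁻¹)           ≈⟨ *-cong (*-congˡ (*-⁻¹ (fac-pos k))) (*-⁻¹ (fac-pos (n ∸ k))) ⟩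
        c * 1# * 1#                           ≈⟨ trans (*-identityʳ _) (*-identityʳ _) ⟩
        c                                     ∎

  -- Cauchy product of the two exponential series.
  exp-+ : ∀ x y → exp (x + y) ≈ exp x * exp y
  exp-+ x y = HasSum-unique (exp-HasSum (x + y)) (HasSum-cong (λ n → trans (reflexive (≡.trans
      (∑-map term (λ k → k , n ∸ k) (upTo (suc n))) (∑-upTo (λ k → term (k , n ∸ k)) (suc n)))) (∑<-expTerm x y n)) refl
    (HasSum-fibres antidiagonal (λ (k , l) → k ℕ.+ l)
      (λ (k , l) → ≡.subst (λ m → (k , m) Membership.∈ antidiagonal (k ℕ.+ l)) (ℕ.m+n∸m≡n k l)
        (Membership.∈-map⁺ _ (Membership.∈-upTo⁺ (s≤s (ℕ.m≤m+n k l)))))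
      (λ {n} kl∈ → case Membership.∈-map⁻ _ kl∈ of λ { (k , k∈ , ≡.refl) → ℕ.m+[n∸m]≡n (ℕ.≤-pred (Membership.∈-upTo⁻ k∈)) })
      (λ n → Unique.map⁺ (≡.cong proj₁) (Unique.upTo⁺ (suc n)))
      (HasSum-× {f = expTerm x} {g = expTerm y} (∣expTerm∣≤ x) (∣expTerm∣≤ y) (proj₂ (expTerm-BoundedBy (0≤∣x∣ x))) (proj₂ (expTerm-BoundedBy (0≤∣x∣ y)))
        (exp-HasSum x) (exp-HasSum y))))
    where
    term : ℕ × ℕ → ℝ
    term (k , l) = expTerm x k * expTerm y l
    antidiagonal : ℕ → List (ℕ × ℕ)
    antidiagonal n = map (λ k → k , n ∸ k) (upTo (suc n))

  expTerm-0 : ∀ x → expTerm x 0 ≈ 1#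
  expTerm-0 x = *-cancelʳ (fac-pos 0) (trans (*-/-cancel 1# (fac-pos 0))
    (sym (trans (*-identityˡ _) (+-identityʳ 1#))))

  expTerm-1 : ∀ x → expTerm x 1 ≈ x
  expTerm-1 x = *-cancelʳ (fac-pos 1) (trans (*-/-cancel (x ^ 1) (fac-pos 1)) (*-congˡ (sym (+-identityʳ 1#))))

  ∑<expTerm≤exp : ∀ {x} → 0# ≤ x → ∀ n → ∑< n (expTerm x) ≤ exp x
  ∑<expTerm≤exp 0≤x = ∑<≤HasSum (expTerm-nonNeg 0≤x) (exp-HasSum _)

  expTerm≤exp : ∀ {x} → 0# ≤ x → ∀ k → expTerm x k ≤ exp x
  expTerm≤exp {x} 0≤x k = ≤-trans (≤-reflexive (sym (+-identityʳ _)))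
    (∑≤HasSum (expTerm-nonNeg 0≤x) (exp-HasSum x) (k ∷ []) ([] ∷ []))

  1+x≤exp : ∀ {x} → 0# ≤ x → 1# + x ≤ exp x
  1+x≤exp {x} 0≤x = ≤-trans (≤-reflexive (sym (+-cong (expTerm-0 x) (trans (+-identityʳ _) (expTerm-1 x)))))
    (∑<expTerm≤exp 0≤x 2)

  1≤exp : ∀ {x} → 0# ≤ x → 1# ≤ exp x
  1≤exp 0≤x = ≤-trans (x≤x+y 0≤x) (1+x≤exp 0≤x)

  -- By additivity the value is a positive idempotent.
  exp-0 : exp 0# ≈ 1#
  exp-0 = *-cancelʳ (<-≤-trans 0<1 (1≤exp ≤-refl))
    (trans (sym (exp-+ 0# 0#)) (trans (exp-cong (+-identityˡ 0#)) (sym (*-identityˡ _))))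

  exp-neg : ∀ x → exp x * exp (- x) ≈ 1#
  exp-neg x = trans (sym (exp-+ x (- x))) (trans (exp-cong (-‿inverseʳ x)) exp-0)

  exp-pos : ∀ x → 0# < exp x
  exp-pos x with total 0# x
  ... | inj₁ 0≤x = <-≤-trans 0<1 (1≤exp 0≤x)
  ... | inj₂ x≤0 = <-resp refl (sym (⁻¹-unique 0<exp-x (trans (*-comm _ _) (exp-neg x)))) (⁻¹-pos 0<exp-x)
    where
    0<exp-x : 0# < exp (- x)
    0<exp-x = <-≤-trans 0<1 (1≤exp (neg-nonNeg x≤0))

  exp-mono : ∀ {x y} → x ≤ y → exp x ≤ exp y
  exp-mono {x} {y} x≤y = begin
    exp x                  ≈⟨ *-identityʳ _ ⟨
    exp x * 1#             ≤⟨ *-monoˡ-≤ (<⇒≤ (exp-pos x)) (1≤exp (≤⇒0≤- x≤y)) ⟩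
    exp x * exp (y - x)    ≈⟨ exp-+ x (y - x) ⟨
    exp (x + (y - x))      ≈⟨ exp-cong (solve 2 (λ x y → x :+ (y :- x) := y) refl x y) ⟩
    exp y                  ∎
    where open ≤-Reasoning

  exp≤1 : ∀ {x} → x ≤ 0# → exp x ≤ 1#
  exp≤1 x≤0 = ≤-trans (exp-mono x≤0) (≤-reflexive exp-0)

  -- Equality would force exp x = 1, against 1 + x ≤ exp x.
  exp-neg<1 : ∀ {x} → 0# < x → exp (- x) < 1#
  exp-neg<1 {x} 0<x = exp≤1 (neg-nonPos (<⇒≤ 0<x)) , λ eq → <⇒≱ 0<x (≤-by
    (≤⇒0≤- (≤-trans (1+x≤exp (<⇒≤ 0<x)) (≤-reflexive (trans (sym (*-identityʳ _)) (trans (*-congˡ (sym eq)) (exp-neg x))))))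
    (solve 1 (λ x → :0 :- x := :1 :- (:1 :+ x)) refl x))

  exp-fromℕ-* : ∀ n x → exp (fromℕ n * x) ≈ exp x ^ n
  exp-fromℕ-* zero    x = trans (exp-cong (zeroˡ x)) exp-0
  exp-fromℕ-* (suc n) x = trans (exp-cong (solve 2 (λ n x → (:1 :+ n) :* x := x :+ n :* x) refl (fromℕ n) x))
    (trans (exp-+ x (fromℕ n * x)) (*-congˡ (exp-fromℕ-* n x)))

  -- A single term of the series of exp (η s) is at most its sum. With η arbitrarily small, this
  -- trades a polynomial factor for a small share of an exponential decay.
  ^≤exp : ∀ {η s} → 0# < η → 0# ≤ s → ∀ k → s ^ k ≤ fromℕ (k !) / η ^ k * exp (η * s)
  ^≤exp {η} {s} 0<η 0≤s k = *-cancelʳ-≤ (^-pos 0<η k) (begin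
    s ^ k * η ^ k                               ≈⟨ trans (*-comm _ _) (sym (^-distrib-* η s k)) ⟩
    (η * s) ^ k                                 ≈⟨ *-/-cancel _ (fac-pos k) ⟨
    expTerm (η * s) k * fromℕ (k !)             ≤⟨ *-monoʳ-≤ (fromℕ-nonNeg (k !)) (expTerm≤exp (*-nonNeg (<⇒≤ 0<η) 0≤s) k) ⟩
    exp (η * s) * fromℕ (k !)                   ≈⟨ *-congˡ (*-/-cancel (fromℕ (k !)) (^-pos 0<η k)) ⟨
    exp (η * s) * (fromℕ (k !) / η ^ k * η ^ k) ≈⟨ solve 3 (λ e f h → e :* (f :* h) := f :* e :* h) refl _ _ _ ⟩
    fromℕ (k !) / η ^ k * exp (η * s) * η ^ k   ∎)
    where open ≤-Reasoning

  -- Taylor's theorem for the exponential function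

  n!≤[m+n]! : ∀ m n → n ! ℕ.≤ (m ℕ.+ n) !
  n!≤[m+n]! zero    n = ℕ.≤-refl
  n!≤[m+n]! (suc m) n = ℕ.≤-trans (n!≤[m+n]! m n) (ℕ.m≤m+n _ _)

  taylor : ℕ → ℝ → ℝ
  taylor p x = ∑< (suc p) (expTerm x)

  -- Since (p + 1 + i)! ≥ i!, the factor |x|^(p+1) comes out of the tail and leaves part of the
  -- series of exp |x|.
  exp-taylor-∣∣ : ∀ p x → ∣ exp x - taylor p x ∣ ≤ ∣ x ∣ ^ suc p * exp ∣ x ∣
  exp-taylor-∣∣ p x = HasSum-∑<-bound (exp-HasSum x) (suc p) λ n → begin
    ∣ ∑< (suc p ℕ.+ n) (expTerm x) - taylor p x ∣
      ≈⟨ ∣∣-cong (trans (+-congʳ (∑<-split (suc p) n (expTerm x))) (solve 2 (λ t r → t :+ r :- t := r) refl _ _)) ⟩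
    ∣ ∑< n (λ i → expTerm x (suc p ℕ.+ i)) ∣
      ≤⟨ ∣∑<∣≤ n (λ i _ → tail i) ⟩
    ∑< n (λ i → ∣ x ∣ ^ suc p * expTerm ∣ x ∣ i)
      ≈⟨ ∑<-* n (∣ x ∣ ^ suc p) (expTerm ∣ x ∣) ⟩
    ∣ x ∣ ^ suc p * ∑< n (expTerm ∣ x ∣)
      ≤⟨ *-monoˡ-≤ (^-nonNeg (0≤∣x∣ x) (suc p)) (∑<expTerm≤exp (0≤∣x∣ x) n) ⟩
    ∣ x ∣ ^ suc p * exp ∣ x ∣
      ∎
    where
    open ≤-Reasoning
    tail : ∀ i → ∣ expTerm x (suc p ℕ.+ i) ∣ ≤ ∣ x ∣ ^ suc p * expTerm ∣ x ∣ i
    tail i = begin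
      ∣ expTerm x (suc p ℕ.+ i) ∣                           ≈⟨ ∣expTerm∣ x (suc p ℕ.+ i) ⟩
      ∣ x ∣ ^ (suc p ℕ.+ i) * fromℕ ((suc p ℕ.+ i) !) ⁻¹    ≤⟨ *-monoˡ-≤ (^-nonNeg (0≤∣x∣ x) (suc p ℕ.+ i))
                                                                 (⁻¹-anti (fac-pos i) (fromℕ-mono (n!≤[m+n]! (suc p) i))) ⟩
      ∣ x ∣ ^ (suc p ℕ.+ i) * fromℕ (i !) ⁻¹                ≈⟨ *-congʳ (^-homo-* ∣ x ∣ (suc p) i) ⟩
      ∣ x ∣ ^ suc p * ∣ x ∣ ^ i * fromℕ (i !) ⁻¹            ≈⟨ *-assoc _ _ _ ⟩
      ∣ x ∣ ^ suc p * expTerm ∣ x ∣ i                       ∎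

  ∣taylor∣≤ : ∀ p {x y} → ∣ x ∣ ≤ y → 1# ≤ y → ∣ taylor p x ∣ ≤ fromℕ (suc p) * y ^ p
  ∣taylor∣≤ p {x} {y} ∣x∣≤y 1≤y = ≤-trans (∣∑<∣≤ (suc p) λ i i<1+p → begin
      ∣ expTerm x i ∣                   ≈⟨ ∣expTerm∣ x i ⟩
      ∣ x ∣ ^ i / fromℕ (i !)           ≤⟨ /-≤ (fac-pos i) (≤-trans (≤-reflexive (sym (*-identityʳ _)))
                                             (*-mono-≤ (^-nonNeg (0≤∣x∣ x) i) (fromℕ-nonNeg (i !))
                                               (≤-trans (^-monoˡ-≤ (0≤∣x∣ x) ∣x∣≤y i) (^-monoʳ-≤ 1≤y (ℕ.≤-pred i<1+p)))
                                               (1≤fromℕ (ℕ.1≤n! i)))) ⟩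
      y ^ p                             ∎)
    (≤-reflexive (∑<-const (suc p) (y ^ p)))
    where open ≤-Reasoning

  -- `exp 1#` bounds exp |x| when -1 ≤ x ≤ 0. For x ≤ -1, the p + 1 terms of the Taylor polynomial
  -- and exp x itself are each at most |x|^(p+1), which makes p + 2. For x ≥ 0, anything from 1 on
  -- would do.
  taylorConstant : ℕ → ℝ
  taylorConstant p = exp 1# + fromℕ (suc (suc p))

  -- For x < -1 the crude bound by |exp x| + |taylor p x| is good enough.
  exp-taylor : ∀ p x → ∣ exp x - taylor p x ∣ ≤ taylorConstant p * ∣ x ∣ ^ suc p * (1# + exp x)
  exp-taylor p x with total 0# x
  ... | inj₁ 0≤x = begin
    ∣ exp x - taylor p x ∣                            ≤⟨ exp-taylor-∣∣ p x ⟩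
    ∣ x ∣ ^ suc p * exp ∣ x ∣                         ≈⟨ *-cong (*-identityˡ _) (sym (exp-cong (0≤x⇒∣x∣≈x 0≤x))) ⟨
    1# * ∣ x ∣ ^ suc p * exp x                        ≤⟨ *-mono-≤ (*-nonNeg 0≤1 0≤∣x∣^) (<⇒≤ 0<1+e) (*-monoʳ-≤ 0≤∣x∣^ 1≤D) (x≤y+x 0≤1) ⟩
    taylorConstant p * ∣ x ∣ ^ suc p * (1# + exp x)   ∎
    where
    open ≤-Reasoning
    0≤∣x∣^ = ^-nonNeg (0≤∣x∣ x) (suc p)
    0<1+e = +-pos 0<1 (<⇒≤ (exp-pos x))
    1≤D : 1# ≤ taylorConstant p
    1≤D = ≤-trans (1≤exp 0≤1) (x≤x+y (fromℕ-nonNeg (suc (suc p))))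
  ... | inj₂ x≤0 with total ∣ x ∣ 1#
  ...   | inj₁ ∣x∣≤1 = begin
    ∣ exp x - taylor p x ∣                            ≤⟨ exp-taylor-∣∣ p x ⟩
    ∣ x ∣ ^ suc p * exp ∣ x ∣                         ≤⟨ *-monoˡ-≤ 0≤∣x∣^ (exp-mono ∣x∣≤1) ⟩
    ∣ x ∣ ^ suc p * exp 1#                            ≤⟨ *-monoˡ-≤ 0≤∣x∣^ (x≤x+y (fromℕ-nonNeg (suc (suc p)))) ⟩
    ∣ x ∣ ^ suc p * taylorConstant p                  ≈⟨ trans (*-comm _ _) (sym (*-identityʳ _)) ⟩
    taylorConstant p * ∣ x ∣ ^ suc p * 1#             ≤⟨ *-monoˡ-≤ (*-nonNeg 0≤D 0≤∣x∣^) (x≤x+y (<⇒≤ (exp-pos x))) ⟩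
    taylorConstant p * ∣ x ∣ ^ suc p * (1# + exp x)   ∎
    where
    open ≤-Reasoning
    0≤∣x∣^ = ^-nonNeg (0≤∣x∣ x) (suc p)
    0≤D : 0# ≤ taylorConstant p
    0≤D = +-nonNeg (<⇒≤ (exp-pos 1#)) (fromℕ-nonNeg (suc (suc p)))
  ...   | inj₂ 1≤∣x∣ = begin
    ∣ exp x - taylor p x ∣                            ≤⟨ ∣x+y∣≤∣x∣+∣y∣ _ _ ⟩
    ∣ exp x ∣ + ∣ - taylor p x ∣                      ≈⟨ +-cong (0≤x⇒∣x∣≈x (<⇒≤ (exp-pos x))) (∣-x∣≈∣x∣ _) ⟩
    exp x + ∣ taylor p x ∣                            ≤⟨ +-mono-≤ (≤-trans (exp≤1 x≤0) (1≤^ 1≤∣x∣ (suc p)))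
                                                           (≤-trans (∣taylor∣≤ p ≤-refl 1≤∣x∣) (*-monoˡ-≤ (fromℕ-nonNeg (suc p)) (^-monoʳ-≤ 1≤∣x∣ (ℕ.n≤1+n p)))) ⟩
    ∣ x ∣ ^ suc p + fromℕ (suc p) * ∣ x ∣ ^ suc p     ≈⟨ solve 2 (λ n y → y :+ n :* y := (:1 :+ n) :* y) refl (fromℕ (suc p)) _ ⟩
    fromℕ (suc (suc p)) * ∣ x ∣ ^ suc p               ≤⟨ *-monoʳ-≤ 0≤∣x∣^ (x≤y+x (<⇒≤ (exp-pos 1#))) ⟩
    taylorConstant p * ∣ x ∣ ^ suc p                  ≈⟨ *-identityʳ _ ⟨
    taylorConstant p * ∣ x ∣ ^ suc p * 1#             ≤⟨ *-monoˡ-≤ (*-nonNeg 0≤D 0≤∣x∣^) (x≤x+y (<⇒≤ (exp-pos x))) ⟩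
    taylorConstant p * ∣ x ∣ ^ suc p * (1# + exp x)   ∎
    where
    open ≤-Reasoning
    0≤∣x∣^ = ^-nonNeg (0≤∣x∣ x) (suc p)
    0≤D : 0# ≤ taylorConstant p
    0≤D = +-nonNeg (<⇒≤ (exp-pos 1#)) (fromℕ-nonNeg (suc (suc p)))

  -- The Euler function

  ∏< : ℕ → (ℕ → ℝ) → ℝ
  ∏< n f = product {n} (f ∘ toℕ)

  ∏<-suc : ∀ n (f : ℕ → ℝ) → ∏< (suc n) f ≈ ∏< n f * f n
  ∏<-suc zero    f = *-comm _ _
  ∏<-suc (suc n) f = trans (*-congˡ (∏<-suc n (f ∘ suc))) (sym (*-assoc _ _ _))

  -- Completeness is stated for suprema, so the limit is minus the supremum of the negated terms.
  antitone-ConvergesTo : (s : ℕ → ℝ) → (∀ n → s (suc n) ≤ s n) → ∀ {δ} → (∀ n → δ ≤ s n) → ∃ (ConvergesTo s)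
  antitone-ConvergesTo s step {δ} δ≤ =
    let S , ub , least = supremum (λ y → ∃[ n ] y ≈ - s n) (- s 0 , 0 , refl)
                           (- δ , λ { y (n , y≈) → ≤-trans (≤-reflexive y≈) (neg-mono-≤ (δ≤ n)) })
    in - S , λ ε 0<ε → case lem {∃[ n ] S - ε < - s n} of λ
      { (yes (n₀ , S-ε<)) → n₀ , λ n n₀≤n → ≤-<-trans
          (≤-reflexive (trans (∣∣-cong (solve 2 (λ a S → a :- :- S := S :- :- a) refl (s n) S)) (0≤x⇒∣x∣≈x (≤⇒0≤- (ub _ (n , refl))))))
          (<-resp (solve 3 (λ S e a → S :- e :+ (e :- a) := S :- a) refl S ε (- s n))
                  (solve 2 (λ e a → a :+ (e :- a) := e) refl ε (- s n))
                  (<+-monoˡ (<-≤-trans S-ε< (neg-mono-≤ (antitone n₀≤n)))))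
      ; (no none) → contradiction (least (S - ε) λ { y (n , y≈) → ≤-trans (≤-reflexive y≈) (≮⇒≥ λ lt → none (n , lt)) })
          (<⇒≱ (<-resp (+-identityʳ _) (solve 2 (λ s e → s :- e :+ e := s) refl S ε) (+-mono-≤-< ≤-refl 0<ε))) }
    where
    <+-monoˡ : ∀ {x y z} → x < y → x + z < y + z
    <+-monoˡ x<y = <-resp (+-comm _ _) (+-comm _ _) (+-mono-≤-< ≤-refl x<y)
    antitone′ : ∀ {m n} → m ℕ.≤′ n → s n ≤ s m
    antitone′ ℕ.≤′-refl     = ≤-refl
    antitone′ (ℕ.≤′-step p) = ≤-trans (step _) (antitone′ p)
    antitone : ∀ {m n} → m ℕ.≤ n → s n ≤ s m
    antitone = antitone′ ∘ ℕ.≤⇒≤′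

  ConvergesTo-≥ : ∀ {s L δ} → ConvergesTo s L → (∀ n → δ ≤ s n) → δ ≤ L
  ConvergesTo-≥ {s} {L} conv δ≤ = ∀ε⇒≤ λ ε 0<ε → let n₀ , h = conv ε 0<ε in
    ≤-trans (δ≤ n₀) (≤-trans (≤-reflexive (solve 2 (λ a l → a := l :+ (a :- l)) refl (s n₀) L))
      (+-monoʳ-≤ L (≤-trans (x≤∣x∣ _) (<⇒≤ (h n₀ ℕ.≤-refl)))))

  Linked-bounded : ∀ {a xs m} → Linked ℕ._≥_ (a ∷ xs) → a ℕ.≤ m → All (ℕ._≤ m) (a ∷ xs)
  Linked-bounded [-]       a≤m = a≤m ∷ []
  Linked-bounded (b≤a ∷ l) a≤m = a≤m ∷ Linked-bounded l (ℕ.≤-trans b≤a a≤m)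

  Linked-tail : ∀ {a xs} → Linked ℕ._≥_ (a ∷ xs) → Linked ℕ._≥_ xs
  Linked-tail [-]     = []
  Linked-tail (_ ∷ l) = l

  module Euler {x} (0≤x : 0# ≤ x) (x<1 : x < 1#) where

    factor : ℕ → ℝ
    factor k = 1# - x ^ suc k

    0<1-x : 0# < 1# - x
    0<1-x = <-resp (-‿inverseˡ x) (+-comm _ _) (+-mono-≤-< ≤-refl x<1)

    c : ℝ
    c = (1# - x) ⁻¹

    0≤c : 0# ≤ c
    0≤c = <⇒≤ (⁻¹-pos 0<1-x)

    x^k≤1 : ∀ k → x ^ k ≤ 1#
    x^k≤1 k = ≤-trans (^-monoˡ-≤ 0≤x (<⇒≤ x<1) k) (≤-reflexive (1^n≈1 k))

    x^1+k≤x : ∀ k → x ^ suc k ≤ x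
    x^1+k≤x k = ≤-trans (*-monoˡ-≤ 0≤x (x^k≤1 k)) (≤-reflexive (*-identityʳ x))

    factor-nonNeg : ∀ k → 0# ≤ factor k
    factor-nonNeg k = ≤⇒0≤- (x^k≤1 (suc k))

    ∏-nonNeg : ∀ n → 0# ≤ ∏< n factor
    ∏-nonNeg zero    = 0≤1
    ∏-nonNeg (suc n) = ≤-trans (*-nonNeg (∏-nonNeg n) (factor-nonNeg n)) (≤-reflexive (sym (∏<-suc n factor)))

    -- (1 - y) exp (c y) ≥ (1 - y) (1 + c y) ≥ 1 for 0 ≤ y ≤ x.
    1≤[1-y]exp[cy] : ∀ {y} → 0# ≤ y → y ≤ x → 1# ≤ (1# - y) * exp (c * y)
    1≤[1-y]exp[cy] {y} 0≤y y≤x = ≤-trans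
      (≤-by (*-nonNeg 0≤y (*-nonNeg 0≤c (≤⇒0≤- y≤x)))
        (trans (solve 3 (λ y c x → (:1 :- y) :* (:1 :+ c :* y) :- :1 := y :* (c :* (x :- y)) :+ y :* ((:1 :- x) :* c :- :1)) refl y c x)
        (trans (+-congˡ (*-congˡ (+-congʳ (*-⁻¹ 0<1-x)))) (solve 2 (λ a y → a :+ y :* (:1 :- :1) := a) refl _ y))))
      (*-monoˡ-≤ (≤⇒0≤- (≤-trans y≤x (<⇒≤ x<1))) (1+x≤exp (*-nonNeg 0≤c 0≤y)))

    1≤∏*exp : ∀ n → 1# ≤ ∏< n factor * exp (c * ∑< n (λ k → x ^ suc k))
    1≤∏*exp zero    = ≤-reflexive (sym (trans (*-identityˡ _) (trans (exp-cong (zeroʳ c)) exp-0)))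
    1≤∏*exp (suc n) = begin
      1#                                                ≈⟨ *-identityˡ 1# ⟨
      1# * 1#                                           ≤⟨ *-mono-≤ 0≤1 (≤-trans 0≤1 step) (1≤∏*exp n) step ⟩
      ∏< n factor * exp (c * G) * (factor n * exp (c * x ^ suc n))
        ≈⟨ solve 4 (λ p e f g → p :* e :* (f :* g) := p :* f :* (e :* g)) refl _ _ _ _ ⟩
      ∏< n factor * factor n * (exp (c * G) * exp (c * x ^ suc n))
        ≈⟨ *-cong (sym (∏<-suc n factor)) (trans (sym (exp-+ _ _))
             (exp-cong (trans (sym (distribˡ c G _)) (*-congˡ (sym (∑<-suc n (λ k → x ^ suc k))))))) ⟩
      ∏< (suc n) factor * exp (c * ∑< (suc n) (λ k → x ^ suc k)) ∎
      where
      open ≤-Reasoning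
      G = ∑< n (λ k → x ^ suc k)
      step = 1≤[1-y]exp[cy] (^-nonNeg 0≤x (suc n)) (x^1+k≤x n)

    ∑x^1+k≤c : ∀ n → ∑< n (λ k → x ^ suc k) ≤ c
    ∑x^1+k≤c n = ≤-trans (∑<-mono n (λ k _ → ≤-trans (*-monoʳ-≤ (^-nonNeg 0≤x k) (<⇒≤ x<1)) (≤-reflexive (*-identityˡ _))))
      (≤-trans (≤-/ 0<1-x (geometric-∑< 0≤x n)) (≤-reflexive (*-identityˡ _)))

    -- Multiplying 1 ≤ (1 - y) exp (c y) over y = x^(k+1) gives the exponent c times a geometric
    -- sum, and that sum is at most c again.
    B : ℝ
    B = exp (c * c)

    1≤∏*B : ∀ n → 1# ≤ ∏< n factor * B
    1≤∏*B n = ≤-trans (1≤∏*exp n) (*-monoˡ-≤ (∏-nonNeg n) (exp-mono (*-monoˡ-≤ 0≤c (∑x^1+k≤c n))))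

    B⁻¹≤∏ : ∀ n → B ⁻¹ ≤ ∏< n factor
    B⁻¹≤∏ n = *-cancelʳ-≤ (exp-pos (c * c)) (≤-trans (≤-reflexive (trans (*-comm _ _) (*-⁻¹ (exp-pos (c * c))))) (1≤∏*B n))

    -- Convergence comes first, because a divergent `lim` would be `0#`. The partial products
    -- decrease and stay above `B ⁻¹`, which also bounds the limit.
    φ-pos : 0# < φ x
    φ-pos = <-≤-trans (⁻¹-pos (exp-pos (c * c))) (ConvergesTo-≥ (choose-spec _ (antitone-ConvergesTo (λ n → ∏< n factor)
      (λ n → ≤-trans (≤-reflexive (∏<-suc n factor)) (≤-trans (*-monoˡ-≤ (∏-nonNeg n)
        (≤-by (^-nonNeg 0≤x (suc n)) (solve 1 (λ y → :1 :- (:1 :- y) := y) refl _))) (≤-reflexive (*-identityʳ _)))) B⁻¹≤∏)) B⁻¹≤∏)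

    -- The partitions with parts at most k and length at most n.
    partitions : ℕ → ℕ → List (List ℕ)
    partitions zero    n       = [] ∷ []
    partitions (suc k) zero    = [] ∷ []
    partitions (suc k) (suc n) = partitions k (suc n) ++ map (suc k ∷_) (partitions (suc k) n)

    -- Truncated form of Euler's generating function. Split by whether the part k + 1 occurs: with y
    -- = x^(k+1), the two halves contribute at most 1 - y and y.
    ∑partitions : ∀ k n → ∑ (λ xs → x ^ ℕ.sum xs) (partitions k n) * ∏< k factor ≤ 1#
    ∑partitions zero    n       = ≤-reflexive (solve 0 ((:1 :+ :0) :* :1 := :1) refl)
    ∑partitions (suc k) zero    = ≤-trans (≤-reflexive (trans (*-congˡ (∏<-suc k factor)) (trans (*-congʳ (+-identityʳ 1#)) (*-identityˡ _))))
      (≤-trans (*-mono-≤ (∏-nonNeg k) 0≤1 (∏≤1 k) (factor≤1 k)) (≤-reflexive (*-identityˡ 1#)))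
      where
      factor≤1 : ∀ k → factor k ≤ 1#
      factor≤1 k = ≤-by (^-nonNeg 0≤x (suc k)) (solve 1 (λ y → :1 :- (:1 :- y) := y) refl _)
      ∏≤1 : ∀ k → ∏< k factor ≤ 1#
      ∏≤1 zero    = ≤-refl
      ∏≤1 (suc k) = ≤-trans (≤-reflexive (∏<-suc k factor)) (≤-trans (*-mono-≤ (∏-nonNeg k) 0≤1 (∏≤1 k) (factor≤1 k)) (≤-reflexive (*-identityˡ 1#)))
    ∑partitions (suc k) (suc n) = begin
      ∑ weight (partitions k (suc n) ++ map (suc k ∷_) (partitions (suc k) n)) * ∏< (suc k) factor
        ≈⟨ *-congʳ (trans (∑-++ weight (partitions k (suc n)) _) (+-congˡ (trans (reflexive (∑-map weight (suc k ∷_) (partitions (suc k) n)))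
             (trans (∑-cong (λ xs → ^-homo-* x (suc k) (ℕ.sum xs)) (partitions (suc k) n)) (∑-* y weight (partitions (suc k) n)))))) ⟩
      (S₁ + y * S₂) * ∏< (suc k) factor
        ≈⟨ trans (distribʳ _ _ _) (+-cong (trans (*-congˡ (∏<-suc k factor)) (sym (*-assoc _ _ _))) (*-assoc _ _ _)) ⟩
      S₁ * ∏< k factor * factor k + y * (S₂ * ∏< (suc k) factor)
        ≤⟨ +-mono-≤ (*-monoʳ-≤ (factor-nonNeg k) (∑partitions k (suc n))) (*-monoˡ-≤ (^-nonNeg 0≤x (suc k)) (∑partitions (suc k) n)) ⟩
      1# * (1# - y) + y * 1#
        ≈⟨ solve 1 (λ y → :1 :* (:1 :- y) :+ y :* :1 := :1) refl y ⟩
      1#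
        ∎
      where
      open ≤-Reasoning
      weight : List ℕ → ℝ
      weight xs = x ^ ℕ.sum xs
      y = x ^ suc k
      S₁ = ∑ weight (partitions k (suc n))
      S₂ = ∑ weight (partitions (suc k) n)

    ∈-partitions : ∀ k n {xs} → Linked ℕ._≥_ xs → All (0 ℕ.<_) xs → All (ℕ._≤ k) xs → List.length xs ℕ.≤ n →
                   xs Membership.∈ partitions k n
    ∈-partitions zero    n       {[]}     _ _ _ _ = here ≡.refl
    ∈-partitions zero    n       {a ∷ xs} _ (0<a ∷ _) (a≤0 ∷ _) _ = contradiction 0<a (ℕ.≤⇒≯ a≤0)
    ∈-partitions (suc k) zero    {[]}     _ _ _ _ = here ≡.refl
    ∈-partitions (suc k) (suc n) {[]}     _ _ _ _ = Membership.∈-++⁺ˡ (∈-partitions k (suc n) [] [] [] z≤n)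
    ∈-partitions (suc k) (suc n) {a ∷ xs} l p@(_ ∷ p′) b@(a≤1+k ∷ b′) (s≤s len) with a ℕ.≟ suc k
    ... | yes ≡.refl = Membership.∈-++⁺ʳ (partitions k (suc n)) (Membership.∈-map⁺ (suc k ∷_)
                         (∈-partitions (suc k) n (Linked-tail l) p′ b′ len))
    ... | no a≢1+k   = Membership.∈-++⁺ˡ (∈-partitions k (suc n) l p
                         (Linked-bounded l (ℕ.≤-pred (ℕ.≤∧≢⇒< a≤1+k a≢1+k))) (s≤s len))

  -- Summability over partitions, integers and triples

  recompute : {P : Set} → .P → P
  recompute {P} p with lem {P}
  ... | yes p′ = p′
  ... | no ¬p  = ⊥-elim-irr (¬p p)

  value-injective : {A : Set} {P : A → Set} {a b : Refinement A P} → value a ≡ value b → a ≡ b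
  value-injective ≡.refl = ≡.refl

  IsPartition : List ℕ → Set
  IsPartition xs = Linked ℕ._≥_ xs × All (0 ℕ.<_) xs

  -- The proof stored in a `Refinement` is irrelevant; excluded middle turns it into one that can be
  -- analysed.
  isPartition : (μ : Partition) → IsPartition (value μ)
  isPartition (xs , [ p ]) = recompute p

  length≤sum : ∀ {xs} → All (0 ℕ.<_) xs → List.length xs ℕ.≤ ℕ.sum xs
  length≤sum []          = z≤n
  length≤sum (0<a ∷ 0<s) = ℕ.+-mono-≤ 0<a (length≤sum 0<s)

  All-≤sum : ∀ xs → All (ℕ._≤ ℕ.sum xs) xs
  All-≤sum []       = []
  All-≤sum (a ∷ xs) = ℕ.m≤m+n a _ ∷ All.map (λ b≤ → ℕ.≤-trans b≤ (ℕ.m≤n+m _ a)) (All-≤sum xs)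

  sizes-bounded : (μs : List Partition) → ∃[ k ] (∀ {μ} → μ Membership.∈ μs → size μ ℕ.≤ k)
  sizes-bounded []       = 0 , λ ()
  sizes-bounded (ν ∷ μs) with k , h ← sizes-bounded μs = size ν ℕ.⊔ k , λ
    { (here ≡.refl) → ℕ.m≤m⊔n _ k ; (there μ∈) → ℕ.≤-trans (h μ∈) (ℕ.m≤n⊔m _ k) }

  module _ {x} (0≤x : 0# ≤ x) (x<1 : x < 1#) where

    open Euler 0≤x x<1

    -- Finitely many partitions have a common bound k on their sizes. It bounds their parts and
    -- their lengths too, so all of them occur in `partitions k k`.
    partition-BoundedBy : BoundedBy (λ μ → x ^ size μ) B
    partition-BoundedBy μs u with k , size≤k ← sizes-bounded μs = begin
      ∑ (λ μ → x ^ size μ) μs                         ≡⟨ ∑-map (λ xs → x ^ ℕ.sum xs) value μs ⟨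
      ∑ (λ xs → x ^ ℕ.sum xs) (map value μs)          ≤⟨ ∑-mono-⊆ (λ xs → ^-nonNeg 0≤x (ℕ.sum xs)) (Unique.map⁺ value-injective u)
        (λ xs∈ → case Membership.∈-map⁻ value xs∈ of λ { (μ , μ∈ , ≡.refl) →
           let l , p = isPartition μ ; ≤k = size≤k μ∈ in
           ∈-partitions k k l p (All.map (λ a≤ → ℕ.≤-trans a≤ ≤k) (All-≤sum (value μ))) (ℕ.≤-trans (length≤sum p) ≤k) }) ⟩
      ∑ (λ xs → x ^ ℕ.sum xs) (partitions k k)        ≤⟨ S≤B ⟩
      B                                               ∎
      where
      open ≤-Reasoning
      S = ∑ (λ xs → x ^ ℕ.sum xs) (partitions k k)
      S≤B : S ≤ B
      S≤B = begin
        S                            ≈⟨ *-identityʳ S ⟨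
        S * 1#                       ≤⟨ *-monoˡ-≤ (∑-nonNeg (λ xs → ^-nonNeg 0≤x (ℕ.sum xs)) (partitions k k)) (1≤∏*B k) ⟩
        S * (∏< k factor * B)        ≈⟨ *-assoc _ _ _ ⟨
        S * ∏< k factor * B          ≤⟨ *-monoʳ-≤ (<⇒≤ (exp-pos (c * c))) (∑partitions k k) ⟩
        1# * B                       ≈⟨ *-identityˡ B ⟩
        B                            ∎

    Bool-BoundedBy : BoundedBy {Bool} (λ _ → 1#) 2#
    Bool-BoundedBy bs u = ∑-mono-⊆ (λ _ → 0≤1) {bs = false ∷ true ∷ []} u
      λ { {false} _ → here ≡.refl ; {true} _ → there (here ≡.refl) }

    -- Sign and absolute value embed ℤ into two copies of ℕ, each contributing a geometric series.
    integer-BoundedBy : BoundedBy (λ m → x ^ ℤ.∣ m ∣) (2# * c)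
    integer-BoundedBy = BoundedBy-mono (λ m → ≤-reflexive (sym (*-identityˡ _))) (BoundedBy-injection ι ι-injective
      {f = λ (_ , k) → 1# * x ^ k} (BoundedBy-× (λ _ → 0≤1) (^-nonNeg 0≤x) Bool-BoundedBy (geometric-BoundedBy 0≤x x<1)))
      where
      isNonNeg : ℤ → Bool
      isNonNeg (+ _)    = true
      isNonNeg -[1+ _ ] = false
      ι : ℤ → Bool × ℕ
      ι m = isNonNeg m , ℤ.∣ m ∣
      ι-injective : ∀ {i j} → ι i ≡ ι j → i ≡ j
      ι-injective {+ _}      {+ _}      ≡.refl = ≡.refl
      ι-injective { -[1+ _ ]} { -[1+ _ ]} ≡.refl = ≡.refl

  Triple : Set
  Triple = Partition × Partition × ℤ

  totalSize : Triple → ℕ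
  totalSize (μ , ν , m) = size μ ℕ.+ (size ν ℕ.+ ℤ.∣ m ∣)

  triple-BoundedBy : ∀ {x} → 0# ≤ x → x < 1# → ∃[ S ] BoundedBy (λ τ → x ^ totalSize τ) S
  triple-BoundedBy {x} 0≤x x<1 = _ , BoundedBy-mono
    (λ (μ , ν , m) → ≤-reflexive (trans (^-homo-* x (size μ) _) (*-congˡ (^-homo-* x (size ν) _))))
    (BoundedBy-× (λ μ → ^-nonNeg 0≤x (size μ)) (λ (ν , m) → *-nonNeg (^-nonNeg 0≤x (size ν)) (^-nonNeg 0≤x ℤ.∣ m ∣))
      (partition-BoundedBy 0≤x x<1)
      (BoundedBy-× (λ ν → ^-nonNeg 0≤x (size ν)) (λ m → ^-nonNeg 0≤x ℤ.∣ m ∣)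
        (partition-BoundedBy 0≤x x<1) (integer-BoundedBy 0≤x x<1)))

  -- Signatures of length N and pairs of partitions around a shift

  -- Padding by zeros makes a partition a decreasing sequence on all of ℕ, so that the entries of a
  -- signature have one formula for all rows.
  nth : List ℕ → ℕ → ℕ
  nth []       _       = 0
  nth (a ∷ xs) zero    = a
  nth (a ∷ xs) (suc i) = nth xs i

  nth-beyond : ∀ xs {i} → List.length xs ℕ.≤ i → nth xs i ≡ 0
  nth-beyond []       _             = ≡.refl
  nth-beyond (a ∷ xs) (s≤s len≤i)   = nth-beyond xs len≤i

  nth-step : ∀ {xs} → Linked ℕ._≥_ xs → ∀ i → nth xs (suc i) ℕ.≤ nth xs i
  nth-step []        _       = z≤n
  nth-step [-]       _       = z≤n
  nth-step (b≤a ∷ _) zero    = b≤a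
  nth-step (_ ∷ l)   (suc i) = nth-step l i

  -- Positivity of the parts lets the padded sequence reveal the length: it is where the zeros
  -- begin.
  nth-extensional : ∀ {xs ys} → All (0 ℕ.<_) xs → All (0 ℕ.<_) ys → (∀ i → nth xs i ≡ nth ys i) → xs ≡ ys
  nth-extensional []        []        _  = ≡.refl
  nth-extensional []        (0<b ∷ _) eq = contradiction (eq 0) (ℕ.<⇒≢ 0<b)
  nth-extensional (0<a ∷ _) []        eq = contradiction (≡.sym (eq 0)) (ℕ.<⇒≢ 0<a)
  nth-extensional (_ ∷ p)   (_ ∷ q)   eq = ≡.cong₂ _∷_ (eq 0) (nth-extensional p q (eq ∘ suc))

  -- The partition with parts f 0 ≥ f 1 ≥ … ≥ f (n - 1), zero parts dropped.
  fromParts : (ℕ → ℕ) → ℕ → List ℕ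
  fromParts f zero    = []
  fromParts f (suc n) with f 0
  ... | zero  = []
  ... | suc a = suc a ∷ fromParts (f ∘ suc) n

  -- Restricted to indices below n because the distances of the entries of a signature from its
  -- central entry decrease on one side of the centre only.
  AntitoneBelow : ℕ → (ℕ → ℕ) → Set
  AntitoneBelow n f = ∀ {i j} → i ℕ.≤ j → j ℕ.< n → f j ℕ.≤ f i

  shift : ∀ {f n} → AntitoneBelow (suc n) f → AntitoneBelow n (f ∘ suc)
  shift anti i≤j j<n = anti (s≤s i≤j) (s≤s j<n)

  fromParts-positive : ∀ f n → All (0 ℕ.<_) (fromParts f n)
  fromParts-positive f zero    = []
  fromParts-positive f (suc n) with f 0
  ... | zero  = []
  ... | suc a = s≤s z≤n ∷ fromParts-positive (f ∘ suc) n

  length-fromParts : ∀ f n → List.length (fromParts f n) ℕ.≤ n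
  length-fromParts f zero    = z≤n
  length-fromParts f (suc n) with f 0
  ... | zero  = z≤n
  ... | suc a = s≤s (length-fromParts (f ∘ suc) n)

  nth-fromParts : ∀ {f} n → AntitoneBelow n f → ∀ {i} → i ℕ.< n → nth (fromParts f n) i ≡ f i
  nth-fromParts {f} (suc n) anti {i} i<n with f 0 in f0≡
  ... | zero  = ≡.sym (ℕ.n≤0⇒n≡0 (≡.subst (f i ℕ.≤_) f0≡ (anti z≤n i<n)))
  nth-fromParts {f} (suc n) anti {zero}  i<n       | suc a = ≡.sym f0≡
  nth-fromParts {f} (suc n) anti {suc i} (s≤s i<n) | suc a = nth-fromParts n (shift anti) i<n

  fromParts-linked : ∀ {f} n → AntitoneBelow n f → Linked ℕ._≥_ (fromParts f n)
  fromParts-linked {f} zero    anti = []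
  fromParts-linked {f} (suc n) anti with f 0 in f0≡
  ... | zero  = []
  ... | suc a = cons n (λ i<n → ≡.subst (f _ ℕ.≤_) f0≡ (anti z≤n i<n)) (fromParts-linked n (shift anti))
    where
    cons : ∀ {g b} n → (∀ {i} → suc i ℕ.< suc n → g i ℕ.≤ b) → Linked ℕ._≥_ (fromParts g n) → Linked ℕ._≥_ (b ∷ fromParts g n)
    cons zero    _  _ = [-]
    cons {g} (suc n) g≤ l with g 0 in g0≡
    ... | zero  = [-]
    ... | suc c = ≡.subst (ℕ._≤ _) g0≡ (g≤ (s≤s (s≤s z≤n))) ∷ l

  toPartition : ∀ {f} n → AntitoneBelow n f → Partition
  toPartition {f} n anti = fromParts f n , [ fromParts-linked n anti , fromParts-positive f n ]

  -- Natural indices allow the reflection i ↦ N - 1 - i without bounds in the types; the default 0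
  -- is never read inside a vector.
  at : ∀ {n} → Vec ℤ n → ℕ → ℤ
  at []      _       = + 0
  at (a ∷ v) zero    = a
  at (a ∷ v) (suc i) = at v i

  at-tabulate : ∀ n (f : ℕ → ℤ) {i} → i ℕ.< n → at (Vec.tabulate {n = n} (f ∘ toℕ)) i ≡ f i
  at-tabulate (suc n) f {zero}  _         = ≡.refl
  at-tabulate (suc n) f {suc i} (s≤s i<n) = at-tabulate n (f ∘ suc) i<n

  at-extensional : ∀ {n} (v w : Vec ℤ n) → (∀ i → i ℕ.< n → at v i ≡ at w i) → v ≡ w
  at-extensional []      []      _  = ≡.refl
  at-extensional (a ∷ v) (b ∷ w) eq = ≡.cong₂ _∷_ (eq 0 (s≤s z≤n)) (at-extensional v w (λ i i<n → eq (suc i) (s≤s i<n)))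

  at-antitone : ∀ {n} {v : Vec ℤ n} → VecLinked.Linked ℤ._≥_ v → ∀ {i j} → i ℕ.≤ j → j ℕ.< n → at v j ℤ.≤ at v i
  at-antitone {v = a ∷ v}     _ {zero}  {zero}  _ _ = ℤ.≤-refl
  at-antitone {v = a ∷ b ∷ v} (b≤a VecLinked.∷ l) {zero} {suc j} _ (s≤s j<n) =
    ℤ.≤-trans (at-antitone l {0} {j} z≤n j<n) b≤a
  at-antitone {v = a ∷ v}     l {suc i} {suc j} (s≤s i≤j) (s≤s j<n) = at-antitone (VecLinked.tail l) i≤j j<n

  tabulate-linked : ∀ n (f : ℕ → ℤ) → (∀ i → f (suc i) ℤ.≤ f i) → VecLinked.Linked ℤ._≥_ (Vec.tabulate {n = n} (f ∘ toℕ))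
  tabulate-linked zero          f step = VecLinked.[]
  tabulate-linked (suc zero)    f step = VecLinked.[-]
  tabulate-linked (suc (suc n)) f step = step 0 VecLinked.∷ tabulate-linked (suc n) (f ∘ suc) (step ∘ suc)

  entry : ℕ → Triple → ℕ → ℤ
  entry N (μ , ν , m) i = m ℤ.+ (+ nth (value μ) i ℤ.- + nth (value ν) (N ∸ suc i))

  entry-step : ∀ N τ i → entry N τ (suc i) ℤ.≤ entry N τ i
  entry-step N (μ , ν , m) i = ℤ.+-monoʳ-≤ m (ℤ.+-mono-≤ (ℤ.+≤+ (nth-step (proj₁ (isPartition μ)) i))
    (ℤ.neg-mono-≤ (ℤ.+≤+ (case-∸ (ℕ.∸-monoʳ-≤ N (ℕ.n≤1+n (suc i)))))))
    where
    case-∸ : ∀ {i j} → i ℕ.≤ j → nth (value ν) j ℕ.≤ nth (value ν) i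
    case-∸ {i} i≤j = go (ℕ.≤⇒≤′ i≤j)
      where
      go : ∀ {j} → i ℕ.≤′ j → nth (value ν) j ℕ.≤ nth (value ν) i
      go ℕ.≤′-refl     = ℕ.≤-refl
      go (ℕ.≤′-step p) = ℕ.≤-trans (nth-step (proj₁ (isPartition ν)) _) (go p)

  signature : ∀ N → Triple → Signature N
  signature N τ = Vec.tabulate (entry N τ ∘ toℕ) , [ tabulate-linked N (entry N τ) (entry-step N τ) ]

  -- For triples that fit, the supports of μ and of the reversal of ν are disjoint
  -- and avoid the position a, at which the signature takes the value m.
  module Decomposition (N : ℕ) (a : ℕ) (a<N : a ℕ.< N) where

    Fits : Triple → Set
    Fits (μ , ν , m) = List.length (value μ) ℕ.≤ a × List.length (value ν) ℕ.≤ N ∸ suc a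

    i≤a⇒≤N∸ : ∀ {i} → i ℕ.≤ a → N ∸ suc a ℕ.≤ N ∸ suc i
    i≤a⇒≤N∸ i≤a = ℕ.∸-monoʳ-≤ N (s≤s i≤a)

    N∸suc-involutive : ∀ {i} → i ℕ.< N → N ∸ suc (N ∸ suc i) ≡ i
    N∸suc-involutive {i} i<N = ≡.trans (≡.cong (N ∸_) (≡.sym (ℕ.+-∸-assoc 1 i<N))) (ℕ.m∸[m∸n]≡n (ℕ.<⇒≤ i<N))

    a<N∸suc : ∀ {j} → j ℕ.< N ∸ suc a → a ℕ.< N ∸ suc j
    a<N∸suc {j} j< = ≡.subst (ℕ._≤ N ∸ suc j) (ℕ.m∸[m∸n]≡n a<N) (ℕ.∸-monoʳ-≤ N j<)

    N∸suc<N : ∀ {j} → j ℕ.< N ∸ suc a → N ∸ suc j ℕ.< N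
    N∸suc<N j< = ℕ.∸-monoʳ-< {o = 0} (s≤s z≤n) (ℕ.<-≤-trans j< (ℕ.m∸n≤m N (suc a)))

    entry-top : ((μ , ν , m) : Triple) → Fits (μ , ν , m) → ∀ {i} → i ℕ.≤ a → entry N (μ , ν , m) i ≡ m ℤ.+ + nth (value μ) i
    entry-top (μ , ν , m) (_ , lν) {i} i≤a = ≡.cong (λ z → m ℤ.+ z) (≡.trans
      (≡.cong (λ k → + nth (value μ) i ℤ.- + k) (nth-beyond (value ν) (ℕ.≤-trans lν (i≤a⇒≤N∸ i≤a)))) (ℤ.+-identityʳ _))

    entry-bottom : ((μ , ν , m) : Triple) → Fits (μ , ν , m) → ∀ {i} → a ℕ.≤ i → entry N (μ , ν , m) i ≡ m ℤ.- + nth (value ν) (N ∸ suc i)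
    entry-bottom (μ , ν , m) (lμ , _) {i} a≤i = ≡.cong (λ z → m ℤ.+ z) (≡.trans
      (≡.cong (λ k → + k ℤ.- + nth (value ν) (N ∸ suc i)) (nth-beyond (value μ) (ℕ.≤-trans lμ a≤i))) (ℤ.+-identityˡ _))

    entry-centre : ((μ , ν , m) : Triple) → Fits (μ , ν , m) → entry N (μ , ν , m) a ≡ m
    entry-centre τ@(μ , ν , m) f@(lμ , _) = ≡.trans (entry-top τ f ℕ.≤-refl)
      (≡.trans (≡.cong (λ k → m ℤ.+ + k) (nth-beyond (value μ) lμ)) (ℤ.+-identityʳ m))

    -- Row a gives m; the rows before it then give μ and the rows after it ν. At all further indices
    -- both padded sequences are 0 by `Fits`.
    signature-injective : ∀ {τ τ′} → Fits τ → Fits τ′ → signature N τ ≡ signature N τ′ → τ ≡ τ′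
    signature-injective {τ@(μ , ν , m)} {τ′@(μ′ , ν′ , m′)} f@(lμ , lν) f′@(lμ′ , lν′) eq = ≡.cong₂ _,_
      (value-injective (nth-extensional (proj₂ (isPartition μ)) (proj₂ (isPartition μ′)) μ≗μ′))
      (≡.cong₂ _,_ (value-injective (nth-extensional (proj₂ (isPartition ν)) (proj₂ (isPartition ν′)) ν≗ν′)) m≡m′)
      where
      entries : ∀ {i} → i ℕ.< N → entry N τ i ≡ entry N τ′ i
      entries i<N = ≡.trans (≡.sym (at-tabulate N (entry N τ) i<N))
        (≡.trans (≡.cong (λ s → at (value s) _) eq) (at-tabulate N (entry N τ′) i<N))
      m≡m′ : m ≡ m′
      m≡m′ = ≡.trans (≡.sym (entry-centre τ f)) (≡.trans (entries a<N) (entry-centre τ′ f′))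
      μ≗μ′ : ∀ i → nth (value μ) i ≡ nth (value μ′) i
      μ≗μ′ i with i ℕ.<? a
      ... | no i≮a  = ≡.trans (nth-beyond (value μ) (ℕ.≤-trans lμ (ℕ.≮⇒≥ i≮a)))
                              (≡.sym (nth-beyond (value μ′) (ℕ.≤-trans lμ′ (ℕ.≮⇒≥ i≮a))))
      ... | yes i<a = ℤ.+-injective (∙-cancelˡ m _ _ (≡.trans (≡.sym (entry-top τ f (ℕ.<⇒≤ i<a)))
        (≡.trans (entries (ℕ.<-trans i<a a<N)) (≡.trans (entry-top τ′ f′ (ℕ.<⇒≤ i<a)) (≡.cong (λ z → z ℤ.+ _) (≡.sym m≡m′))))))
      ν≗ν′ : ∀ j → nth (value ν) j ≡ nth (value ν′) j
      ν≗ν′ j with j ℕ.<? N ∸ suc a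
      ... | no j≮  = ≡.trans (nth-beyond (value ν) (ℕ.≤-trans lν (ℕ.≮⇒≥ j≮)))
                             (≡.sym (nth-beyond (value ν′) (ℕ.≤-trans lν′ (ℕ.≮⇒≥ j≮))))
      ... | yes j< = ≡.subst (λ k → nth (value ν) k ≡ nth (value ν′) k) (N∸suc-involutive j<N)
        (ℤ.+-injective (ℤ.neg-injective (∙-cancelˡ m _ _ (≡.trans (≡.sym (entry-bottom τ f a≤i))
          (≡.trans (entries i<N) (≡.trans (entry-bottom τ′ f′ a≤i) (≡.cong (λ z → z ℤ.- _) (≡.sym m≡m′))))))))
        where
        j<N : j ℕ.< N
        j<N = ℕ.<-≤-trans j< (ℕ.m∸n≤m N (suc a))
        i<N = N∸suc<N j<
        a≤i = ℕ.<⇒≤ (a<N∸suc j<)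

    signature-surjective : ∀ ƛ → ∃[ τ ] Fits τ × signature N τ ≡ ƛ
    signature-surjective (v , [ linked ]) = τ , fits , value-injective (at-extensional _ v λ i i<N →
        ≡.trans (at-tabulate N (entry N τ) i<N) (entries i i<N))
      where
      antitone : ∀ {i j} → i ℕ.≤ j → j ℕ.< N → at v j ℤ.≤ at v i
      antitone = at-antitone (recompute linked)
      m = at v a
      -- The absolute values only convert to ℕ: the differences are nonnegative wherever f and g are
      -- read, by monotonicity around row a.
      f g : ℕ → ℕ
      f i = ℤ.∣ at v i ℤ.- m ∣
      g j = ℤ.∣ m ℤ.- at v (N ∸ suc j) ∣
      +f≡ : ∀ {i} → i ℕ.≤ a → + f i ≡ at v i ℤ.- m
      +f≡ i≤a = ℤ.0≤i⇒+∣i∣≡i (ℤ.i≤j⇒0≤j-i (antitone i≤a a<N))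
      +g≡ : ∀ {j} → j ℕ.< N ∸ suc a → + g j ≡ m ℤ.- at v (N ∸ suc j)
      +g≡ {j} j< = ℤ.0≤i⇒+∣i∣≡i (ℤ.i≤j⇒0≤j-i (antitone (ℕ.<⇒≤ (a<N∸suc j<)) (N∸suc<N j<)))
      f-antitone : AntitoneBelow a f
      f-antitone i≤j j<a = ℤ.drop‿+≤+ (≡.subst₂ ℤ._≤_ (≡.sym (+f≡ (ℕ.<⇒≤ j<a))) (≡.sym (+f≡ (ℕ.≤-trans i≤j (ℕ.<⇒≤ j<a))))
        (ℤ.+-monoˡ-≤ (ℤ.- m) (antitone i≤j (ℕ.<-trans j<a a<N))))
      g-antitone : AntitoneBelow (N ∸ suc a) g
      g-antitone {i} {j} i≤j j< = ℤ.drop‿+≤+ (≡.subst₂ ℤ._≤_ (≡.sym (+g≡ j<)) (≡.sym (+g≡ (ℕ.≤-<-trans i≤j j<)))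
        (ℤ.+-monoʳ-≤ m (ℤ.neg-mono-≤ (antitone (ℕ.∸-monoʳ-≤ N (s≤s i≤j)) (N∸suc<N (ℕ.≤-<-trans i≤j j<))))))
      τ : Triple
      τ = toPartition a f-antitone , toPartition (N ∸ suc a) g-antitone , m
      fits : Fits τ
      fits = length-fromParts f a , length-fromParts g (N ∸ suc a)
      m+[x-m]≡x : ∀ x → m ℤ.+ (x ℤ.- m) ≡ x
      m+[x-m]≡x x = ≡.trans (ℤ.+-comm m _) (≡.trans (ℤ.+-assoc x (ℤ.- m) m)
        (≡.trans (≡.cong (λ z → x ℤ.+ z) (ℤ.+-inverseˡ m)) (ℤ.+-identityʳ x)))
      m-[m-x]≡x : ∀ x → m ℤ.- (m ℤ.- x) ≡ x
      m-[m-x]≡x x = ≡.trans (≡.cong (λ z → m ℤ.+ z) (≡.trans (ℤ.neg-distrib-+ m (ℤ.- x))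
        (≡.trans (ℤ.+-comm (ℤ.- m) _) (≡.cong (λ z → z ℤ.+ ℤ.- m) (ℤ.neg-involutive x))))) (m+[x-m]≡x x)
      entries : ∀ i → i ℕ.< N → entry N τ i ≡ at v i
      entries i i<N with ℕ.<-cmp i a
      ... | tri< i<a _ _ = ≡.trans (entry-top τ fits (ℕ.<⇒≤ i<a)) (≡.trans
        (≡.cong (λ k → m ℤ.+ + k) (nth-fromParts a f-antitone i<a))
        (≡.trans (≡.cong (λ z → m ℤ.+ z) (+f≡ (ℕ.<⇒≤ i<a))) (m+[x-m]≡x (at v i))))
      ... | tri≈ _ ≡.refl _ = entry-centre τ fits
      ... | tri> _ _ a<i = ≡.trans (entry-bottom τ fits (ℕ.<⇒≤ a<i)) (≡.trans
        (≡.cong (λ k → m ℤ.- + k) (nth-fromParts (N ∸ suc a) g-antitone N∸i<))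
        (≡.trans (≡.cong (λ z → m ℤ.- z) (+g≡ N∸i<)) (≡.trans (m-[m-x]≡x _) (≡.cong (at v) (N∸suc-involutive i<N)))))
        where
        N∸i< : N ∸ suc i ℕ.< N ∸ suc a
        N∸i< = ℕ.∸-monoʳ-< (s≤s a<i) i<N

  -- The eigenvalues in terms of partitions

  ∑<-reverse : ∀ n (f : ℕ → ℝ) → ∑< n (λ i → f (n ∸ suc i)) ≈ ∑< n f
  ∑<-reverse zero    f = refl
  ∑<-reverse (suc n) f = trans (+-congˡ (∑<-reverse n f)) (trans (+-comm _ _) (sym (∑<-suc n f)))

  -- `g` receives the row index and the part. Recursion on the list replaces sums over `Fin` of its
  -- length, and the shift `g ∘ suc` carries the row index.
  listSum : (ℕ → ℕ → ℝ) → List ℕ → ℝ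
  listSum g []       = 0#
  listSum g (k ∷ ks) = g 0 k + listSum (g ∘ suc) ks

  listSum≡sum : ∀ g ks → listSum g ks ≡ sum (λ i → g (toℕ i) (List.lookup ks i))
  listSum≡sum g []       = ≡.refl
  listSum≡sum g (k ∷ ks) = ≡.cong (λ s → g 0 k + s) (listSum≡sum (g ∘ suc) ks)

  listSum-cong : ∀ {g h} → (∀ i k → g i k ≈ h i k) → ∀ ks → listSum g ks ≈ listSum h ks
  listSum-cong g≈h []       = refl
  listSum-cong g≈h (k ∷ ks) = +-cong (g≈h 0 k) (listSum-cong (g≈h ∘ suc) ks)

  listSum-+ : ∀ g h ks → listSum (λ i k → g i k + h i k) ks ≈ listSum g ks + listSum h ks
  listSum-+ g h []       = sym (+-identityˡ 0#)
  listSum-+ g h (k ∷ ks) = trans (+-congˡ (listSum-+ (g ∘ suc) (h ∘ suc) ks))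
    (solve 4 (λ x y u v → x :+ y :+ (u :+ v) := x :+ u :+ (y :+ v)) refl _ _ _ _)

  listSum-* : ∀ c g ks → listSum (λ i k → c * g i k) ks ≈ c * listSum g ks
  listSum-* c g []       = sym (zeroʳ c)
  listSum-* c g (k ∷ ks) = trans (+-congˡ (listSum-* c (g ∘ suc) ks)) (sym (distribˡ c _ _))

  listSum-nonNeg : ∀ {g} → (∀ i k → 0# ≤ g i k) → ∀ ks → 0# ≤ listSum g ks
  listSum-nonNeg 0≤g []       = ≤-refl
  listSum-nonNeg 0≤g (k ∷ ks) = +-nonNeg (0≤g 0 k) (listSum-nonNeg (0≤g ∘ suc) ks)

  listSum-const : ∀ c ks → listSum (λ _ _ → c) ks ≈ fromℕ (List.length ks) * c
  listSum-const c []       = sym (zeroˡ c)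
  listSum-const c (k ∷ ks) = trans (+-congˡ (listSum-const c ks))
    (solve 2 (λ n c → c :+ n :* c := (:1 :+ n) :* c) refl (fromℕ (List.length ks)) c)

  fromℕ-sum : ∀ ks → fromℕ (ℕ.sum ks) ≈ listSum (λ _ k → fromℕ k) ks
  fromℕ-sum []       = refl
  fromℕ-sum (k ∷ ks) = trans (fromℕ-+ k _) (+-congˡ (fromℕ-sum ks))

  listSum-bound : ∀ {g K b} ks → All (ℕ._≤ b) ks →
    (∀ i k → i ℕ.< List.length ks → k ℕ.≤ b → ∣ g i k ∣ ≤ fromℕ k * K) → ∣ listSum g ks ∣ ≤ fromℕ (ℕ.sum ks) * K
  listSum-bound {K = K} []       _         h = ≤-reflexive (trans (0≤x⇒∣x∣≈x ≤-refl) (sym (zeroˡ K)))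
  listSum-bound {K = K} (k ∷ ks) (k≤ ∷ ≤b) h = ≤-trans (∣x+y∣≤∣x∣+∣y∣ _ _) (≤-trans
    (+-mono-≤ (h 0 k (s≤s z≤n) k≤) (listSum-bound ks ≤b (λ i k i< → h (suc i) k (s≤s i<))))
    (≤-reflexive (trans (sym (distribʳ K _ _)) (*-congʳ (sym (fromℕ-+ k _))))))

  ∑<-nth : ∀ {g} → (∀ i → g i 0 ≈ 0#) → ∀ ks n → List.length ks ℕ.≤ n → ∑< n (λ i → g i (nth ks i)) ≈ listSum g ks
  ∑<-nth {g} g0≈0 []       zero    _         = refl
  ∑<-nth {g} g0≈0 []       (suc n) _         = trans (+-cong (g0≈0 0) (∑<-nth {g ∘ suc} (g0≈0 ∘ suc) [] n z≤n)) (+-identityˡ 0#)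
  ∑<-nth {g} g0≈0 (k ∷ ks) (suc n) (s≤s len) = +-congˡ (∑<-nth {g ∘ suc} (g0≈0 ∘ suc) ks n len)

  row : ℝ → ℕ → ℕ → ℝ
  row α i k = ∑< k (λ j → α * fromℕ j - fromℕ i)

  content≈ : ∀ α μ → content α μ ≈ listSum (row α) (value μ)
  content≈ α μ = reflexive (≡.sym (listSum≡sum (row α) (value μ)))

  -- Doubled so that the sum k(k-1)/2 of the column indices needs no division.
  2*row : ∀ α i k → 2# * row α i k ≈ α * fromℕ k ^ 2 - α * fromℕ k - 2# * fromℕ i * fromℕ k
  2*row α i zero    = solve 2 (λ α i → :2 :* :0 := α :* :0 :^ 2 :- α :* :0 :- :2 :* i :* :0) refl α (fromℕ i)
  2*row α i (suc k) = begin
    2# * row α i (suc k)                                ≈⟨ trans (*-congˡ (∑<-suc k (λ j → α * fromℕ j - fromℕ i))) (distribˡ _ _ _) ⟩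
    2# * row α i k + 2# * (α * fromℕ k - fromℕ i)       ≈⟨ +-congʳ (2*row α i k) ⟩
    α * fromℕ k ^ 2 - α * fromℕ k - 2# * fromℕ i * fromℕ k + 2# * (α * fromℕ k - fromℕ i)
      ≈⟨ solve 3 (λ α i k → α :* k :^ 2 :- α :* k :- :2 :* i :* k :+ :2 :* (α :* k :- i)
                     := α :* (:1 :+ k) :^ 2 :- α :* (:1 :+ k) :- :2 :* i :* (:1 :+ k)) refl α (fromℕ i) (fromℕ k) ⟩
    α * fromℕ (suc k) ^ 2 - α * fromℕ (suc k) - 2# * fromℕ i * fromℕ (suc k) ∎
    where open ≈-Reasoning

  squares : List ℕ → ℝ
  squares = listSum (λ _ k → fromℕ k ^ 2)

  coefficient : ℕ → ℕ → ℝ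
  coefficient N i = fromℕ N - 1# - 2# * fromℕ i

  moment : ℕ → List ℕ → ℝ
  moment N = listSum (λ i k → coefficient N i * fromℕ k)

  scale : ℕ → ℝ → ℝ
  scale N α = fromℕ N + α - 1#

  -- Row by row, αk² + (N - 1 - 2i)k = (αk² - αk - 2ik) + (N + α - 1)k. The bracket is twice the
  -- content of the row; the rest is why N + α - 1 is the natural scale.
  α*squares+moment : ∀ N α ks → α * squares ks + moment N ks ≈ 2# * listSum (row α) ks + scale N α * fromℕ (ℕ.sum ks)
  α*squares+moment N α ks = begin
    α * squares ks + moment N ks
      ≈⟨ trans (+-congʳ (sym (listSum-* α _ ks))) (sym (listSum-+ _ _ ks)) ⟩
    listSum (λ i k → α * fromℕ k ^ 2 + coefficient N i * fromℕ k) ks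
      ≈⟨ listSum-cong (λ i k → trans (solve 4 (λ α k n i → α :* k :^ 2 :+ (n :- :1 :- :2 :* i) :* k
             := α :* k :^ 2 :- α :* k :- :2 :* i :* k :+ (n :+ α :- :1) :* k) refl α (fromℕ k) (fromℕ N) (fromℕ i))
           (+-congʳ (sym (2*row α i k)))) ks ⟩
    listSum (λ i k → 2# * row α i k + scale N α * fromℕ k) ks
      ≈⟨ trans (listSum-+ _ _ ks) (+-cong (listSum-* 2# (row α) ks) (listSum-* (scale N α) _ ks)) ⟩
    2# * listSum (row α) ks + scale N α * listSum (λ _ k → fromℕ k) ks
      ≈⟨ +-congˡ (*-congˡ (fromℕ-sum ks)) ⟨
    2# * listSum (row α) ks + scale N α * fromℕ (ℕ.sum ks)
      ∎
    where open ≈-Reasoning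

  fromℕ-∸ : ∀ {m n} → m ℕ.≤ n → fromℕ (n ∸ m) ≈ fromℕ n - fromℕ m
  fromℕ-∸ {m} {n} m≤n = begin
    fromℕ (n ∸ m)                          ≈⟨ solve 2 (λ x y → x := x :+ y :- y) refl _ (fromℕ m) ⟩
    fromℕ (n ∸ m) + fromℕ m - fromℕ m      ≈⟨ +-congʳ (fromℕ-+ (n ∸ m) m) ⟨
    fromℕ (n ∸ m ℕ.+ m) - fromℕ m          ≡⟨ ≡.cong (λ k → fromℕ k - fromℕ m) (ℕ.m∸n+n≡m m≤n) ⟩
    fromℕ n - fromℕ m                      ∎
    where open ≈-Reasoning

  coefficient-reverse : ∀ N {i} → i ℕ.< N → coefficient N (N ∸ suc i) ≈ - coefficient N i
  coefficient-reverse N {i} i<N = trans (+-congˡ (-‿cong (*-congˡ (fromℕ-∸ i<N))))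
    (solve 2 (λ n i → n :- :1 :- :2 :* (n :- (:1 :+ i)) := :- (n :- :1 :- :2 :* i)) refl (fromℕ N) (fromℕ i))

  -- Reversing the rows negates the coefficients, so the sum equals its own negative. Consequently
  -- the linear part of κ does not see the shift m.
  ∑coefficient : ∀ N → ∑< N (coefficient N) ≈ 0#
  ∑coefficient N = *-cancelʳ 0<2 (begin
    X * 2#             ≈⟨ solve 1 (λ x → x :* :2 := x :+ x) refl X ⟩
    X + X              ≈⟨ +-congʳ X≈-X ⟩
    - X + X            ≈⟨ solve 1 (λ x → :- x :+ x := :0 :* :2) refl X ⟩
    0# * 2#            ∎)
    where
    open ≈-Reasoning
    X = ∑< N (coefficient N)
    X≈-X : X ≈ - X
    X≈-X = begin
      X                                              ≈⟨ ∑<-reverse N (coefficient N) ⟨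
      ∑< N (λ i → coefficient N (N ∸ suc i))         ≈⟨ ∑<-cong N (λ i i<N → trans (coefficient-reverse N i<N)
                                                          (solve 1 (λ c → :- c := :- :1 :* c) refl (coefficient N i))) ⟩
      ∑< N (λ i → - 1# * coefficient N i)            ≈⟨ ∑<-* N (- 1#) (coefficient N) ⟩
      - 1# * X                                       ≈⟨ solve 1 (λ x → :- :1 :* x := :- x) refl X ⟩
      - X                                            ∎

  module Eigenvalue (N a : ℕ) (a<N : a ℕ.< N) (α : ℝ) where

    open Decomposition N a a<N

    numerator : Signature N → ℝ
    numerator ƛ = α * sum (λ k → fromℤ (Vec.lookup (value ƛ) k) ^ 2)
                + sum (λ k → (fromℕ N - 1# - 2# * fromℕ (toℕ k)) * fromℤ (Vec.lookup (value ƛ) k))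

    ∑α*squares+moment : ∀ ks → List.length ks ℕ.≤ N →
      ∑< N (λ i → α * fromℕ (nth ks i) ^ 2 + coefficient N i * fromℕ (nth ks i)) ≈ α * squares ks + moment N ks
    ∑α*squares+moment ks len≤N = trans
      (∑<-nth {λ i k → α * fromℕ k ^ 2 + coefficient N i * fromℕ k}
        (λ i → solve 2 (λ α c → α :* :0 :^ 2 :+ c :* :0 := :0) refl α (coefficient N i)) ks N len≤N)
      (trans (listSum-+ _ _ ks) (+-congʳ (listSum-* α _ ks)))

    ∑nth : ∀ ks → List.length ks ℕ.≤ N → ∑< N (λ i → fromℕ (nth ks i)) ≈ fromℕ (ℕ.sum ks)
    ∑nth ks len≤N = trans (∑<-nth {λ _ k → fromℕ k} (λ _ → refl) ks N len≤N) (sym (fromℕ-sum ks))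

    module _ (μ ν : Partition) (m : ℤ) (fits : Fits (μ , ν , m)) where

      private
        M u v : ℝ
        M = fromℤ m
        u = fromℕ (size μ)
        v = fromℕ (size ν)

        U V : ℕ → ℝ
        U i = fromℕ (nth (value μ) i)
        V i = fromℕ (nth (value ν) i)

        -- No row meets both supports, so the square of an entry has no cross term between μ and ν.
        UV≈0 : ∀ i → U i * V (N ∸ suc i) ≈ 0#
        UV≈0 i with ℕ.≤-total a i
        ... | inj₁ a≤i = trans (*-congʳ (reflexive (≡.cong fromℕ (nth-beyond (value μ) (ℕ.≤-trans (proj₁ fits) a≤i))))) (zeroˡ _)
        ... | inj₂ i≤a = trans (*-congˡ (reflexive (≡.cong fromℕ (nth-beyond (value ν) (ℕ.≤-trans (proj₂ fits) (i≤a⇒≤N∸ i≤a)))))) (zeroʳ _)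

        part : ℕ → ℝ
        part i = fromℤ (entry N (μ , ν , m) i)

        part≈ : ∀ i → part i ≈ M + (U i - V (N ∸ suc i))
        part≈ i = trans (fromℤ-+ m _) (+-congˡ (trans (fromℤ-+ (+ nth (value μ) i) (ℤ.- + nth (value ν) (N ∸ suc i)))
                    (+-congˡ (fromℤ-neg (+ nth (value ν) (N ∸ suc i))))))

        g h : List ℕ → ℕ → ℝ
        g ks i = α * fromℕ (nth ks i) ^ 2 + coefficient N i * fromℕ (nth ks i)
        h ks i = fromℕ (nth ks i)

        -- Grouped as shift alone, each partition alone, and shift against partitions. The sign of
        -- the linear term of ν is absorbed by reading its coefficient in the reflected row, so ν is
        -- treated exactly as μ.
        summand : ∀ i → i ℕ.< N → α * part i ^ 2 + coefficient N i * part i ≈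
          (α * M ^ 2 + M * coefficient N i) + ((g (value μ) i + g (value ν) (N ∸ suc i))
            + (2# * α * M * h (value μ) i + - (2# * α * M) * h (value ν) (N ∸ suc i)))
        summand i i<N = begin
          α * part i ^ 2 + coefficient N i * part i
            ≈⟨ +-cong (*-congˡ (^-congˡ 2 (part≈ i))) (*-congˡ (part≈ i)) ⟩
          α * (M + (U i - V i′)) ^ 2 + coefficient N i * (M + (U i - V i′))
            ≈⟨ solve 5 (λ α M c u v → α :* (M :+ (u :- v)) :^ 2 :+ c :* (M :+ (u :- v))
                  := (α :* M :^ 2 :+ M :* c) :+ (((α :* u :^ 2 :+ c :* u) :+ (α :* v :^ 2 :+ :- c :* v))
                       :+ (:2 :* α :* M :* u :+ :- (:2 :* α :* M) :* v)) :- :2 :* α :* (u :* v)) refl α M (coefficient N i) (U i) (V i′) ⟩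
          _ - 2# * α * (U i * V i′)
            ≈⟨ +-cong (+-congˡ (+-congʳ (+-congˡ (+-congˡ (*-congʳ (sym (coefficient-reverse N i<N)))))))
                 (-‿cong (*-congˡ (UV≈0 i))) ⟩
          _ - 2# * α * 0#
            ≈⟨ solve 2 (λ x y → x :- y :* :0 := x) refl _ _ ⟩
          _
            ∎
          where
          open ≈-Reasoning
          i′ = N ∸ suc i

        length-μ : List.length (value μ) ℕ.≤ N
        length-μ = ℕ.≤-trans (proj₁ fits) (ℕ.<⇒≤ a<N)

        length-ν : List.length (value ν) ℕ.≤ N
        length-ν = ℕ.≤-trans (proj₂ fits) (ℕ.m∸n≤m N (suc a))

        f₁ f₂ f₃ f₄ f₅ f₆ : ℕ → ℝ
        f₁ i = α * M ^ 2
        f₂ i = M * coefficient N i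
        f₃ i = g (value μ) i
        f₄ i = g (value ν) (N ∸ suc i)
        f₅ i = 2# * α * M * h (value μ) i
        f₆ i = - (2# * α * M) * h (value ν) (N ∸ suc i)

        ∑<-split₆ : ∑< N (λ i → (f₁ i + f₂ i) + ((f₃ i + f₄ i) + (f₅ i + f₆ i))) ≈
          (∑< N f₁ + ∑< N f₂) + ((∑< N f₃ + ∑< N f₄) + (∑< N f₅ + ∑< N f₆))
        ∑<-split₆ = trans (∑<-+ N (λ i → f₁ i + f₂ i) (λ i → (f₃ i + f₄ i) + (f₅ i + f₆ i))) (+-cong (∑<-+ N f₁ f₂)
          (trans (∑<-+ N (λ i → f₃ i + f₄ i) (λ i → f₅ i + f₆ i)) (+-cong (∑<-+ N f₃ f₄) (∑<-+ N f₅ f₆))))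

      numerator≈ : numerator (signature N (μ , ν , m)) ≈
        fromℕ N * (α * M ^ 2) + ((α * squares (value μ) + moment N (value μ) + (α * squares (value ν) + moment N (value ν)))
          + (2# * α * M * u + - (2# * α * M) * v))
      numerator≈ = begin
        numerator (signature N (μ , ν , m))
          ≈⟨ +-cong (*-congˡ (sum-cong-≋ {N} {λ k → entry′ k ^ 2} {λ k → part (toℕ k) ^ 2} (λ k → ^-congˡ 2 (lookup≈ k))))
               (sum-cong-≋ {N} {λ k → coefficient N (toℕ k) * entry′ k} {λ k → coefficient N (toℕ k) * part (toℕ k)}
                 (λ k → *-congˡ (lookup≈ k))) ⟩
        α * ∑< N (λ i → part i ^ 2) + ∑< N (λ i → coefficient N i * part i)
          ≈⟨ trans (+-congʳ (sym (∑<-* N α (λ i → part i ^ 2)))) (sym (∑<-+ N (λ i → α * part i ^ 2) (λ i → coefficient N i * part i))) ⟩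
        ∑< N (λ i → α * part i ^ 2 + coefficient N i * part i)
          ≈⟨ ∑<-cong N {g = λ i → (f₁ i + f₂ i) + ((f₃ i + f₄ i) + (f₅ i + f₆ i))} summand ⟩
        ∑< N (λ i → (f₁ i + f₂ i) + ((f₃ i + f₄ i) + (f₅ i + f₆ i)))
          ≈⟨ ∑<-split₆ ⟩
        (∑< N f₁ + ∑< N f₂) + ((∑< N f₃ + ∑< N f₄) + (∑< N f₅ + ∑< N f₆))
          ≈⟨ +-cong
               (trans (+-cong (∑<-const N _) (trans (∑<-* N M (coefficient N)) (trans (*-congˡ (∑coefficient N)) (zeroʳ M)))) (+-identityʳ _))
               (+-cong
                 (+-cong (∑α*squares+moment (value μ) length-μ)
                   (trans (∑<-reverse N (g (value ν))) (∑α*squares+moment (value ν) length-ν)))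
                 (+-cong (trans (∑<-* N _ (h (value μ))) (*-congˡ (∑nth (value μ) length-μ)))
                   (trans (∑<-* N _ (λ i → h (value ν) (N ∸ suc i))) (*-congˡ (trans (∑<-reverse N (h (value ν))) (∑nth (value ν) length-ν)))))) ⟩
        _
          ∎
        where
        open ≈-Reasoning
        entry′ : Fin N → ℝ
        entry′ k = fromℤ (Vec.lookup (Vec.tabulate (entry N (μ , ν , m) ∘ toℕ)) k)
        lookup≈ : ∀ k → entry′ k ≈ part (toℕ k)
        lookup≈ k = reflexive (≡.cong fromℤ (Vec.lookup∘tabulate (entry N (μ , ν , m) ∘ toℕ) k))

      -- The shift contributes N α m² = (N + α - 1) α m² - α(α - 1) m², which is the origin of the
      -- last term of F; its mixed terms 2αm(|μ| - |ν|) give the third.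
      numerator-F : numerator (signature N (μ , ν , m)) ≈ scale N α * (u + v + α * M ^ 2) + 2# * F α μ ν m
      numerator-F = begin
        numerator (signature N (μ , ν , m))
          ≈⟨ numerator≈ ⟩
        fromℕ N * (α * M ^ 2) + ((α * squares (value μ) + moment N (value μ) + (α * squares (value ν) + moment N (value ν)))
          + (2# * α * M * u + - (2# * α * M) * v))
          ≈⟨ +-congˡ (+-congʳ (+-cong (α*squares+moment′ μ) (α*squares+moment′ ν))) ⟩
        fromℕ N * (α * M ^ 2) + ((2# * content α μ + scale N α * u + (2# * content α ν + scale N α * v))
          + (2# * α * M * u + - (2# * α * M) * v))
          ≈⟨ solve 7 (λ n α M x y u v →
               n :* (α :* M :^ 2) :+ ((:2 :* x :+ (n :+ α :- :1) :* u :+ (:2 :* y :+ (n :+ α :- :1) :* v))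
                 :+ (:2 :* α :* M :* u :+ :- (:2 :* α :* M) :* v))
               := (n :+ α :- :1) :* (u :+ v :+ α :* M :^ 2)
                 :+ :2 :* (x :+ y :+ α :* M :* (u :- v)) :- α :* (α :- :1) :* M :^ 2)
               refl (fromℕ N) α M (content α μ) (content α ν) u v ⟩
        scale N α * (u + v + α * M ^ 2) + 2# * (content α μ + content α ν + α * M * (u - v)) - α * (α - 1#) * M ^ 2
          ≈⟨ +-congˡ (-‿cong (trans (*-congʳ (sym (*-/-cancel (α * (α - 1#)) 0<2)))
               (solve 3 (λ z t M → z :* t :* M := t :* (z :* M)) refl _ 2# (M ^ 2)))) ⟩
        scale N α * (u + v + α * M ^ 2) + 2# * (content α μ + content α ν + α * M * (u - v)) - 2# * (α * (α - 1#) / 2# * M ^ 2)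
          ≈⟨ solve 3 (λ k f z → k :+ :2 :* f :- :2 :* z := k :+ :2 :* (f :- z)) refl _ _ _ ⟩
        scale N α * (u + v + α * M ^ 2) + 2# * F α μ ν m
          ∎
        where
        open ≈-Reasoning
        α*squares+moment′ : ∀ μ → α * squares (value μ) + moment N (value μ) ≈ 2# * content α μ + scale N α * fromℕ (size μ)
        α*squares+moment′ μ = trans (α*squares+moment N α (value μ)) (+-congʳ (*-congˡ (sym (content≈ α μ))))

  -- Quadratic bound for F

  ∣row∣≤ : ∀ {α} → 0# ≤ α → ∀ {b} i k → i ℕ.≤ b → k ℕ.≤ b → ∣ row α i k ∣ ≤ fromℕ k * ((α + 1#) * fromℕ b)
  ∣row∣≤ {α} 0≤α {b} i k i≤b k≤b = ≤-trans (∣∑<∣≤ k term≤) (≤-reflexive (∑<-const k _))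
    where
    open ≤-Reasoning
    term≤ : ∀ j → j ℕ.< k → ∣ α * fromℕ j - fromℕ i ∣ ≤ (α + 1#) * fromℕ b
    term≤ j j<k = begin
      ∣ α * fromℕ j - fromℕ i ∣           ≤⟨ ∣x+y∣≤∣x∣+∣y∣ _ _ ⟩
      ∣ α * fromℕ j ∣ + ∣ - fromℕ i ∣     ≈⟨ +-cong (0≤x⇒∣x∣≈x (*-nonNeg 0≤α (fromℕ-nonNeg j)))
                                               (trans (∣-x∣≈∣x∣ _) (0≤x⇒∣x∣≈x (fromℕ-nonNeg i))) ⟩
      α * fromℕ j + fromℕ i               ≤⟨ +-mono-≤ (*-monoˡ-≤ 0≤α (fromℕ-mono (ℕ.≤-trans (ℕ.<⇒≤ j<k) k≤b))) (fromℕ-mono i≤b) ⟩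
      α * fromℕ b + fromℕ b               ≈⟨ solve 2 (λ α b → α :* b :+ b := (α :+ :1) :* b) refl α (fromℕ b) ⟩
      (α + 1#) * fromℕ b                  ∎

  ∣content∣≤ : ∀ {α} → 0# ≤ α → ∀ μ → ∣ content α μ ∣ ≤ fromℕ (size μ) * ((α + 1#) * fromℕ (size μ))
  ∣content∣≤ {α} 0≤α μ = ≤-trans (≤-reflexive (∣∣-cong (content≈ α μ)))
    (listSum-bound (value μ) (All-≤sum (value μ)) λ i k i<length k≤size →
      ∣row∣≤ 0≤α i k (ℕ.≤-trans (ℕ.<⇒≤ i<length) (length≤sum (proj₂ (isPartition μ)))) k≤size)

  ∣fromℤ∣ : ∀ m → ∣ fromℤ m ∣ ≈ fromℕ ℤ.∣ m ∣
  ∣fromℤ∣ (+ n)    = 0≤x⇒∣x∣≈x (fromℕ-nonNeg n)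
  ∣fromℤ∣ -[1+ n ] = trans (∣-x∣≈∣x∣ _) (0≤x⇒∣x∣≈x (fromℕ-nonNeg (suc n)))

  fromℤ^2 : ∀ m → fromℤ m ^ 2 ≈ fromℕ ℤ.∣ m ∣ ^ 2
  fromℤ^2 (+ n)    = refl
  fromℤ^2 -[1+ n ] = solve 1 (λ x → (:- x) :^ 2 := x :^ 2) refl (fromℕ (suc n))

  fromℕ-totalSize : ∀ μ ν m → fromℕ (totalSize (μ , ν , m)) ≈ fromℕ (size μ) + (fromℕ (size ν) + fromℕ ℤ.∣ m ∣)
  fromℕ-totalSize μ ν m = trans (fromℕ-+ (size μ) _) (+-congˡ (fromℕ-+ (size ν) _))

  -- A partition of size u has u boxes with contents at most (α + 1)u in absolute value, and the
  -- shift terms are quadratic as well. The constant is generous: only its dependence on R alone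
  -- matters.
  ∣F∣≤ : ∀ {α R} → 0# ≤ α → α ≤ R → ∀ μ ν m → ∣ F α μ ν m ∣ ≤ (R + 1#) ^ 2 * fromℕ (totalSize (μ , ν , m)) ^ 2
  ∣F∣≤ {α} {R} 0≤α α≤R μ ν m = begin
    ∣ content α μ + content α ν + α * M * (u - v) - α * (α - 1#) / 2# * M ^ 2 ∣
      ≤⟨ ≤-trans (∣x+y∣≤∣x∣+∣y∣ _ _) (+-mono-≤ (≤-trans (∣x+y∣≤∣x∣+∣y∣ _ _) (+-mono-≤ (∣x+y∣≤∣x∣+∣y∣ _ _) ≤-refl))
           (≤-reflexive (∣-x∣≈∣x∣ _))) ⟩
    ∣ content α μ ∣ + ∣ content α ν ∣ + ∣ α * M * (u - v) ∣ + ∣ α * (α - 1#) / 2# * M ^ 2 ∣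
      ≤⟨ +-mono-≤ (+-mono-≤ (+-mono-≤ (∣content∣≤ 0≤α μ) (∣content∣≤ 0≤α ν)) cross) quadratic ⟩
    u * ((α + 1#) * u) + v * ((α + 1#) * v) + α * w * (u + v) + α * (α + 1#) * w ^ 2
      ≤⟨ ≤-by
           (+-nonNeg (+-nonNeg (+-nonNeg
             (*-nonNeg (*-nonNeg 0≤α 0≤α+1) (+-nonNeg (^-nonNeg 0≤u 2) (^-nonNeg 0≤v 2)))
             (*-nonNeg 0≤α+1 (^-nonNeg 0≤w 2)))
             (*-nonNeg (*-nonNeg 0≤2 (^-nonNeg 0≤α+1 2)) (*-nonNeg 0≤u 0≤v)))
             (*-nonNeg (+-nonNeg (+-nonNeg (*-nonNeg 0≤2 (^-nonNeg 0≤α 2)) (*-nonNeg (fromℕ-nonNeg 3) 0≤α)) 0≤2)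
               (*-nonNeg 0≤w (+-nonNeg 0≤u 0≤v))))
           (solve 4 (λ α u v w → (α :+ :1) :^ 2 :* (u :+ (v :+ w)) :^ 2
                :- (u :* ((α :+ :1) :* u) :+ v :* ((α :+ :1) :* v) :+ α :* w :* (u :+ v) :+ α :* (α :+ :1) :* w :^ 2)
              := α :* (α :+ :1) :* (u :^ 2 :+ v :^ 2) :+ (α :+ :1) :* w :^ 2 :+ :2 :* (α :+ :1) :^ 2 :* (u :* v)
                :+ (:2 :* α :^ 2 :+ con (+ 3) :* α :+ :2) :* (w :* (u :+ v))) refl α u v w) ⟩
    (α + 1#) ^ 2 * (u + (v + w)) ^ 2
      ≤⟨ *-monoʳ-≤ (^-nonNeg (+-nonNeg 0≤u (+-nonNeg 0≤v 0≤w)) 2) (^-monoˡ-≤ 0≤α+1 (+-mono-≤ α≤R ≤-refl) 2) ⟩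
    (R + 1#) ^ 2 * (u + (v + w)) ^ 2
      ≈⟨ *-congˡ (^-congˡ 2 (fromℕ-totalSize μ ν m)) ⟨
    (R + 1#) ^ 2 * fromℕ (totalSize (μ , ν , m)) ^ 2
      ∎
    where
    open ≤-Reasoning
    M = fromℤ m
    u = fromℕ (size μ)
    v = fromℕ (size ν)
    w = fromℕ ℤ.∣ m ∣
    0≤u = fromℕ-nonNeg (size μ)
    0≤v = fromℕ-nonNeg (size ν)
    0≤w = fromℕ-nonNeg ℤ.∣ m ∣
    0≤α+1 : 0# ≤ α + 1#
    0≤α+1 = +-nonNeg 0≤α 0≤1
    cross : ∣ α * M * (u - v) ∣ ≤ α * w * (u + v)
    cross = begin
      ∣ α * M * (u - v) ∣             ≈⟨ trans (∣x*y∣≈∣x∣*∣y∣ _ _) (*-congʳ (trans (∣x*y∣≈∣x∣*∣y∣ _ _) (*-cong (0≤x⇒∣x∣≈x 0≤α) (∣fromℤ∣ m)))) ⟩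
      α * w * ∣ u - v ∣               ≤⟨ *-monoˡ-≤ (*-nonNeg 0≤α 0≤w) (∣∣≤
        (≤-by (*-nonNeg 0≤2 0≤v) (solve 2 (λ u v → u :+ v :- (u :- v) := :2 :* v) refl u v))
        (≤-by (*-nonNeg 0≤2 0≤u) (solve 2 (λ u v → u :+ v :- :- (u :- v) := :2 :* u) refl u v))) ⟩
      α * w * (u + v)                 ∎
    ½ = 2# ⁻¹
    0≤½ = <⇒≤ (⁻¹-pos 0<2)
    quadratic : ∣ α * (α - 1#) / 2# * M ^ 2 ∣ ≤ α * (α + 1#) * w ^ 2
    quadratic = begin
      ∣ α * (α - 1#) * ½ * M ^ 2 ∣    ≈⟨ trans (∣x*y∣≈∣x∣*∣y∣ _ _) (*-cong (trans (∣x*y∣≈∣x∣*∣y∣ _ _)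
                                           (*-cong (trans (∣x*y∣≈∣x∣*∣y∣ _ _) (*-congʳ (0≤x⇒∣x∣≈x 0≤α))) (0≤x⇒∣x∣≈x 0≤½)))
                                           (trans (∣∣-cong (fromℤ^2 m)) (0≤x⇒∣x∣≈x (^-nonNeg 0≤w 2)))) ⟩
      α * ∣ α - 1# ∣ * ½ * w ^ 2      ≤⟨ *-monoʳ-≤ (^-nonNeg 0≤w 2) (*-mono-≤ (*-nonNeg 0≤α (0≤∣x∣ _)) 0≤1
        (*-monoˡ-≤ 0≤α (∣∣≤ (≤-by 0≤2 (solve 1 (λ α → α :+ :1 :- (α :- :1) := :2) refl α))
                            (≤-by (*-nonNeg 0≤2 0≤α) (solve 1 (λ α → α :+ :1 :- :- (α :- :1) := :2 :* α) refl α))))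
        ½≤1) ⟩
      α * (α + 1#) * 1# * w ^ 2       ≈⟨ *-congʳ (*-identityʳ _) ⟩
      α * (α + 1#) * w ^ 2            ∎
      where
      ½≤1 : ½ ≤ 1#
      ½≤1 = ≤-trans (⁻¹-anti 0<1 (≤-by 0≤1 (solve 0 (:2 :- :1 := :1) refl)))
                    (≤-reflexive (sym (⁻¹-unique 0<1 (*-identityˡ 1#))))

  -- Lower bound for the eigenvalues

  sum≤length* : ∀ {k} ks → All (ℕ._≤ k) ks → ℕ.sum ks ℕ.≤ List.length ks ℕ.* k
  sum≤length* []       []         = z≤n
  sum≤length* (j ∷ ks) (j≤k ∷ p)  = ℕ.+-mono-≤ j≤k (sum≤length* ks p)

  -- Chebyshev's sum inequality for the decreasing sequences ks and coefficient.
  moment-nonNeg : ∀ {ks} → Linked ℕ._≥_ ks → 0# ≤ moment (List.length ks) ks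
  moment-nonNeg {[]}     _ = ≤-refl
  moment-nonNeg {k ∷ ks} l with (_ ∷ ≤k) ← Linked-bounded l ℕ.≤-refl = begin
    0#                                                  ≤⟨ +-nonNeg (moment-nonNeg (Linked-tail l)) (≤⇒0≤- (fromℕ-mono (sum≤length* ks ≤k))) ⟩
    moment n ks + (fromℕ (n ℕ.* k) - fromℕ (ℕ.sum ks))  ≈⟨ +-congˡ (+-cong (fromℕ-* n k) (-‿cong (fromℕ-sum ks))) ⟩
    moment n ks + (fromℕ n * fromℕ k - Σ)               ≈⟨ solve 4 (λ m n k s → m :+ (n :* k :- s) := (:1 :+ n :- :1 :- :2 :* :0) :* k :+ (m :+ :- :1 :* s)) refl _ (fromℕ n) (fromℕ k) Σ ⟩
    coefficient (suc n) 0 * fromℕ k + (moment n ks + - 1# * Σ)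
      ≈⟨ +-congˡ (trans (+-congˡ (sym (listSum-* (- 1#) (λ _ j → fromℕ j) ks))) (trans (sym (listSum-+ (λ i j → coefficient n i * fromℕ j) (λ _ j → - 1# * fromℕ j) ks))
           (listSum-cong (λ i j → solve 3 (λ n i j → (n :- :1 :- :2 :* i) :* j :+ :- :1 :* j := (:1 :+ n :- :1 :- :2 :* (:1 :+ i)) :* j)
             refl (fromℕ n) (fromℕ i) (fromℕ j)) ks))) ⟩
    moment (suc n) (k ∷ ks)                             ∎
    where
    open ≤-Reasoning
    n = List.length ks
    Σ = listSum (λ _ j → fromℕ j) ks

  -- With ℓ rows, the moment for N is the moment for ℓ plus (N - ℓ)|ks|. The former is nonnegative,
  -- and 2(N - ℓ) ≥ N when the rows fill at most half.
  moment-≥ : ∀ N {ks} → Linked ℕ._≥_ ks → 2 ℕ.* List.length ks ℕ.≤ N → 0# ≤ 2# * moment N ks - fromℕ N * fromℕ (ℕ.sum ks)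
  moment-≥ N {ks} l 2ℓ≤N = ≤-trans
    (+-nonNeg (*-nonNeg 0≤2 (moment-nonNeg l)) (*-nonNeg (≤⇒0≤- (fromℕ-mono 2ℓ≤N)) (fromℕ-nonNeg (ℕ.sum ks))))
    (≤-reflexive (trans (+-congˡ (*-congʳ (+-congˡ (-‿cong (fromℕ-* 2 ℓ)))))
      (trans (solve 4 (λ m n k s → :2 :* m :+ (n :- :2 :* k) :* s := :2 :* (m :+ (n :- k) :* s) :- n :* s) refl _ (fromℕ N) (fromℕ ℓ) (fromℕ (ℕ.sum ks)))
             (+-congʳ (*-congˡ (sym split))))))
    where
    ℓ = List.length ks
    split : moment N ks ≈ moment ℓ ks + (fromℕ N - fromℕ ℓ) * fromℕ (ℕ.sum ks)
    split = trans (listSum-cong (λ i k → solve 4 (λ n l i k → (n :- :1 :- :2 :* i) :* k := (l :- :1 :- :2 :* i) :* k :+ (n :- l) :* k)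
                    refl (fromℕ N) (fromℕ ℓ) (fromℕ i) (fromℕ k)) ks)
      (trans (listSum-+ (λ i k → coefficient ℓ i * fromℕ k) _ ks)
             (+-congˡ (trans (listSum-* _ (λ _ k → fromℕ k) ks) (*-congˡ (sym (fromℕ-sum ks))))))

  -- The expanded sum of (k + y)² over the rows; y will be minus the absolute value of the shift.
  squares-shifted : ∀ y ks → 0# ≤ squares ks + 2# * y * fromℕ (ℕ.sum ks) + fromℕ (List.length ks) * y ^ 2
  squares-shifted y ks = ≤-trans (listSum-nonNeg (λ _ k → ≤-trans (0≤x*x (fromℕ k + y)) (≤-reflexive
      (solve 2 (λ k y → (k :+ y) :* (k :+ y) := k :^ 2 :+ :2 :* y :* k :+ y :^ 2) refl (fromℕ k) y))) ks)
    (≤-reflexive (trans (listSum-+ (λ _ k → fromℕ k ^ 2 + 2# * y * fromℕ k) (λ _ _ → y ^ 2) ks)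
      (+-cong (trans (listSum-+ (λ _ k → fromℕ k ^ 2) (λ _ k → 2# * y * fromℕ k) ks)
        (+-congˡ (trans (listSum-* (2# * y) (λ _ k → fromℕ k) ks) (*-congˡ (sym (fromℕ-sum ks)))))) (listSum-const (y ^ 2) ks))))

  squares-nonNeg : ∀ ks → 0# ≤ squares ks
  squares-nonNeg = listSum-nonNeg (λ _ k → ^-nonNeg (fromℕ-nonNeg k) 2)

  -- The square of the shift is compensated by the half of the rows on its own side.
  module _ (n : ℕ) (ks ls : List ℕ) (2ℓ≤n : 2 ℕ.* List.length ls ℕ.≤ n) where

    quadratic-≥ : ∀ {y} → 0# ≤ y →
      0# ≤ fromℕ n * y ^ 2 + 2# * squares ks + 2# * squares ls + fromℕ 4 * y * fromℕ (ℕ.sum ks) - fromℕ 4 * y * fromℕ (ℕ.sum ls)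
    quadratic-≥ {y} 0≤y = ≤-trans
      (+-nonNeg (+-nonNeg (+-nonNeg (*-nonNeg 0≤2 (squares-nonNeg ks)) (*-nonNeg (*-nonNeg (fromℕ-nonNeg 4) 0≤y) (fromℕ-nonNeg (ℕ.sum ks))))
        (*-nonNeg 0≤2 (squares-shifted (- y) ls))) (*-nonNeg (≤⇒0≤- (fromℕ-mono 2ℓ≤n)) (^-nonNeg 0≤y 2)))
      (≤-reflexive (trans (+-congˡ (*-congʳ (+-congˡ (-‿cong (fromℕ-* 2 (List.length ls))))))
        (solve 7 (λ n y sk sl u v l → :2 :* sk :+ con (+ 4) :* y :* u :+ :2 :* (sl :+ :2 :* :- y :* v :+ l :* (:- y) :^ 2) :+ (n :- :2 :* l) :* y :^ 2
           := n :* y :^ 2 :+ :2 :* sk :+ :2 :* sl :+ con (+ 4) :* y :* u :- con (+ 4) :* y :* v) refl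
           (fromℕ n) y (squares ks) (squares ls) (fromℕ (ℕ.sum ks)) (fromℕ (ℕ.sum ls)) (fromℕ (List.length ls)))))

  module _ (N a : ℕ) (a<N : a ℕ.< N) {α : ℝ} (0≤α : 0# ≤ α) (2a≤N : 2 ℕ.* a ℕ.≤ N) (2b≤N : 2 ℕ.* (N ∸ suc a) ℕ.≤ N) where

    open Decomposition N a a<N
    open Eigenvalue N a a<N α

    numerator-≥ : ∀ μ ν m → Fits (μ , ν , m) →
      fromℕ N * (fromℕ (size μ) + fromℕ (size ν) + α * fromℤ m ^ 2) ≤ 2# * numerator (signature N (μ , ν , m))
    numerator-≥ μ ν m fits@(lμ , lν) = ≤-by
      (+-nonNeg (*-nonNeg 0≤α quadratic) (+-nonNeg (moment-≥ N (proj₁ (isPartition μ)) 2ℓμ≤N) (moment-≥ N (proj₁ (isPartition ν)) 2ℓν≤N)))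
      (trans (+-congʳ (*-congˡ (numerator≈ μ ν m fits)))
        (solve 9 (λ n α M sk sl u v mk ml →
           :2 :* (n :* (α :* M :^ 2) :+ ((α :* sk :+ mk :+ (α :* sl :+ ml)) :+ (:2 :* α :* M :* u :+ :- (:2 :* α :* M) :* v)))
             :- n :* (u :+ v :+ α :* M :^ 2)
           := α :* (n :* M :^ 2 :+ :2 :* sk :+ :2 :* sl :+ con (+ 4) :* M :* u :- con (+ 4) :* M :* v)
             :+ (:2 :* mk :- n :* u :+ (:2 :* ml :- n :* v))) refl
           (fromℕ N) α (fromℤ m) (squares (value μ)) (squares (value ν)) (fromℕ (size μ)) (fromℕ (size ν))
           (moment N (value μ)) (moment N (value ν))))
      where
      2ℓμ≤N = ℕ.≤-trans (ℕ.*-monoʳ-≤ 2 lμ) 2a≤N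
      2ℓν≤N = ℕ.≤-trans (ℕ.*-monoʳ-≤ 2 lν) 2b≤N
      M = fromℤ m
      quadratic : 0# ≤ fromℕ N * M ^ 2 + 2# * squares (value μ) + 2# * squares (value ν)
                       + fromℕ 4 * M * fromℕ (size μ) - fromℕ 4 * M * fromℕ (size ν)
      -- Only the partition on the side opposed to the sign of M gives a negative mixed term: ν for
      -- M ≥ 0, μ for M ≤ 0. The squares are completed on that side.
      quadratic with total 0# M
      ... | inj₁ 0≤M = quadratic-≥ N (value μ) (value ν) 2ℓν≤N 0≤M
      ... | inj₂ M≤0 = ≤-trans (quadratic-≥ N (value ν) (value μ) 2ℓμ≤N (neg-nonNeg M≤0))
        (≤-reflexive (solve 6 (λ n y sk sl u v → n :* (:- y) :^ 2 :+ :2 :* sl :+ :2 :* sk :+ con (+ 4) :* :- y :* v :- con (+ 4) :* :- y :* u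
            := n :* y :^ 2 :+ :2 :* sk :+ :2 :* sl :+ con (+ 4) :* y :* u :- con (+ 4) :* y :* v) refl
          (fromℕ N) M (squares (value μ)) (squares (value ν)) (fromℕ (size μ)) (fromℕ (size ν))))

  HasSum-∑< : {A : Set} → ∀ n {f : ℕ → A → ℝ} {S : ℕ → ℝ} → (∀ r → HasSum (f r) (S r)) →
              HasSum (λ a → ∑< n (λ r → f r a)) (∑< n S)
  -- The zero family is obtained as `0#` times the first one.
  HasSum-∑< zero    {f} hf = HasSum-cong (λ a → zeroˡ (f 0 a)) (zeroˡ _) (HasSum-* 0# (hf 0))
  HasSum-∑< (suc n) hf = HasSum-+ (hf 0) (HasSum-∑< n (hf ∘ suc))

  -- Estimates depending only on a bound R for t, α and their inverses.
  module Uniform {R : ℝ} (1≤R : 1# ≤ R) where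

    0<R : 0# < R
    0<R = <-≤-trans 0<1 1≤R

    -- The decay: t ≥ r, and κ ≥ N Y / (2c) ≥ Y / (2W) ≥ r S / (2W) because c ≤ N W, so tκ/2 ≥ η S.
    -- The growth: |tF| ≤ A S². `B` adds up the constants of the three quantities that `g` has to
    -- dominate.
    r W η ρ A B : ℝ
    r = R ⁻¹
    W = 1# + R
    η = r / 2# * (r / (2# * W))
    ρ = exp (- η)
    A = R * (R + 1#) ^ 2
    B = 1# + A + 2# * W

    0<r : 0# < r
    0<r = ⁻¹-pos 0<R

    r≤1 : r ≤ 1#
    r≤1 = ≤-trans (⁻¹-anti 0<1 1≤R) (≤-reflexive (sym (⁻¹-unique 0<1 (*-identityˡ 1#))))

    0<W : 0# < W
    0<W = +-pos 0<1 (<⇒≤ 0<R)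

    0<2W : 0# < 2# * W
    0<2W = *-pos 0<2 0<W

    0<η : 0# < η
    0<η = *-pos (/-pos 0<r 0<2) (/-pos 0<r 0<2W)

    0≤A : 0# ≤ A
    0≤A = *-nonNeg (<⇒≤ 0<R) (^-nonNeg (+-nonNeg (<⇒≤ 0<R) 0≤1) 2)

    0≤B : 0# ≤ B
    0≤B = +-nonNeg (+-nonNeg 0≤1 0≤A) (<⇒≤ 0<2W)

    S : Triple → ℝ
    S τ = fromℕ (totalSize τ)

    0≤S : ∀ τ → 0# ≤ S τ
    0≤S τ = fromℕ-nonNeg (totalSize τ)

    exp≤ρ^ : ∀ {x} τ → η * S τ ≤ x → exp (- x) ≤ ρ ^ totalSize τ
    exp≤ρ^ {x} τ ηS≤x = begin
      exp (- x)            ≤⟨ exp-mono (neg-mono-≤ ηS≤x) ⟩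
      exp (- (η * S τ))    ≈⟨ exp-cong (solve 2 (λ e s → :- (e :* s) := s :* :- e) refl η (S τ)) ⟩
      exp (S τ * - η)      ≈⟨ exp-fromℕ-* (totalSize τ) (- η) ⟩
      ρ ^ totalSize τ      ∎
      where open ≤-Reasoning

    -- A single majorant for 1, for A S² and for 2 W S. The second controls the Taylor variable, the
    -- third the triples that do not fit; being at least 1 makes its powers increase.
    g : Triple → ℝ
    g τ = B * (1# + S τ) ^ 2

    1≤g : ∀ τ → 1# ≤ g τ
    1≤g τ = ≤-trans (≤-reflexive (sym (*-identityˡ 1#)))
      (*-mono-≤ 0≤1 (^-nonNeg (+-nonNeg 0≤1 (0≤S τ)) 2) (≤-trans (x≤x+y 0≤A) (x≤x+y (<⇒≤ 0<2W))) (1≤^ (x≤x+y (0≤S τ)) 2))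

    1+AS²≤g : ∀ τ → 1# + A * S τ ^ 2 ≤ g τ
    1+AS²≤g τ = ≤-by (+-nonNeg (+-nonNeg (+-nonNeg (*-nonNeg 0≤2 (0≤S τ)) (^-nonNeg (0≤S τ) 2)) (*-nonNeg 0≤A (+-nonNeg 0≤1 (*-nonNeg 0≤2 (0≤S τ)))))
        (*-nonNeg (<⇒≤ 0<2W) (^-nonNeg (+-nonNeg 0≤1 (0≤S τ)) 2)))
      (solve 3 (λ a w s → (:1 :+ a :+ w) :* (:1 :+ s) :^ 2 :- (:1 :+ a :* s :^ 2)
        := :2 :* s :+ s :^ 2 :+ a :* (:1 :+ :2 :* s) :+ w :* (:1 :+ s) :^ 2) refl A (2# * W) (S τ))

    AS²≤g : ∀ τ → A * S τ ^ 2 ≤ g τ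
    AS²≤g τ = ≤-trans (x≤y+x 0≤1) (1+AS²≤g τ)

    2WS≤g : ∀ τ → 2# * W * S τ ≤ g τ
    2WS≤g τ = ≤-by (+-nonNeg (*-nonNeg (+-nonNeg 0≤1 0≤A) (^-nonNeg (+-nonNeg 0≤1 (0≤S τ)) 2))
        (*-nonNeg (<⇒≤ 0<2W) (+-nonNeg (+-nonNeg 0≤1 (0≤S τ)) (^-nonNeg (0≤S τ) 2))))
      (solve 3 (λ a w s → (:1 :+ a :+ w) :* (:1 :+ s) :^ 2 :- w :* s
        := (:1 :+ a) :* (:1 :+ s) :^ 2 :+ w :* (:1 :+ s :+ s :^ 2)) refl A (2# * W) (S τ))

    envelope : ℕ → Triple → ℝ
    envelope k τ = g τ ^ k * ρ ^ totalSize τ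

    0≤ρ^ : ∀ k → 0# ≤ ρ ^ k
    0≤ρ^ = ^-nonNeg (<⇒≤ (exp-pos (- η)))

    envelope-nonNeg : ∀ k τ → 0# ≤ envelope k τ
    envelope-nonNeg k τ = *-nonNeg (^-nonNeg (≤-trans 0≤1 (1≤g τ)) k) (0≤ρ^ (totalSize τ))

    -- Half of the exponential decay absorbs the polynomial factor.
    abstract
      envelope-BoundedBy : ∀ k → ∃ (BoundedBy (envelope k))
      envelope-BoundedBy k = _ , BoundedBy-mono dominated (BoundedBy-* (*-nonNeg (^-nonNeg 0≤B k) 0≤D)
          (proj₂ (triple-BoundedBy (<⇒≤ (exp-pos (- (η / 2#)))) (exp-neg<1 0<η/2))))
        where
        open ≤-Reasoning
        0<η/2 : 0# < η / 2#
        0<η/2 = /-pos 0<η 0<2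
        -- `g` is quadratic in 1 + S, so its k-th power has degree 2k. The factor exp (η/2) in D is
        -- the price of having 1 + S in place of S.
        σ E D : ℝ
        σ = exp (- (η / 2#))
        E = fromℕ ((2 ℕ.* k) !) / (η / 2#) ^ (2 ℕ.* k)
        D = E * exp (η / 2#)
        0≤E : 0# ≤ E
        0≤E = /-nonNeg (fromℕ-nonNeg ((2 ℕ.* k) !)) (^-pos 0<η/2 (2 ℕ.* k))
        0≤D : 0# ≤ D
        0≤D = *-nonNeg 0≤E (<⇒≤ (exp-pos (η / 2#)))
        exponents : ∀ s → η / 2# * (1# + s) + s * - η ≈ η / 2# + s * - (η / 2#)
        exponents s = trans (+-congˡ (*-congˡ (-‿cong (sym (half+half η)))))
          (solve 2 (λ h s → h :* (:1 :+ s) :+ s :* :- (h :+ h) := h :+ s :* :- h) refl (η / 2#) s)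
        dominated : ∀ τ → envelope k τ ≤ B ^ k * D * σ ^ totalSize τ
        dominated τ = begin
          (B * (1# + S τ) ^ 2) ^ k * ρ ^ s
            ≈⟨ *-cong (trans (^-distrib-* B _ k) (*-congˡ (^-assocʳ (1# + S τ) 2 k))) (sym (exp-fromℕ-* s (- η))) ⟩
          B ^ k * (1# + S τ) ^ (2 ℕ.* k) * exp (S τ * - η)
            ≤⟨ *-monoʳ-≤ (<⇒≤ (exp-pos _)) (*-monoˡ-≤ (^-nonNeg 0≤B k) (^≤exp 0<η/2 (+-nonNeg 0≤1 (0≤S τ)) (2 ℕ.* k))) ⟩
          B ^ k * (E * exp (η / 2# * (1# + S τ))) * exp (S τ * - η)
            ≈⟨ trans (solve 4 (λ b e x y → b :* (e :* x) :* y := b :* e :* (x :* y)) refl _ _ _ _) (*-congˡ (sym (exp-+ _ _))) ⟩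
          B ^ k * E * exp (η / 2# * (1# + S τ) + S τ * - η)
            ≈⟨ *-congˡ (trans (exp-cong (exponents (S τ))) (exp-+ _ _)) ⟩
          B ^ k * E * (exp (η / 2#) * exp (S τ * - (η / 2#)))
            ≈⟨ trans (solve 4 (λ b e x y → b :* e :* (x :* y) := b :* (e :* x) :* y) refl _ _ _ _) (*-congˡ (exp-fromℕ-* s (- (η / 2#)))) ⟩
          B ^ k * D * σ ^ s
            ∎
          where
          s : ℕ
          s = totalSize τ

    module Parameters {t α : ℝ} (r≤t : r ≤ t) (t≤R : t ≤ R) (r≤α : r ≤ α) (α≤R : α ≤ R) where

      0<t : 0# < t
      0<t = <-≤-trans 0<r r≤t

      0<α : 0# < α
      0<α = <-≤-trans 0<r r≤α

      0≤t : 0# ≤ t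
      0≤t = <⇒≤ 0<t

      0≤α : 0# ≤ α
      0≤α = <⇒≤ 0<α

      Y Fτ weight : Triple → ℝ
      Y (μ , ν , m) = fromℕ (size μ) + fromℕ (size ν) + α * fromℤ m ^ 2
      Fτ (μ , ν , m) = F α μ ν m
      weight τ = exp (- (t / 2# * Y τ))

      -- An integer satisfies |m| ≤ m², so α m² ≥ r|m|; the sizes are covered by r ≤ 1.
      rS≤Y : ∀ τ → r * S τ ≤ Y τ
      rS≤Y (μ , ν , m) = ≤-trans (≤-reflexive (*-congˡ (fromℕ-totalSize μ ν m))) (≤-by
        (+-nonNeg (+-nonNeg (*-nonNeg (≤⇒0≤- r≤1) (+-nonNeg (fromℕ-nonNeg (size μ)) (fromℕ-nonNeg (size ν))))
          (*-nonNeg (≤⇒0≤- r≤α) (^-nonNeg (fromℕ-nonNeg ℤ.∣ m ∣) 2)))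
          (*-nonNeg (<⇒≤ 0<r) (≤⇒0≤- w≤w²)))
        (trans (+-congʳ (+-congˡ (*-congˡ (fromℤ^2 m))))
          (solve 5 (λ u v α w r → u :+ v :+ α :* w :^ 2 :- r :* (u :+ (v :+ w))
            := (:1 :- r) :* (u :+ v) :+ (α :- r) :* w :^ 2 :+ r :* (w :^ 2 :- w)) refl
            (fromℕ (size μ)) (fromℕ (size ν)) α (fromℕ ℤ.∣ m ∣) r)))
        where
        n≤n*n : ∀ n → n ℕ.≤ n ℕ.* n
        n≤n*n zero    = z≤n
        n≤n*n (suc n) = ℕ.m≤m*n (suc n) (suc n)
        w≤w² : fromℕ ℤ.∣ m ∣ ≤ fromℕ ℤ.∣ m ∣ ^ 2
        w≤w² = ≤-trans (fromℕ-mono (n≤n*n ℤ.∣ m ∣)) (≤-reflexive (trans (fromℕ-* ℤ.∣ m ∣ ℤ.∣ m ∣) (*-congˡ (sym (*-identityʳ _)))))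

      0≤rS : ∀ τ → 0# ≤ r * S τ
      0≤rS τ = *-nonNeg (<⇒≤ 0<r) (0≤S τ)

      ηS≤ : ∀ τ {x} → r * S τ / (2# * W) ≤ x → η * S τ ≤ t / 2# * x
      ηS≤ τ h = ≤-trans (≤-reflexive (solve 4 (λ a r i s → a :* (r :* i) :* s := a :* (r :* s :* i)) refl (r / 2#) r ((2# * W) ⁻¹) (S τ)))
        (*-mono-≤ (/-nonNeg (<⇒≤ 0<r) 0<2) (≤-trans (/-nonNeg (0≤rS τ) 0<2W) h) (*-monoʳ-≤ (<⇒≤ (⁻¹-pos 0<2)) r≤t) h)

      weight-pos : ∀ τ → 0# < weight τ
      weight-pos τ = exp-pos _

      -- The rate ρ is dictated by the summand of the heat trace; the weight decays faster, by the
      -- factor 2W ≥ 1 in the exponent.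
      weight≤ρ^ : ∀ τ → weight τ ≤ ρ ^ totalSize τ
      weight≤ρ^ τ = exp≤ρ^ τ (ηS≤ τ (≤-trans (/-≤ 0<2W (≤-trans (≤-reflexive (sym (*-identityʳ _))) (*-monoˡ-≤ (0≤rS τ) 1≤2W))) (rS≤Y τ)))
        where
        1≤2W : 1# ≤ 2# * W
        1≤2W = ≤-by (+-nonNeg 0≤1 (*-nonNeg 0≤2 (<⇒≤ 0<R))) (solve 1 (λ R → :2 :* (:1 :+ R) :- :1 := :1 :+ :2 :* R) refl R)

      ∣tF∣≤AS² : ∀ τ → ∣ t * Fτ τ ∣ ≤ A * S τ ^ 2
      ∣tF∣≤AS² τ@(μ , ν , m) = begin
        ∣ t * Fτ τ ∣                        ≈⟨ trans (∣x*y∣≈∣x∣*∣y∣ _ _) (*-congʳ (0≤x⇒∣x∣≈x 0≤t)) ⟩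
        t * ∣ Fτ τ ∣                        ≤⟨ *-mono-≤ 0≤t (*-nonNeg (^-nonNeg (+-nonNeg (<⇒≤ 0<R) 0≤1) 2) (^-nonNeg (0≤S τ) 2))
                                                 t≤R (∣F∣≤ 0≤α α≤R μ ν m) ⟩
        R * ((R + 1#) ^ 2 * S τ ^ 2)        ≈⟨ *-assoc _ _ _ ⟨
        A * S τ ^ 2                         ∎
        where open ≤-Reasoning

      ∣F∣≤g : ∀ τ → ∣ Fτ τ ∣ ≤ g τ
      ∣F∣≤g τ@(μ , ν , m) = ≤-trans (∣F∣≤ 0≤α α≤R μ ν m) (≤-trans (*-monoʳ-≤ (^-nonNeg (0≤S τ) 2)
        (≤-trans (≤-reflexive (sym (*-identityˡ _))) (*-monoʳ-≤ (^-nonNeg (+-nonNeg (<⇒≤ 0<R) 0≤1) 2) 1≤R))) (AS²≤g τ))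

      moment-HasSum : ∀ k → HasSum (λ τ → weight τ * Fτ τ ^ k) (tsum (λ τ → weight τ * Fτ τ ^ k))
      moment-HasSum k = tsum-HasSum (proj₂ (abs-HasSum bound (proj₂ (envelope-BoundedBy k))))
        where
        open ≤-Reasoning
        bound : ∀ τ → ∣ weight τ * Fτ τ ^ k ∣ ≤ envelope k τ
        bound τ = begin
          ∣ weight τ * Fτ τ ^ k ∣          ≈⟨ trans (∣x*y∣≈∣x∣*∣y∣ _ _) (*-cong (0≤x⇒∣x∣≈x (<⇒≤ (weight-pos τ))) (∣x^n∣≈∣x∣^n _ k)) ⟩
          weight τ * ∣ Fτ τ ∣ ^ k          ≤⟨ *-mono-≤ (<⇒≤ (weight-pos τ)) (^-nonNeg (≤-trans 0≤1 (1≤g τ)) k)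
                                                (weight≤ρ^ τ) (^-monoˡ-≤ (0≤∣x∣ _) (∣F∣≤g τ) k) ⟩
          ρ ^ totalSize τ * g τ ^ k        ≈⟨ *-comm _ _ ⟩
          envelope k τ                     ∎

      -- The normalisation of the three laws

      0<φ : 0# < φ (q t)
      0<φ = Euler.φ-pos (<⇒≤ (exp-pos _)) (exp-neg<1 (/-pos 0<t 0<2))

      weight≈ : ∀ μ ν m → q t ^ size μ * (q t ^ size ν * gauss α t m) ≈ weight (μ , ν , m)
      weight≈ μ ν m = begin
        q t ^ size μ * (q t ^ size ν * gauss α t m)
          ≈⟨ *-cong (sym (exp-fromℕ-* (size μ) _)) (trans (*-congʳ (sym (exp-fromℕ-* (size ν) _))) (sym (exp-+ _ _))) ⟩
        exp (fromℕ (size μ) * - (t / 2#)) * exp (fromℕ (size ν) * - (t / 2#) + - (t * α * fromℤ m ^ 2 / 2#))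
          ≈⟨ exp-+ _ _ ⟨
        exp (fromℕ (size μ) * - (t / 2#) + (fromℕ (size ν) * - (t / 2#) + - (t * α * fromℤ m ^ 2 / 2#)))
          ≈⟨ exp-cong (solve 6 (λ u v t h α M → u :* :- (t :* h) :+ (v :* :- (t :* h) :+ :- (t :* α :* M :^ 2 :* h))
               := :- (t :* h :* (u :+ v :+ α :* M :^ 2))) refl (fromℕ (size μ)) (fromℕ (size ν)) t (2# ⁻¹) α (fromℤ m)) ⟩
        weight (μ , ν , m)
          ∎
        where open ≈-Reasoning

      ∅ : Partition
      ∅ = [] , [ [] , [] ]

      -- The single term m = 0 is a positive lower bound. Convergence holds because the Gaussian at
      -- m is the weight of the triple with two empty partitions.
      0<Θ : 0# < Θ α t
      0<Θ = <-≤-trans (exp-pos _) (≤-trans (≤-reflexive (sym (+-identityʳ _)))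
        (∑≤HasSum (λ m → <⇒≤ (exp-pos _)) (tsum-HasSum (proj₂ gauss-HasSum)) (+ 0 ∷ []) ([] ∷ [])))
        where
        gauss-HasSum : ∃[ L ] HasSum (gauss α t) L
        gauss-HasSum = nonNeg-HasSum (λ m → <⇒≤ (exp-pos _))
          (BoundedBy-mono {g = λ m → ρ ^ totalSize (∅ , ∅ , m)}
            (λ m → ≤-trans (≤-reflexive (trans (solve 1 (λ x → x := :1 :* (:1 :* x)) refl _) (weight≈ ∅ ∅ m))) (weight≤ρ^ (∅ , ∅ , m)))
            (BoundedBy-injection (λ m → ∅ , ∅ , m) (λ { ≡.refl → ≡.refl })
              (proj₂ (triple-BoundedBy (<⇒≤ (exp-pos (- η))) (exp-neg<1 0<η)))))

      0<φ² : 0# < φ (q t) ^ 2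
      0<φ² = ^-pos 0<φ 2

      -- The normalising constants of the three laws factor out; their product is the inverse of the
      -- prefactor of the expansion.
      𝔼≈ : ∀ k → 𝔼 α t (λ μ ν m → F α μ ν m ^ k) ≈ φ (q t) ^ 2 / Θ α t * tsum (λ τ → weight τ * Fτ τ ^ k)
      𝔼≈ k = tsum-≈ (HasSum-cong (λ (μ , ν , m) → trans (*-congˡ (*-congʳ (sym (weight≈ μ ν m))))
        (solve 6 (λ f h a b c x → f :^ 2 :* h :* (a :* (b :* c) :* x) := f :* a :* (f :* b) :* (c :* h) :* x) refl
          (φ (q t)) (Θ α t ⁻¹) (q t ^ size μ) (q t ^ size ν) (gauss α t m) (F α μ ν m ^ k)))
        refl (HasSum-* (φ (q t) ^ 2 / Θ α t) (moment-HasSum k)))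

  -- Halving the rows, and the comparison of the heat trace with its expansion

  halve : ∀ N → ∃[ a ] 2 ℕ.* a ℕ.≤ N × N ℕ.≤ suc (2 ℕ.* a)
  halve zero          = 0 , z≤n , z≤n
  halve (suc zero)    = 0 , z≤n , s≤s z≤n
  halve (suc (suc N)) with a , 2a≤N , N≤ ← halve N = suc a ,
    ≡.subst (ℕ._≤ suc (suc N)) (≡.sym (ℕ.*-suc 2 a)) (s≤s (s≤s 2a≤N)) ,
    ≡.subst (λ k → suc (suc N) ℕ.≤ suc k) (≡.sym (ℕ.*-suc 2 a)) (s≤s (s≤s N≤))

  module Halving {N a : ℕ} (2a≤N : 2 ℕ.* a ℕ.≤ N) (N≤1+2a : N ℕ.≤ suc (2 ℕ.* a)) (2≤N : 2 ℕ.≤ N) where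

    a<N : a ℕ.< N
    a<N = ℕ.≰⇒> λ N≤a → ℕ.<⇒≱ (s≤s z≤n) (ℕ.≤-trans 2≤N (ℕ.+-cancelˡ-≤ N N 0
      (ℕ.≤-trans (ℕ.+-mono-≤ N≤a (ℕ.≤-trans N≤a (ℕ.m≤m+n a 0))) (ℕ.≤-trans 2a≤N (ℕ.m≤m+n N 0)))))

    open Decomposition N a a<N

    2[N∸1+a]≤N : 2 ℕ.* (N ∸ suc a) ℕ.≤ N
    2[N∸1+a]≤N = ≡.subst (ℕ._≤ N) (≡.sym (ℕ.*-distribˡ-∸ 2 N (suc a))) (ℕ.m≤n+o⇒m∸n≤o (2 ℕ.* N) (2 ℕ.* suc a)
      (ℕ.+-mono-≤ (ℕ.≤-trans N≤1+2a (≡.subst (suc (2 ℕ.* a) ℕ.≤_) (≡.sym (ℕ.*-suc 2 a)) (ℕ.n≤1+n _)))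
                  (ℕ.≤-reflexive (ℕ.+-identityʳ N))))

    -- A triple fails to fit when μ has at least a + 1 rows or ν at least N - a, and either number
    -- is at least N/2.
    N≤2length : ((μ , ν , m) : Triple) → ¬ Fits (μ , ν , m) → N ℕ.≤ 2 ℕ.* (List.length (value μ) ℕ.+ List.length (value ν))
    N≤2length (μ , ν , m) ¬fits with List.length (value μ) ℕ.≤? a
    ... | no ℓ≰a = begin
      N                                                       ≤⟨ N≤1+2a ⟩
      suc (2 ℕ.* a)                                           ≤⟨ ℕ.n≤1+n _ ⟩
      2 ℕ.+ 2 ℕ.* a                                           ≡⟨ ℕ.*-suc 2 a ⟨
      2 ℕ.* suc a                                             ≤⟨ ℕ.*-monoʳ-≤ 2 (ℕ.≰⇒> ℓ≰a) ⟩
      2 ℕ.* List.length (value μ)                             ≤⟨ ℕ.*-monoʳ-≤ 2 (ℕ.m≤m+n (List.length (value μ)) _) ⟩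
      2 ℕ.* (List.length (value μ) ℕ.+ List.length (value ν)) ∎
      where open ℕ.≤-Reasoning
    ... | yes ℓ≤a = begin
      N                                                       ≤⟨ ℕ.m+n≤o⇒m≤o∸n N (ℕ.+-monoʳ-≤ N (ℕ.≤-trans 2a≤N (ℕ.≤-reflexive (≡.sym (ℕ.+-identityʳ N))))) ⟩
      2 ℕ.* N ∸ 2 ℕ.* a                                       ≡⟨ ℕ.*-distribˡ-∸ 2 N a ⟨
      2 ℕ.* (N ∸ a)                                           ≡⟨ ≡.cong (λ k → 2 ℕ.* k) (ℕ.+-∸-assoc 1 a<N) ⟩
      2 ℕ.* suc (N ∸ suc a)                                   ≤⟨ ℕ.*-monoʳ-≤ 2 (ℕ.≰⇒> λ ℓ≤ → ¬fits (ℓ≤a , ℓ≤)) ⟩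
      2 ℕ.* List.length (value ν)                             ≤⟨ ℕ.*-monoʳ-≤ 2 (ℕ.m≤n+m _ (List.length (value μ))) ⟩
      2 ℕ.* (List.length (value μ) ℕ.+ List.length (value ν)) ∎
      where open ℕ.≤-Reasoning

    N≤2totalSize : ∀ τ → ¬ Fits τ → N ℕ.≤ 2 ℕ.* totalSize τ
    N≤2totalSize τ@(μ , ν , m) ¬fits = ℕ.≤-trans (N≤2length τ ¬fits) (ℕ.*-monoʳ-≤ 2
      (ℕ.+-mono-≤ (length≤sum (proj₂ (isPartition μ))) (ℕ.≤-trans (length≤sum (proj₂ (isPartition ν))) (ℕ.m≤m+n _ _))))

  -- The first summand serves the triples that fit, where the weight and the heat-trace term each
  -- contribute one ρ^s. The second counts the terms of the Taylor polynomial for the other triples.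
  errorConstant : ℕ → ℝ
  errorConstant p = 2# * taylorConstant p + fromℕ (suc p)

  -- Defined before N, t and α are introduced, which makes the uniformity of the estimate evident.
  uniformConstant : ∀ {R} → 1# ≤ R → ℕ → ℝ
  uniformConstant 1≤R p = errorConstant p * proj₁ (Uniform.envelope-BoundedBy 1≤R (p ℕ.+ suc p))

  module Comparison {R : ℝ} (1≤R : 1# ≤ R) (p : ℕ)
    {t α : ℝ} (r≤t : R ⁻¹ ≤ t) (t≤R : t ≤ R) (r≤α : R ⁻¹ ≤ α) (α≤R : α ≤ R)
    {N a : ℕ} (2a≤N : 2 ℕ.* a ℕ.≤ N) (N≤1+2a : N ℕ.≤ suc (2 ℕ.* a)) (2≤N : 2 ℕ.≤ N)
    where

    open Uniform 1≤R
    open Parameters r≤t t≤R r≤α α≤R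
    open Halving {N} {a} 2a≤N N≤1+2a 2≤N
    open Decomposition N a a<N
    open Eigenvalue N a a<N α using (numerator; numerator-F)

    c : ℝ
    c = scale N α

    1≤c : 1# ≤ c
    1≤c = ≤-by (+-nonNeg (≤⇒0≤- (fromℕ-mono 2≤N)) 0≤α) (solve 2 (λ n α → n :+ α :- :1 :- :1 := n :- :2 :+ α) refl (fromℕ N) α)

    0<c : 0# < c
    0<c = <-≤-trans 0<1 1≤c

    0≤c⁻¹ : 0# ≤ c ⁻¹
    0≤c⁻¹ = <⇒≤ (⁻¹-pos 0<c)

    c≤NW : c ≤ fromℕ N * W
    c≤NW = ≤-trans (≤-by (+-nonNeg (*-nonNeg 0≤α (≤⇒0≤- (1≤fromℕ (ℕ.≤-trans (s≤s z≤n) 2≤N)))) 0≤1)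
        (solve 2 (λ n α → n :* (:1 :+ α) :- (n :+ α :- :1) := α :* (n :- :1) :+ :1) refl (fromℕ N) α))
      (*-monoˡ-≤ (fromℕ-nonNeg N) (+-monoʳ-≤ 1# α≤R))

    x : Triple → ℝ
    x τ = - t * (Fτ τ * c ⁻¹)

    zterm : Signature N → ℝ
    zterm ƛ = exp (- (t / 2#) * κ α N ƛ)

    zterm≈ : ∀ τ → Fits τ → zterm (signature N τ) ≈ weight τ * exp (x τ)
    zterm≈ τ@(μ , ν , m) fits = begin
      exp (- (t / 2#) * (numerator (signature N τ) * c ⁻¹))
        ≈⟨ exp-cong (*-congˡ (*-congʳ (numerator-F μ ν m fits))) ⟩
      exp (- (t / 2#) * ((c * Y τ + 2# * Fτ τ) * c ⁻¹))
        ≈⟨ exp-cong (solve 6 (λ t h c y f i → :- (t :* h) :* ((c :* y :+ :2 :* f) :* i)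
             := :- (t :* h :* y) :* (c :* i) :+ :- t :* (f :* i) :* (:2 :* h)) refl t (2# ⁻¹) c (Y τ) (Fτ τ) (c ⁻¹)) ⟩
      exp (- (t / 2# * Y τ) * (c * c ⁻¹) + x τ * (2# * 2# ⁻¹))
        ≈⟨ exp-cong (+-cong (trans (*-congˡ (*-⁻¹ 0<c)) (*-identityʳ _)) (trans (*-congˡ (*-⁻¹ 0<2)) (*-identityʳ _))) ⟩
      exp (- (t / 2# * Y τ) + x τ)
        ≈⟨ exp-+ _ _ ⟩
      weight τ * exp (x τ)
        ∎
      where open ≈-Reasoning

    zterm≤ρ^ : ∀ τ → Fits τ → zterm (signature N τ) ≤ ρ ^ totalSize τ
    zterm≤ρ^ τ@(μ , ν , m) fits = ≤-trans (≤-reflexive (exp-cong (sym (-‿distribˡ-* _ _)))) (exp≤ρ^ τ (ηS≤ τ (≤-/ 0<c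
      (*-cancelʳ-≤ 0<2 (begin
        r * S τ / (2# * W) * c * 2#                   ≤⟨ *-monoʳ-≤ 0≤2 (*-monoˡ-≤ (/-nonNeg (0≤rS τ) 0<2W) c≤NW) ⟩
        r * S τ / (2# * W) * (fromℕ N * W) * 2#       ≈⟨ solve 4 (λ z i n w → z :* i :* (n :* w) :* :2 := n :* z :* (:2 :* w :* i)) refl _ _ (fromℕ N) W ⟩
        fromℕ N * (r * S τ) * (2# * W * (2# * W) ⁻¹)  ≈⟨ trans (*-congˡ (*-⁻¹ 0<2W)) (*-identityʳ _) ⟩
        fromℕ N * (r * S τ)                           ≤⟨ *-monoˡ-≤ (fromℕ-nonNeg N) (rS≤Y τ) ⟩
        fromℕ N * Y τ                                 ≤⟨ numerator-≥ N a a<N 0≤α 2a≤N 2[N∸1+a]≤N μ ν m fits ⟩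
        2# * numerator (signature N τ)                ≈⟨ *-comm _ _ ⟩
        numerator (signature N τ) * 2#                ∎)))))
      where open ≤-Reasoning

    -- The summand of the heat trace, moved to triples and extended by 0.
    restricted : Triple → ℝ
    restricted τ with lem {Fits τ}
    ... | yes _ = zterm (signature N τ)
    ... | no _  = 0#

    restricted-on : ∀ τ → Fits τ → restricted τ ≈ zterm (signature N τ)
    restricted-on τ fits with lem {Fits τ}
    ... | yes _ = refl
    ... | no ¬f = contradiction fits ¬f

    restricted-off : ∀ τ → ¬ Fits τ → restricted τ ≈ 0#
    restricted-off τ ¬fits with lem {Fits τ}
    ... | yes f = contradiction f ¬fits
    ... | no _  = refl

    -- Convergence over signatures has to be known before the transfer. Surjectivity provides a
    -- section into triples, along which the summable ρ^s is pulled back.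
    Z-HasSum : HasSum restricted (Z α N t)
    Z-HasSum = HasSum-transfer (signature N) Fits signature-surjective signature-injective restricted-on restricted-off
      (tsum-HasSum (proj₂ (nonNeg-HasSum {f = zterm} (λ ƛ → <⇒≤ (exp-pos _))
        (BoundedBy-mono {g = λ ƛ → ρ ^ totalSize (triple ƛ)} zterm≤ (BoundedBy-injection triple triple-injective
          (proj₂ (triple-BoundedBy (<⇒≤ (exp-pos (- η))) (exp-neg<1 0<η))))))))
      where
      triple : Signature N → Triple
      triple ƛ = proj₁ (signature-surjective ƛ)
      signature-triple : ∀ ƛ → signature N (triple ƛ) ≡ ƛ
      signature-triple ƛ = proj₂ (proj₂ (signature-surjective ƛ))
      zterm≤ : ∀ ƛ → zterm ƛ ≤ ρ ^ totalSize (triple ƛ)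
      zterm≤ ƛ = ≡.subst (λ ƛ′ → zterm ƛ′ ≤ ρ ^ totalSize (triple ƛ)) (signature-triple ƛ)
        (zterm≤ρ^ (triple ƛ) (proj₁ (proj₂ (signature-surjective ƛ))))
      triple-injective : ∀ {ƛ ƛ′} → triple ƛ ≡ triple ƛ′ → ƛ ≡ ƛ′
      triple-injective {ƛ} {ƛ′} eq =
        ≡.trans (≡.sym (signature-triple ƛ)) (≡.trans (≡.cong (signature N) eq) (signature-triple ƛ′))

    approximation : Triple → ℝ
    approximation τ = weight τ * taylor p (x τ)

    coef M : ℕ → ℝ
    coef k = (- t) ^ k / (fromℕ (k !) * c ^ k)
    M k = tsum (λ τ → weight τ * Fτ τ ^ k)

    coef*weight*F^ : ∀ k τ → coef k * (weight τ * Fτ τ ^ k) ≈ weight τ * expTerm (x τ) k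
    coef*weight*F^ k τ = begin
      (- t) ^ k * (fromℕ (k !) * c ^ k) ⁻¹ * (weight τ * Fτ τ ^ k)
        ≈⟨ *-congʳ (*-congˡ (trans (⁻¹-* (fac-pos k) (^-pos 0<c k)) (*-congˡ (⁻¹-^ 0<c k)))) ⟩
      (- t) ^ k * (fromℕ (k !) ⁻¹ * (c ⁻¹) ^ k) * (weight τ * Fτ τ ^ k)
        ≈⟨ solve 5 (λ a i j w f → a :* (i :* j) :* (w :* f) := w :* (a :* (f :* j) :* i)) refl _ _ _ _ _ ⟩
      weight τ * ((- t) ^ k * (Fτ τ ^ k * (c ⁻¹) ^ k) * fromℕ (k !) ⁻¹)
        ≈⟨ *-congˡ (*-congʳ (trans (^-distrib-* (- t) _ k) (*-congˡ (^-distrib-* (Fτ τ) (c ⁻¹) k)))) ⟨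
      weight τ * expTerm (x τ) k
        ∎
      where open ≈-Reasoning

    approximation-HasSum : HasSum approximation (∑< (suc p) (λ k → coef k * M k))
    approximation-HasSum = HasSum-cong
      (λ τ → trans (∑<-cong (suc p) (λ k _ → coef*weight*F^ k τ)) (∑<-* (suc p) (weight τ) (expTerm (x τ)))) refl
      (HasSum-∑< (suc p) {λ k τ → coef k * (weight τ * Fτ τ ^ k)} (λ k → HasSum-* (coef k) (moment-HasSum k)))

    normalised : Θ α t / φ (q t) ^ 2 * ∑< (suc p) (λ k → coef k * 𝔼 α t (λ μ ν m → F α μ ν m ^ k)) ≈
                 ∑< (suc p) (λ k → coef k * M k)
    normalised = trans (sym (∑<-* (suc p) _ (λ k → coef k * 𝔼 α t (λ μ ν m → F α μ ν m ^ k)))) (∑<-cong (suc p) λ k _ → begin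
      Θ α t * (φ (q t) ^ 2) ⁻¹ * (coef k * 𝔼 α t (λ μ ν m → F α μ ν m ^ k))
        ≈⟨ *-congˡ (*-congˡ (𝔼≈ k)) ⟩
      Θ α t * (φ (q t) ^ 2) ⁻¹ * (coef k * (φ (q t) ^ 2 * Θ α t ⁻¹ * M k))
        ≈⟨ solve 6 (λ θ j c f i m → θ :* j :* (c :* (f :* i :* m)) := θ :* i :* (f :* j) :* (c :* m)) refl _ _ (coef k) (φ (q t) ^ 2) _ (M k) ⟩
      Θ α t * Θ α t ⁻¹ * (φ (q t) ^ 2 * (φ (q t) ^ 2) ⁻¹) * (coef k * M k)
        ≈⟨ *-congʳ (*-cong (*-⁻¹ 0<Θ) (*-⁻¹ 0<φ²)) ⟩
      1# * 1# * (coef k * M k)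
        ≈⟨ trans (*-congʳ (*-identityˡ 1#)) (*-identityˡ _) ⟩
      coef k * M k
        ∎)
      where open ≈-Reasoning

    0≤taylorConstant : 0# ≤ taylorConstant p
    0≤taylorConstant = +-nonNeg (<⇒≤ (exp-pos 1#)) (fromℕ-nonNeg (suc (suc p)))

    ∣x∣≤AS²/c : ∀ τ → ∣ x τ ∣ ≤ A * S τ ^ 2 * c ⁻¹
    ∣x∣≤AS²/c τ = begin
      ∣ - t * (Fτ τ * c ⁻¹) ∣     ≈⟨ trans (∣∣-cong (solve 3 (λ t f i → :- t :* (f :* i) := :- (t :* f :* i)) refl t (Fτ τ) (c ⁻¹)))
                                       (trans (∣-x∣≈∣x∣ _) (trans (∣x*y∣≈∣x∣*∣y∣ _ _) (*-congˡ (0≤x⇒∣x∣≈x 0≤c⁻¹)))) ⟩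
      ∣ t * Fτ τ ∣ * c ⁻¹         ≤⟨ *-monoʳ-≤ 0≤c⁻¹ (∣tF∣≤AS² τ) ⟩
      A * S τ ^ 2 * c ⁻¹          ∎
      where open ≤-Reasoning

    c⁻¹≤1 : c ⁻¹ ≤ 1#
    c⁻¹≤1 = ≤-trans (⁻¹-anti 0<1 1≤c) (≤-reflexive (sym (⁻¹-unique 0<1 (*-identityˡ 1#))))

    0≤g^ : ∀ τ k → 0# ≤ g τ ^ k
    0≤g^ τ k = ^-nonNeg (≤-trans 0≤1 (1≤g τ)) k

    0≤c⁻¹^ : 0# ≤ (c ⁻¹) ^ suc p
    0≤c⁻¹^ = ^-nonNeg 0≤c⁻¹ (suc p)

    D : ℝ
    D = errorConstant p

    errorBound : Triple → ℝ
    errorBound τ = D * (c ⁻¹) ^ suc p * envelope (p ℕ.+ suc p) τ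

    -- |x| ≤ g/c supplies the powers of 1/c. The weight times 1 + exp x is the weight plus the
    -- heat-trace term, both at most ρ^s. The power p + 1 of g is raised to 2p + 1 only to share one
    -- majorant with the triples that do not fit.
    error-on : ∀ τ → Fits τ → ∣ restricted τ - approximation τ ∣ ≤ errorBound τ
    error-on τ fits = begin
      ∣ restricted τ - approximation τ ∣
        ≈⟨ ∣∣-cong (trans (+-congʳ (trans (restricted-on τ fits) (zterm≈ τ fits)))
             (solve 3 (λ w e y → w :* e :- w :* y := w :* (e :- y)) refl (weight τ) (exp (x τ)) (taylor p (x τ)))) ⟩
      ∣ weight τ * (exp (x τ) - taylor p (x τ)) ∣
        ≈⟨ trans (∣x*y∣≈∣x∣*∣y∣ _ _) (*-congʳ (0≤x⇒∣x∣≈x (<⇒≤ (weight-pos τ)))) ⟩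
      weight τ * ∣ exp (x τ) - taylor p (x τ) ∣
        ≤⟨ *-monoˡ-≤ (<⇒≤ (weight-pos τ)) (exp-taylor p (x τ)) ⟩
      weight τ * (K * ∣ x τ ∣ ^ suc p * (1# + exp (x τ)))
        ≈⟨ solve 4 (λ w k y e → w :* (k :* y :* (:1 :+ e)) := k :* y :* (w :+ w :* e)) refl _ K _ _ ⟩
      K * ∣ x τ ∣ ^ suc p * (weight τ + weight τ * exp (x τ))
        ≤⟨ *-mono-≤ (*-nonNeg 0≤taylorConstant (^-nonNeg (0≤∣x∣ _) (suc p))) (+-nonNeg (0≤ρ^ s) (0≤ρ^ s))
             (*-monoˡ-≤ 0≤taylorConstant (≤-trans (^-monoˡ-≤ (0≤∣x∣ _) (≤-trans (∣x∣≤AS²/c τ) (*-monoʳ-≤ 0≤c⁻¹ (AS²≤g τ))) (suc p))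
               (≤-reflexive (^-distrib-* (g τ) (c ⁻¹) (suc p)))))
             (+-mono-≤ (weight≤ρ^ τ) (≤-trans (≤-reflexive (sym (zterm≈ τ fits))) (zterm≤ρ^ τ fits))) ⟩
      K * (g τ ^ suc p * (c ⁻¹) ^ suc p) * (ρ ^ s + ρ ^ s)
        ≈⟨ solve 4 (λ k y i e → k :* (y :* i) :* (e :+ e) := :2 :* k :* i :* (y :* e)) refl K _ _ _ ⟩
      2# * K * (c ⁻¹) ^ suc p * (g τ ^ suc p * ρ ^ s)
        ≤⟨ *-mono-≤ (*-nonNeg (*-nonNeg 0≤2 0≤taylorConstant) 0≤c⁻¹^) (envelope-nonNeg (p ℕ.+ suc p) τ)
             (*-monoʳ-≤ 0≤c⁻¹^ (x≤x+y (fromℕ-nonNeg (suc p)))) (*-monoʳ-≤ (0≤ρ^ s) (^-monoʳ-≤ (1≤g τ) (ℕ.m≤n+m (suc p) p))) ⟩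
      errorBound τ
        ∎
      where
      open ≤-Reasoning
      s = totalSize τ
      K = taylorConstant p

    1≤g/c : ∀ τ → ¬ Fits τ → 1# ≤ g τ * c ⁻¹
    1≤g/c τ ¬fits = ≤-/ 0<c (begin
      1# * c                    ≈⟨ *-identityˡ c ⟩
      c                         ≤⟨ c≤NW ⟩
      fromℕ N * W               ≤⟨ *-monoʳ-≤ (<⇒≤ 0<W) (fromℕ-mono (N≤2totalSize τ ¬fits)) ⟩
      fromℕ (2 ℕ.* totalSize τ) * W   ≈⟨ trans (*-congʳ (fromℕ-* 2 (totalSize τ))) (solve 2 (λ s w → :2 :* s :* w := :2 :* w :* s) refl (S τ) W) ⟩
      2# * W * S τ              ≤⟨ 2WS≤g τ ⟩
      g τ                       ∎)
      where open ≤-Reasoning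

    ∣x∣≤g : ∀ τ → ∣ x τ ∣ ≤ g τ
    ∣x∣≤g τ = ≤-trans (∣x∣≤AS²/c τ) (≤-trans (*-monoˡ-≤ (*-nonNeg 0≤A (^-nonNeg (0≤S τ) 2)) c⁻¹≤1)
      (≤-trans (≤-reflexive (*-identityʳ _)) (AS²≤g τ)))

    -- Here the heat trace has no term and the whole approximation is error. Its Taylor polynomial
    -- costs g^p, and the inserted factor (g/c)^(p+1) ≥ 1 costs g^(p+1): together the exponent p +
    -- (p + 1) of the envelope.
    error-off : ∀ τ → ¬ Fits τ → ∣ restricted τ - approximation τ ∣ ≤ errorBound τ
    error-off τ ¬fits = begin
      ∣ restricted τ - approximation τ ∣
        ≈⟨ trans (∣∣-cong (trans (+-congʳ (restricted-off τ ¬fits)) (+-identityˡ _))) (trans (∣-x∣≈∣x∣ _)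
             (trans (∣x*y∣≈∣x∣*∣y∣ _ _) (*-congʳ (0≤x⇒∣x∣≈x (<⇒≤ (weight-pos τ)))))) ⟩
      weight τ * ∣ taylor p (x τ) ∣
        ≤⟨ *-mono-≤ (<⇒≤ (weight-pos τ)) 0≤bound (weight≤ρ^ τ) (∣taylor∣≤ p (∣x∣≤g τ) (1≤g τ)) ⟩
      ρ ^ s * (fromℕ (suc p) * g τ ^ p)
        ≈⟨ trans (*-comm _ _) (sym (*-identityʳ _)) ⟩
      fromℕ (suc p) * g τ ^ p * ρ ^ s * 1#
        ≤⟨ *-monoˡ-≤ (*-nonNeg 0≤bound (0≤ρ^ s)) (1≤^ (1≤g/c τ ¬fits) (suc p)) ⟩
      fromℕ (suc p) * g τ ^ p * ρ ^ s * (g τ * c ⁻¹) ^ suc p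
        ≈⟨ *-congˡ (^-distrib-* (g τ) (c ⁻¹) (suc p)) ⟩
      fromℕ (suc p) * g τ ^ p * ρ ^ s * (g τ ^ suc p * (c ⁻¹) ^ suc p)
        ≈⟨ solve 5 (λ n a e b i → n :* a :* e :* (b :* i) := n :* i :* (a :* b :* e)) refl _ _ _ _ _ ⟩
      fromℕ (suc p) * (c ⁻¹) ^ suc p * (g τ ^ p * g τ ^ suc p * ρ ^ s)
        ≈⟨ *-congˡ (*-congʳ (^-homo-* (g τ) p (suc p))) ⟨
      fromℕ (suc p) * (c ⁻¹) ^ suc p * envelope (p ℕ.+ suc p) τ
        ≤⟨ *-monoʳ-≤ (envelope-nonNeg (p ℕ.+ suc p) τ) (*-monoʳ-≤ 0≤c⁻¹^ (x≤y+x (*-nonNeg 0≤2 0≤taylorConstant))) ⟩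
      errorBound τ
        ∎
      where
      open ≤-Reasoning
      s = totalSize τ
      0≤bound : 0# ≤ fromℕ (suc p) * g τ ^ p
      0≤bound = *-nonNeg (fromℕ-nonNeg (suc p)) (0≤g^ τ p)

    error : ∀ τ → ∣ restricted τ - approximation τ ∣ ≤ errorBound τ
    error τ = case lem {Fits τ} of λ { (yes fits) → error-on τ fits ; (no ¬fits) → error-off τ ¬fits }

    target : ℝ
    target = ∑< (suc p) (λ k → coef k * M k)

    difference-HasSum : HasSum (λ τ → restricted τ - approximation τ) (Z α N t - target)
    difference-HasSum = HasSum-cong
      (λ τ → solve 2 (λ a b → a :+ :- :1 :* b := a :- b) refl (restricted τ) (approximation τ))
      (solve 2 (λ a b → a :+ :- :1 :* b := a :- b) refl (Z α N t) target)
      (HasSum-+ Z-HasSum (HasSum-* (- 1#) approximation-HasSum))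

    E : ℝ
    E = proj₁ (envelope-BoundedBy (p ℕ.+ suc p))

    errorBound-BoundedBy : BoundedBy errorBound (D * (c ⁻¹) ^ suc p * E)
    errorBound-BoundedBy = BoundedBy-* {f = envelope (p ℕ.+ suc p)} (*-nonNeg 0≤D 0≤c⁻¹^) (proj₂ (envelope-BoundedBy (p ℕ.+ suc p)))
      where
      0≤D : 0# ≤ D
      0≤D = +-nonNeg (*-nonNeg 0≤2 0≤taylorConstant) (fromℕ-nonNeg (suc p))

    ∣Z-target∣≤ : ∣ Z α N t - target ∣ ≤ D * (c ⁻¹) ^ suc p * E
    ∣Z-target∣≤ = HasSum-bound {f = λ τ → restricted τ - approximation τ}
      (λ τs u → ≤-trans (∣∑∣≤ {g = errorBound} error τs) (errorBound-BoundedBy τs u)) difference-HasSum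

    ∣Z-X∣≤ : ∀ {X} → X ≈ target → ∣ Z α N t - X ∣ ≤ D * E / c ^ suc p
    ∣Z-X∣≤ X≈target = ≤-resp (∣∣-cong (+-congˡ (-‿cong (sym X≈target))))
      (trans (solve 3 (λ d i e → d :* i :* e := d :* e :* i) refl D _ E) (*-congˡ (sym (⁻¹-^ 0<c (suc p))))) ∣Z-target∣≤

    expansion : ∣ Z α N t - Θ α t / φ (q t) ^ 2 * ∑< (suc p) (λ k → coef k * 𝔼 α t (λ μ ν m → F α μ ν m ^ k)) ∣
                ≤ uniformConstant 1≤R p / c ^ suc p
    expansion = ∣Z-X∣≤ normalised

  -- Compact subsets of the open quadrant

  Open-∩ : ∀ {U V} → Open U → Open V → Open (λ z → U z × V z)
  Open-∩ U-open V-open x y (Uz , Vz) with U-open x y Uz | V-open x y Vz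
  ... | ε , 0<ε , U-ball | δ , 0<δ , V-ball with total ε δ
  ...   | inj₁ ε≤δ = ε , 0<ε , λ x′ y′ dx dy → U-ball x′ y′ dx dy , V-ball x′ y′ (<-≤-trans dx ε≤δ) (<-≤-trans dy ε≤δ)
  ...   | inj₂ δ≤ε = δ , 0<δ , λ x′ y′ dx dy → U-ball x′ y′ (<-≤-trans dx δ≤ε) (<-≤-trans dy δ≤ε) , V-ball x′ y′ dx dy

  x<y⇒0<y-x : ∀ {x y} → x < y → 0# < y - x
  x<y⇒0<y-x {x} x<y = <-resp (-‿inverseˡ x) (+-comm _ _) (+-mono-≤-< ≤-refl x<y)

  above-near : ∀ {c x x′} → ∣ x′ - x ∣ < x - c → c < x′
  above-near {c} {x} {x′} h = <-resp (solve 3 (λ c x x′ → x′ :- (x :- c) :+ :- (x′ :- x) := c) refl c x x′)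
    (solve 3 (λ c x x′ → x′ :- (x :- c) :+ (x :- c) := x′) refl c x x′) (+-mono-≤-< ≤-refl (≤-<-trans (-x≤∣x∣ _) h))

  below-near : ∀ {c x x′} → ∣ x′ - x ∣ < c - x → x′ < c
  below-near {c} {x} {x′} h = <-resp (solve 2 (λ x x′ → x :+ (x′ :- x) := x′) refl x x′)
    (solve 2 (λ x c → x :+ (c :- x) := c) refl x c) (+-mono-≤-< ≤-refl (≤-<-trans (x≤∣x∣ _) h))

  -- An increasing exhaustion of the open quadrant, with strict inequalities so that the sets are
  -- open and natural indices so that finitely many of them fit into one.
  Box : ℕ → Pred (ℝ × ℝ) 0ℓ
  Box n (x , y) = (fromℕ (suc n) ⁻¹ < x × x < fromℕ (suc n)) × (fromℕ (suc n) ⁻¹ < y × y < fromℕ (suc n))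

  Box-open : ∀ n → Open (Box n)
  Box-open n = Open-∩
    (Open-∩ (λ x y c<x → _ , x<y⇒0<y-x c<x , λ x′ y′ dx _ → above-near dx) (λ x y x<c → _ , x<y⇒0<y-x x<c , λ x′ y′ dx _ → below-near dx))
    (Open-∩ (λ x y c<y → _ , x<y⇒0<y-x c<y , λ x′ y′ _ dy → above-near dy) (λ x y y<c → _ , x<y⇒0<y-x y<c , λ x′ y′ _ dy → below-near dy))

  -- A bound on x + x⁻¹ controls both ends at once; passing from n to n + 1 makes the inequalities
  -- strict.
  between : ∀ {x} n → 0# < x → x + x ⁻¹ ≤ fromℕ n → fromℕ (suc n) ⁻¹ < x × x < fromℕ (suc n)
  between {x} n 0<x h = n⁻¹<x , <-1+n (≤-trans (x≤x+y (<⇒≤ (⁻¹-pos 0<x))) h)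
    where
    0<1+n = fromℕ-pos {suc n} (s≤s z≤n)
    <-1+n : ∀ {y} → y ≤ fromℕ n → y < fromℕ (suc n)
    <-1+n y≤n = <-resp (+-identityʳ _) (+-comm _ _) (+-mono-≤-< y≤n 0<1)
    n⁻¹<x : fromℕ (suc n) ⁻¹ < x
    n⁻¹<x = ≰⇒> λ x≤n⁻¹ → <⇒≱ (<-1+n (≤-trans (x≤y+x (<⇒≤ 0<x)) h)) (begin
      fromℕ (suc n)                          ≈⟨ ⁻¹-unique (⁻¹-pos 0<1+n) (trans (*-comm _ _) (*-⁻¹ 0<1+n)) ⟩
      fromℕ (suc n) ⁻¹ ⁻¹                    ≤⟨ ⁻¹-anti 0<x x≤n⁻¹ ⟩
      x ⁻¹                                   ∎)
      where open ≤-Reasoning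

  positive⇒Box : ∀ {x y} → 0# < x → 0# < y → ∃[ n ] Box n (x , y)
  positive⇒Box {x} {y} 0<x 0<y = proj₁ bound ,
    between (proj₁ bound) 0<x (≤-trans (x≤x+y (+-nonNeg (<⇒≤ 0<y) (<⇒≤ (⁻¹-pos 0<y)))) (proj₂ bound)) ,
    between (proj₁ bound) 0<y (≤-trans (x≤y+x (+-nonNeg (<⇒≤ 0<x) (<⇒≤ (⁻¹-pos 0<x)))) (proj₂ bound))
    where
    bound : ∃[ n ] x + x ⁻¹ + (y + y ⁻¹) ≤ fromℕ n
    bound = archimedean (x + x ⁻¹ + (y + y ⁻¹))

  within : ℝ → ℝ → Set
  within R x = R ⁻¹ ≤ x × x ≤ R

  within-mono : ∀ {x} n n′ → n ℕ.≤ n′ → fromℕ (suc n) ⁻¹ < x × x < fromℕ (suc n) → within (fromℕ (suc n′)) x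
  within-mono n n′ n≤n′ (l , u) =
    ≤-trans (⁻¹-anti (fromℕ-pos {suc n} (s≤s z≤n)) (fromℕ-mono {suc n} {suc n′} (s≤s n≤n′))) (<⇒≤ l) , ≤-trans (<⇒≤ u) (fromℕ-mono {suc n} {suc n′} (s≤s n≤n′))

  -- The sum of the indices stands in for their maximum: each of them is at most the sum, and the
  -- boxes increase.
  Any-Box⇒within : ∀ {x y} ns → Any (λ n → Box n (x , y)) ns →
    within (fromℕ (suc (ℕ.sum ns))) x × within (fromℕ (suc (ℕ.sum ns))) y
  Any-Box⇒within ns box with n , n∈ns , x-bounds , y-bounds ← Membership.find box =
    within-mono n (ℕ.sum ns) (All.lookup (All-≤sum ns) n∈ns) x-bounds , within-mono n (ℕ.sum ns) (All.lookup (All-≤sum ns) n∈ns) y-bounds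

  compact-bounded : (K : Pred (ℝ × ℝ) 0ℓ) → Compact K → (∀ t α → (t , α) ∈ K → 0# < t × 0# < α) →
    ∃[ R ] 1# ≤ R × (∀ t α → (t , α) ∈ K → within R t × within R α)
  compact-bounded K compact positive = fromℕ (suc (ℕ.sum ns)) , 1≤fromℕ {suc (ℕ.sum ns)} (s≤s z≤n) ,
    λ t α z∈K → Any-Box⇒within ns (proj₂ cover (t , α) z∈K)
    where
    cover : Σ[ ns ∈ List ℕ ] (∀ z → z ∈ K → Any (λ n → Box n z) ns)
    cover = compact ℕ Box Box-open λ (t , α) z∈K → positive⇒Box (proj₁ (positive t α z∈K)) (proj₂ (positive t α z∈K))
    ns : List ℕ
    ns = proj₁ cover

theorem2p5 : (lem : ExcludedMiddle 0ℓ) (reals : CompleteOrderedField) →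
    let open JackHeatTrace lem reals in
    (p : ℕ) (K : Pred (ℝ × ℝ) 0ℓ) → Compact K →
    (∀ t α → (t , α) ∈ K → 0# < t × 0# < α) →
    ∃[ C ] ∃[ N₀ ] (∀ N → 1 ℕ.≤ N → N₀ ℕ.≤ N → ∀ t α → (t , α) ∈ K →
    ∣ Z α N t
    - Θ α t / φ (q t) ^ 2
    * sum (λ (k : Fin (suc p)) → let r = toℕ k in
    (- t) ^ r / (fromℕ (r !) * (fromℕ N + α - 1#) ^ r)
    * 𝔼 α t (λ μ ν m → F α μ ν m ^ r)) ∣
    ≤ C / (fromℕ N + α - 1#) ^ suc p)
theorem2p5 lem reals p K compact positive =
  let open Expansion lem reals
      R , 1≤R , bounds = compact-bounded K compact positive
  -- From N = 2 on, N + α - 1 ≥ 1 for every α > 0, so that its inverse is at most 1.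
  in uniformConstant 1≤R p , 2 , λ N _ 2≤N t α z∈K →
    let (r≤t , t≤R) , (r≤α , α≤R) = bounds t α z∈K
        a , 2a≤N , N≤1+2a = halve N
    in Comparison.expansion 1≤R p r≤t t≤R r≤α α≤R {N} {a} 2a≤N N≤1+2a 2≤N
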